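{- Let $G=(V,E)$ be a finite bridgeless graph (loops and multiple edges allowed). Then $\varphi(G,q)$ is a polynomial function of degree $n(G)$ of positive integers $q$, and $\bar{\varphi}(G,q)$ is a polynomial function of nonnegative integers $q$. Writing $\varphi(G,t)$ and $\bar\varphi(G,t)$ for these polynomials, they satisfy the reciprocity law \[ \varphi(G,-t)=(-1)^{n(G)}\bar{\varphi}(G,t). \] Moreover, \[ \varphi(G,t)=\sum_{\rho\in [{\mathcal O}_{TC}(G)]} \varphi_{\rho}(G,t),\qquad \bar{\varphi}(G,t)=\sum_{\rho\in [{\mathcal O}_{TC}(G)]} \bar{\varphi}_{\rho}(G,t). \] In particular, $|\varphi(G,-1)|$ equals the number of totally cyclic orientations on $G$, and $|\varphi(G,0)|$ equals the number of Eulerian equivalence classes of totally cyclic orientations on $G$.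
   Context: An orientation $\varepsilon$ of $G$ assigns a direction (arrow) to every edge: for a non-loop edge $e$ with end-vertices $u\neq v$ one sets $\varepsilon(u,e)=-\varepsilon(v,e)\in\{1,-1\}$ ($\varepsilon(u,e)=1$ meaning the arrow goes from $u$ to $v$); a loop at $v$ receives one of its two possible directions; $\varepsilon(w,e)=0$ if $w$ is not an end-vertex of $e$. ${\mathcal O}(G)$ is the set of all orientations. For an abelian group $A$, an $A$-flow of $(G,\varepsilon)$ is a map $f:E\to A$ with $\sum_{e\in E}\varepsilon(v,e)f(e)=0$ for every $v\in V$, where a loop contributes $0$ (its head and tail at $v$ cancel); $F(G,\varepsilon;A)$ denotes the group of $A$-flows. A cut is a nonempty edge set $[S,V\setminus S]$ of all edges between $S$ and $V\setminus S$ for a nonempty proper $S\subset V$; it is directed in $\varepsilon$ if all its edges point from $S$ to $V\setminus S$ or all point from $V\setminus S$ to $S$. An orientation is totally cyclic if it has no directed cut; ${\mathcal O}_{TC}(G)$ is the set of totally cyclic orientations. Two orientations $\varepsilon_1,\varepsilon_2$ are Eulerian equivalent if the spanning subgraph with edge set $\{e: \varepsilon_1,\varepsilon_2 \text{ give } e \text{ opposite directions}\}$, oriented by $\varepsilon_1$, is directed Eulerian (in-degree equals out-degree at every vertex); this is an equivalence relation preserving total cyclicity, and $[{\mathcal O}_{TC}(G)]$ denotes a set containing exactly one representative of each equivalence class of totally cyclic orientations. $n(G)=|E|-|V|+c(G)$ where $c(G)$ is the number of connected components. $\varphi(G,q)$ is the (modular) flow polynomial: the number of nowhere-zero $A$-flows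 of $(G,\varepsilon)$ for any abelian group $A$ of order $q$ (independent of $\varepsilon$ and of $A$). For an orientation $\rho$ and integer $q$, $\varphi_{\rho}(G,q)=\#\{f\in F(G,\rho;\mathbb Z): 0<f(e)<q\ \forall e\}$ and $\bar\varphi_{\rho}(G,q)=\#\{f\in F(G,\rho;\mathbb Z): 0\le f(e)\le q\ \forall e\}$; for totally cyclic $\rho$ these are polynomial functions of $q$ (Ehrhart polynomials of the relevant flow polytopes), and $\varphi_\rho(G,t),\bar\varphi_\rho(G,t)$ denote these polynomials. Finally $\bar{\varphi}(G,q)=\#\{(\rho,f): \rho\in[{\mathcal O}_{TC}(G)],\ f\in F(G,\rho;\mathbb Z),\ 0\le f(e)\le q\ \forall e\in E\}$. -}

module Defs where

open import Data.Bool using (Bool; true; false; if_then_else_; not)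
import Data.Bool as B
open import Data.Nat as ℕ using (ℕ; zero; suc; _∸_)
open import Data.Integer as ℤ using (ℤ; +_; 0ℤ)
open import Data.Integer.Divisibility.Signed using (_∣?_) renaming (_∣_ to _∣ℤ_)
open import Data.Rational as ℚ using (ℚ; 0ℚ; 1ℚ)
open import Data.Fin as F using (Fin)
open import Data.Fin.Properties using (all?; any?)
open import Data.Fin.Subset using (Subset)
open import Data.Fin.Subset.Properties using (anySubset?)
open import Data.List.Relation.Unary.All using (All)
open import Data.List.Relation.Unary.Any using (Any)
open import Data.List.Relation.Unary.AllPairs using (AllPairs)
open import Function using (_∘_)
open import Data.Vec as V using (Vec; []; _∷_; lookup)
open import Data.List as L using (List; []; _∷_; concatMap; filter; length)
open import Data.Product using (Σ; ∃; ∃-syntax; _×_; _,_)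
open import Data.Sum using (_⊎_)
open import Data.Unit using (⊤)
open import Data.Nat.ListAction using () renaming (sum to sumℕ)
open import Function.Bundles using (_⇔_)
open import Function.Definitions using (Surjective)
open import Relation.Nullary using (¬_; Dec; yes; no)
open import Relation.Nullary.Decidable using (_×-dec_; _⊎-dec_; _→-dec_; ¬?)
open import Relation.Binary.PropositionalEquality using (_≡_; _≢_)

-- Finite graphs with loops and multiple edges.
-- V = Fin nv, E = Fin ne; every edge e has a reference tail tl e and
-- reference head hd e (a loop has tl e ≡ hd e).

record Graph : Set where
  field
    nv ne : ℕ
    tl hd : Fin ne → Fin nv
open Graph public

module _ (G : Graph) where

  IsLoop : Fin (ne G) → Set
  IsLoop e = tl G e ≡ hd G e

  data Walk (allowed : Fin (ne G) → Set) : Fin (nv G) → Fin (nv G) → Set where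
    stay : ∀ {u} → Walk allowed u u
    fwd  : ∀ {v} e → allowed e → Walk allowed (hd G e) v → Walk allowed (tl G e) v
    bwd  : ∀ {v} e → allowed e → Walk allowed (tl G e) v → Walk allowed (hd G e) v

  Connected : Fin (nv G) → Fin (nv G) → Set
  Connected = Walk (λ _ → ⊤)

  IsComponentCount : ℕ → Set
  IsComponentCount k =
    Σ (Fin (nv G) → Fin k) λ comp →
      Surjective _≡_ _≡_ comp × (∀ u v → (comp u ≡ comp v) ⇔ Connected u v)

  cyclomatic : ℕ → ℕ
  cyclomatic k = (ne G ℕ.+ k) ∸ nv G

  IsBridge : Fin (ne G) → Set
  IsBridge e = ¬ Walk (λ e′ → e′ ≢ e) (tl G e) (hd G e)

  Bridgeless : Set
  Bridgeless = ∀ e → ¬ IsBridge e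

  -- Orientations: o e ≡ true keeps the reference direction tl → hd,
  -- o e ≡ false reverses it (for a loop: the other of its two directions).
  Orientation : Set
  Orientation = Vec Bool (ne G)

  tailO headO : Orientation → Fin (ne G) → Fin (nv G)
  tailO o e = if lookup o e then tl G e else hd G e
  headO o e = if lookup o e then hd G e else tl G e

  inc : Orientation → Fin (nv G) → Fin (ne G) → ℤ
  inc o v e with tl G e F.≟ hd G e
  ... | yes _ = 0ℤ
  ... | no _ with v F.≟ tailO o e
  ...   | yes _ = + 1
  ...   | no _ with v F.≟ headO o e
  ...     | yes _ = ℤ.- (+ 1)
  ...     | no _ = 0ℤ

vecsOver : ∀ {A : Set} → List A → (n : ℕ) → List (Vec A n)
vecsOver xs zero    = [] ∷ []
vecsOver xs (suc n) = concatMap (λ x → L.map (x ∷_) (vecsOver xs n)) xs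

sumℤ : ∀ {n} → (Fin n → ℤ) → ℤ
sumℤ {zero}  f = 0ℤ
sumℤ {suc n} f = f F.zero ℤ.+ sumℤ (f ∘ F.suc)

sumℚ : ∀ {n} → (Fin n → ℚ) → ℚ
sumℚ {zero}  f = 0ℚ
sumℚ {suc n} f = f F.zero ℚ.+ sumℚ (f ∘ F.suc)

ℕtoℚ : ℕ → ℚ
ℕtoℚ n = (+ n) ℚ./ 1

signPow : ℕ → ℚ
signPow zero    = 1ℚ
signPow (suc n) = ℚ.- signPow n

-- polynomials with rational coefficients, constant term first
Poly : Set
Poly = List ℚ

eval : Poly → ℚ → ℚ
eval []       t = 0ℚ
eval (c ∷ cs) t = c ℚ.+ t ℚ.* eval cs t

HasDegree : Poly → ℕ → Set
HasDegree p d = Σ (Vec ℚ (suc d)) λ c → (V.toList c ≡ p) × (lookup c (F.fromℕ d) ≢ 0ℚ)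

module _ (G : Graph) where

  allOrientations : List (Orientation G)
  allOrientations = vecsOver (true ∷ false ∷ []) (ne G)

  refOrientation : Orientation G
  refOrientation = V.replicate (ne G) true

  netFlow : Orientation G → (Fin (ne G) → ℤ) → Fin (nv G) → ℤ
  netFlow o f v = sumℤ (λ e → inc G o v e ℤ.* f e)

  IsIntFlow : Orientation G → (Fin (ne G) → ℤ) → Set
  IsIntFlow o f = ∀ v → netFlow o f v ≡ 0ℤ

  isIntFlow? : ∀ o f → Dec (IsIntFlow o f)
  isIntFlow? o f = all? (λ v → netFlow o f v ℤ.≟ 0ℤ)

  -- nowhere-zero Z_q-flow of (G, reference orientation); Z_q = Fin q,
  -- the flow condition being that each net flow is ≡ 0 mod q.
  IsNZModFlow : (q : ℕ) → Vec (Fin q) (ne G) → Set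
  IsNZModFlow q f =
    (∀ e → F.toℕ (lookup f e) ≢ 0) ×
    (∀ v → (+ q) ∣ℤ netFlow refOrientation (λ e → + F.toℕ (lookup f e)) v)

  isNZModFlow? : ∀ q f → Dec (IsNZModFlow q f)
  isNZModFlow? q f =
    all? (λ e → ¬? (F.toℕ (lookup f e) ℕ.≟ 0)) ×-dec
    all? (λ v → (+ q) ∣? netFlow refOrientation (λ e → + F.toℕ (lookup f e)) v)

  φ : ℕ → ℕ
  φ q = length (filter (isNZModFlow? q) (vecsOver (L.allFin q) (ne G)))

  -- φ_ρ(G,q) = #{ f ∈ F(G,ρ;Z) : 0 < f(e) < q }
  -- (such f are exactly the vectors of values in {1,…,q-1} = nonzero Fin q)
  PosFlowBelow : Orientation G → (q : ℕ) → Vec (Fin q) (ne G) → Set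
  PosFlowBelow ρ q f =
    (∀ e → F.toℕ (lookup f e) ≢ 0) × IsIntFlow ρ (λ e → + F.toℕ (lookup f e))

  φρ : Orientation G → ℕ → ℕ
  φρ ρ q = length (filter (λ f → all? (λ e → ¬? (F.toℕ (lookup f e) ℕ.≟ 0))
                                 ×-dec isIntFlow? ρ (λ e → + F.toℕ (lookup f e)))
                          (vecsOver (L.allFin q) (ne G)))

  φ̄ρ : Orientation G → ℕ → ℕ
  φ̄ρ ρ q = length (filter (λ f → isIntFlow? ρ (λ e → + F.toℕ (lookup f e)))
                          (vecsOver (L.allFin (suc q)) (ne G)))

  Crosses : Subset (nv G) → Fin (ne G) → Set
  Crosses S e = lookup S (tl G e) ≢ lookup S (hd G e)

  crosses? : ∀ S e → Dec (Crosses S e)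
  crosses? S e = ¬? (lookup S (tl G e) B.≟ lookup S (hd G e))

  DirectedCut : Orientation G → Subset (nv G) → Set
  DirectedCut o S =
    (∃[ v ] lookup S v ≡ true) × (∃[ v ] lookup S v ≡ false) ×
    (∃[ e ] Crosses S e) ×
    ((∀ e → Crosses S e → lookup S (tailO G o e) ≡ true) ⊎
     (∀ e → Crosses S e → lookup S (tailO G o e) ≡ false))

  directedCut? : ∀ o S → Dec (DirectedCut o S)
  directedCut? o S =
    any? (λ v → lookup S v B.≟ true) ×-dec
    any? (λ v → lookup S v B.≟ false) ×-dec
    any? (crosses? S) ×-dec
    (all? (λ e → crosses? S e →-dec (lookup S (tailO G o e) B.≟ true)) ⊎-dec
     all? (λ e → crosses? S e →-dec (lookup S (tailO G o e) B.≟ false)))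

  TotallyCyclic : Orientation G → Set
  TotallyCyclic o = ¬ (∃[ S ] DirectedCut o S)

  totallyCyclic? : ∀ o → Dec (TotallyCyclic o)
  totallyCyclic? o = ¬? (anySubset? (directedCut? o))

  numTC : ℕ
  numTC = length (filter totallyCyclic? allOrientations)

  Differ : Orientation G → Orientation G → Fin (ne G) → Set
  Differ o₁ o₂ e = lookup o₁ e ≢ lookup o₂ e

  outDegD inDegD : Orientation G → Orientation G → Fin (nv G) → ℕ
  outDegD o₁ o₂ v = length (filter (λ e → ¬? (lookup o₁ e B.≟ lookup o₂ e)
                                           ×-dec (tailO G o₁ e F.≟ v)) (L.allFin (ne G)))
  inDegD o₁ o₂ v = length (filter (λ e → ¬? (lookup o₁ e B.≟ lookup o₂ e)
                                          ×-dec (headO G o₁ e F.≟ v)) (L.allFin (ne G)))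

  EulerianEquiv : Orientation G → Orientation G → Set
  EulerianEquiv o₁ o₂ = ∀ v → outDegD o₁ o₂ v ≡ inDegD o₁ o₂ v

  IsTCRepresentatives : List (Orientation G) → Set
  IsTCRepresentatives R =
    All TotallyCyclic R ×
    (∀ o → TotallyCyclic o → Any (λ r → EulerianEquiv r o) R) ×
    AllPairs (λ a b → ¬ EulerianEquiv a b) R

  φ̄ : List (Orientation G) → ℕ → ℕ
  φ̄ R q = sumℕ (L.map (λ ρ → φ̄ρ ρ q) R)

{-# OPTIONS --safe #-}

-- Write a flow f of an orientation ρ with 0 ≤ f ≤ q as a vector h on the reference orientation:
-- h e = f e where ρ keeps the edge e, and h e = q - f e where ρ reverses it.  If r is the indicator
-- of the reversed edges, then f is a flow iff ∂ h = q ∂ r.  Two orientations are Eulerian equivalent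
-- iff their ∂ r agree, and by integral rounding (Hoffman's theorem, proved by uncrossing violated
-- cuts) every h in [0,q]^E with q ∣ ∂ h satisfies ∂ h = q ∂ r for some r.  Moreover a set S of
-- vertices is closed under the arcs of ρ iff ∂ r (S) is the number of reference edges leaving S, so iff
-- ∂ h (S) is q times that number; so total cyclicity of ρ can be read off h.  Summing over
-- representatives, φ(q) counts the h in (0,q)^E with q ∣ ∂ h, and φ̄(q) counts the totally cyclic h
-- in [0,q]^E with q ∣ ∂ h.
--
-- These two counts obey φ(G) = φ(G/e) - φ(G-e) and φ̄(G) = φ̄(G/e) + φ̄(G-e) for an edge e that is not
-- a bridge, both vanish if e is a bridge, and both equal q^n when all edges are contracted.  This
-- gives polynomiality, the degree and the reciprocity law.
--
-- For a single ρ, the lattice points h of the q-th dilate of a face of {h ∈ [0,1]^E : ∂ h = ∂ r} are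
-- counted by pulling at a vertex y: those avoiding the facets opposite to y are a translate by y of
-- the points of the (q-1)-st dilate, and the others lie on smaller faces.
module Submission where

-- Contraction never identifies vertices. A graph is given by two edge lists A and B over a fixed
-- vertex set, and contracting e moves it from A to B, where its value is free. A contracted loop
-- then leaves a free value behind, so one recursion covers loops as well. Conservation is imposed
-- on all vertex sets S instead of single vertices: closed sets, bridges and the cut condition of
-- Hoffman's theorem then all speak of the same ∂, and each of these properties is decidable by
-- enumerating subsets.
--
-- The corank r of an edge set is characterised by its having q^r flows modulo q. Deleting an edge
-- that is not a bridge lowers it by one, so the deletion term never reaches the leading
-- coefficient.
--
-- The recursion says nothing about q = 0. There the values of φ̄ come from the polynomials of the
-- single φ̄_ρ, which are valid at 0, together with the fact that polynomials agreeing at all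
-- positive integers are equal everywhere.

-- Sums over integer intervals and boxes

module BoxSums where
  open import Data.Nat as ℕ using (ℕ; zero; suc)
  import Data.Nat.Properties as ℕ
  open import Data.Integer using (ℤ; +_; -[1+_]; +<+; 0ℤ; 1ℤ; _+_; _-_; _*_; -_; _≤_; _<_)
  open import Data.Integer.Properties
  open import Data.Integer.Tactic.RingSolver using (solve-∀)
  open import Data.Bool using (if_then_else_)
  open import Data.Product using (_×_; _,_)
  open import Data.Vec using (Vec; []; _∷_)
  open import Data.Vec.Relation.Binary.Pointwise.Inductive using (Pointwise; []; _∷_)
  open import Function using (_∘_)
  open import Relation.Nullary using (¬_; Dec; yes; no; does; contradiction)
  open import Relation.Binary.PropositionalEquality using (_≡_; refl; sym; trans; cong; cong₂; subst; module ≡-Reasoning)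

  private variable
    n : ℕ
    P Q : Set

  -- The ring solver proves identities only. Comparing differences turns a linear consequence of an
  -- inequality into such an identity.
  ≤-by-difference : ∀ {x y x′ y′} → x ≤ y → y′ - x′ ≡ y - x → x′ ≤ y′
  ≤-by-difference x≤y eq = 0≤i-j⇒j≤i (subst (0ℤ ≤_) (sym eq) (i≤j⇒0≤j-i x≤y))

  ≡-by-difference : ∀ {x y x′ y′} → x ≡ y → x′ - y′ ≡ x - y → x′ ≡ y′
  ≡-by-difference {x} {y} {x′} {y′} x≡y eq = i-j≡0⇒i≡j x′ y′ (trans eq (i≡j⇒i-j≡0 x≡y))

  𝟙 : Dec P → ℤ
  𝟙 d = if does d then 1ℤ else 0ℤ

  𝟙-yes : (d : Dec P) → P → 𝟙 d ≡ 1ℤ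
  𝟙-yes (yes _) p = refl
  𝟙-yes (no ¬p) p = contradiction p ¬p

  𝟙-no : (d : Dec P) → ¬ P → 𝟙 d ≡ 0ℤ
  𝟙-no (yes p) ¬p = contradiction p ¬p
  𝟙-no (no _) ¬p = refl

  𝟙-cong : (d : Dec P) (e : Dec Q) → (P → Q) → (Q → P) → 𝟙 d ≡ 𝟙 e
  𝟙-cong (yes p) e f g = sym (𝟙-yes e (f p))
  𝟙-cong (no ¬p) e f g = sym (𝟙-no e (¬p ∘ g))

  Σr : ℤ → ℕ → (ℤ → ℤ) → ℤ
  Σr l zero    f = 0ℤ
  Σr l (suc k) f = f l + Σr (l + 1ℤ) k f

  Σr-cong′ : ∀ l k {f g : ℤ → ℤ} → (∀ a → l ≤ a → a < l + + k → f a ≡ g a) → Σr l k f ≡ Σr l k g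
  Σr-cong′ l zero    h = refl
  Σr-cong′ l (suc k) h = cong₂ _+_ (h l ≤-refl l<)
    (Σr-cong′ (l + 1ℤ) k λ a l≤a a< →
      h a (≤-trans (i≤i+j l 1ℤ) l≤a) (subst (a <_) (shift l (+ k)) a<))
    where
    shift : ∀ l k → l + 1ℤ + k ≡ l + (1ℤ + k)
    shift = solve-∀
    l< : l < l + + suc k
    l< = subst (_< l + + suc k) (+-identityʳ l) (+-monoʳ-< l (+<+ (ℕ.s≤s ℕ.z≤n)))

  Σr-cong : ∀ l k {f g : ℤ → ℤ} → (∀ a → f a ≡ g a) → Σr l k f ≡ Σr l k g
  Σr-cong l k h = Σr-cong′ l k (λ a _ _ → h a)

  private
    interchange : ∀ a b c d → (a + b) + (c + d) ≡ (a + c) + (b + d)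
    interchange = solve-∀

  Σr-+ : ∀ l k (f g : ℤ → ℤ) → Σr l k (λ a → f a + g a) ≡ Σr l k f + Σr l k g
  Σr-+ l zero    f g = refl
  Σr-+ l (suc k) f g = trans (cong (_+_ (f l + g l)) (Σr-+ (l + 1ℤ) k f g))
    (interchange (f l) (g l) (Σr (l + 1ℤ) k f) (Σr (l + 1ℤ) k g))

  Σr-0 : ∀ l k → Σr l k (λ _ → 0ℤ) ≡ 0ℤ
  Σr-0 l zero    = refl
  Σr-0 l (suc k) = trans (+-identityˡ _) (Σr-0 (l + 1ℤ) k)

  Σr-const : ∀ l k c → Σr l k (λ _ → c) ≡ + k * c
  Σr-const l zero    c = sym (*-zeroˡ c)
  Σr-const l (suc k) c = trans (cong (_+_ c) (Σr-const (l + 1ℤ) k c)) (lemma c (+ k))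
    where
    lemma : ∀ c k → c + k * c ≡ (1ℤ + k) * c
    lemma = solve-∀

  Σr-shift : ∀ l k c (f : ℤ → ℤ) → Σr l k (λ a → f (a + c)) ≡ Σr (l + c) k f
  Σr-shift l zero    c f = refl
  Σr-shift l (suc k) c f = cong (_+_ (f (l + c)))
    (trans (Σr-shift (l + 1ℤ) k c f) (cong (λ x → Σr x k f) (lemma l c)))
    where
    lemma : ∀ l c → l + 1ℤ + c ≡ l + c + 1ℤ
    lemma = solve-∀

  Σr-snoc : ∀ l k (f : ℤ → ℤ) → Σr l (suc k) f ≡ Σr l k f + f (l + + k)
  Σr-snoc l zero f = trans (+-comm (f l) 0ℤ) (cong (λ x → 0ℤ + f x) (sym (+-identityʳ l)))
  Σr-snoc l (suc k) f = trans (cong (_+_ (f l)) (Σr-snoc (l + 1ℤ) k f))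
    (trans (sym (+-assoc (f l) _ _)) (cong (λ x → f l + Σr (l + 1ℤ) k f + f x) (lemma l (+ k))))
    where
    lemma : ∀ l k → l + 1ℤ + k ≡ l + (1ℤ + k)
    lemma = solve-∀

  -- The equation says that c is the sum of the first and the last argument, so a ↦ c - a reverses
  -- the interval.
  Σr-reflect : ∀ l k c (f : ℤ → ℤ) → c ≡ l + l + + k - 1ℤ → Σr l k (λ a → f (c - a)) ≡ Σr l k f
  Σr-reflect l zero c f eq = refl
  Σr-reflect l (suc k) c f refl = begin
    f (c - l) + Σr (l + 1ℤ) k (λ a → f (c - a))
      ≡⟨ cong₂ _+_ (cong f (e₁ l (+ k))) (sym (Σr-shift l k 1ℤ (λ a → f (c - a)))) ⟩
    f (l + + k) + Σr l k (λ a → f (c - (a + 1ℤ)))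
      ≡⟨ cong (_+_ (f (l + + k))) (trans (Σr-cong l k λ a → cong f (e₂ l (+ k) a)) (Σr-reflect l k _ f refl)) ⟩
    f (l + + k) + Σr l k f
      ≡⟨ +-comm (f (l + + k)) _ ⟩
    Σr l k f + f (l + + k)
      ≡⟨ Σr-snoc l k f ⟨
    Σr l (suc k) f ∎
    where
    open ≡-Reasoning
    e₁ : ∀ l k → l + l + (1ℤ + k) - 1ℤ - l ≡ l + k
    e₁ = solve-∀
    e₂ : ∀ l k a → l + l + (1ℤ + k) - 1ℤ - (a + 1ℤ) ≡ l + l + k - 1ℤ - a
    e₂ = solve-∀

  -- Telescoping makes the sum over a full period invariant under translation by one.
  Σr-periodic : ∀ k (f : ℤ → ℤ) → (∀ a → f (a + + k) ≡ f a) → ∀ l c → Σr l k (λ a → f (a + c)) ≡ Σr l k f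
  Σr-periodic k f per l c = trans (Σr-shift l k c f) (trans (start (l + c)) (sym (start l)))
    where
    step : ∀ l → Σr (l + 1ℤ) k f ≡ Σr l k f
    step l = ≡-by-difference (begin
      Σr (l + 1ℤ) k f + f l     ≡⟨ +-comm _ (f l) ⟩
      f l + Σr (l + 1ℤ) k f     ≡⟨ Σr-snoc l k f ⟩
      Σr l k f + f (l + + k)    ≡⟨ cong (_+_ (Σr l k f)) (per l) ⟩
      Σr l k f + f l            ∎) (lemma (Σr (l + 1ℤ) k f) (Σr l k f) (f l))
      where
      open ≡-Reasoning
      lemma : ∀ x y z → x - y ≡ x + z - (y + z)
      lemma = solve-∀
    start : ∀ l → Σr l k f ≡ Σr 0ℤ k f
    start (+ zero) = refl
    start (+ suc m) = trans (cong (λ x → Σr x k f) (+-comm 1ℤ (+ m))) (trans (step (+ m)) (start (+ m)))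
    start -[1+ zero ] = sym (step _)
    start -[1+ suc m ] = trans (sym (step _)) (start -[1+ m ])

  -- A box is a product of integer intervals, each given by its least element and its length.
  Box : ℕ → Set
  Box = Vec (ℤ × ℕ)

  ΣB : Box n → (Vec ℤ n → ℤ) → ℤ
  ΣB []            w = w []
  ΣB ((l , k) ∷ D) w = Σr l k λ a → ΣB D λ h → w (a ∷ h)

  _∈I_ : ℤ → ℤ × ℕ → Set
  a ∈I (l , k) = l ≤ a × a < l + + k

  _∈B_ : Vec ℤ n → Box n → Set
  h ∈B D = Pointwise _∈I_ h D

  ΣB-cong′ : (D : Box n) {v w : Vec ℤ n → ℤ} → (∀ h → h ∈B D → v h ≡ w h) → ΣB D v ≡ ΣB D w
  ΣB-cong′ []            eq = eq [] []
  ΣB-cong′ ((l , k) ∷ D) eq = Σr-cong′ l k λ a l≤a a< → ΣB-cong′ D λ h h∈D → eq (a ∷ h) ((l≤a , a<) ∷ h∈D)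

  ΣB-cong : (D : Box n) {v w : Vec ℤ n → ℤ} → (∀ h → v h ≡ w h) → ΣB D v ≡ ΣB D w
  ΣB-cong D eq = ΣB-cong′ D (λ h _ → eq h)

  ΣB-+ : (D : Box n) (v w : Vec ℤ n → ℤ) → ΣB D (λ h → v h + w h) ≡ ΣB D v + ΣB D w
  ΣB-+ []            v w = refl
  ΣB-+ ((l , k) ∷ D) v w = trans (Σr-cong l k λ a → ΣB-+ D _ _) (Σr-+ l k _ _)

  ΣB-0 : (D : Box n) → ΣB D (λ _ → 0ℤ) ≡ 0ℤ
  ΣB-0 []            = refl
  ΣB-0 ((l , k) ∷ D) = trans (Σr-cong l k λ a → ΣB-0 D) (Σr-0 l k)

  ΣB-Σr-swap : (D : Box n) → ∀ l k (w : ℤ → Vec ℤ n → ℤ) →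
    ΣB D (λ h → Σr l k λ a → w a h) ≡ Σr l k (λ a → ΣB D (w a))
  ΣB-Σr-swap D l zero    w = ΣB-0 D
  ΣB-Σr-swap D l (suc k) w = trans (ΣB-+ D (w l) _) (cong (_+_ (ΣB D (w l))) (ΣB-Σr-swap D (l + 1ℤ) k w))

-- Boundaries on cuts and Hoffman's theorem

module CutPairing where
  open BoxSums
  open import Data.Nat as ℕ using (ℕ; zero; suc)
  import Data.Nat.Properties as ℕ
  open import Data.Integer using (ℤ; +_; 0ℤ; 1ℤ; _+_; _-_; _*_; -_; _≤_; +≤+; +<+; NonZero)
  open import Data.Integer.Properties
  open import Data.Integer.Tactic.RingSolver using (solve-∀)
  open import Data.Bool using (Bool; true; false; _∨_; _∧_)
  open import Data.Empty using (⊥)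
  open import Data.Fin using (Fin)
  open import Data.Fin.Subset using (Subset; _∪_; _∩_; ∁; ⊤) renaming (⊥ to ∅)
  open import Data.Fin.Subset.Properties using (anySubset?; p∪∁p≡⊤; ∩-inverseʳ)
  open import Data.Product using (Σ; _×_; _,_; proj₁; proj₂)
  open import Data.Vec using (Vec; []; _∷_; lookup; map; zipWith; replicate)
  open import Data.Vec.Properties using (lookup-zipWith; lookup-replicate)
  open import Data.Vec.Relation.Binary.Pointwise.Inductive using ([]; _∷_)
  open import Relation.Nullary using (¬_; Dec; yes; no; contradiction)
  open import Relation.Nullary.Decidable using (¬?; decidable-stable)
  open import Relation.Binary.PropositionalEquality using (_≡_; refl; sym; trans; cong; cong₂; subst; module ≡-Reasoning)

  private variable
    ν n : ℕ

  allSubsets? : {P : Subset ν → Set} → (∀ S → Dec (P S)) → Dec (∀ S → P S)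
  allSubsets? P? with anySubset? (λ S → ¬? (P? S))
  ... | yes (S , ¬p) = no λ all → ¬p (all S)
  ... | no none      = yes λ S → decidable-stable (P? S) λ ¬p → none (S , ¬p)

  Edge : ℕ → Set
  Edge ν = Fin ν × Fin ν

  bit : Bool → ℤ
  bit true  = 1ℤ
  bit false = 0ℤ

  -- The incidence of an edge with a cut: 1 if the edge leaves S, -1 if it enters S, 0 if it does
  -- not cross.
  c : Edge ν → Subset ν → ℤ
  c (a , b) S = bit (lookup S a) - bit (lookup S b)

  -- The net amount of h leaving S.
  ∂ : Vec (Edge ν) n → Vec ℤ n → Subset ν → ℤ
  ∂ []       []      S = 0ℤ
  ∂ (e ∷ es) (x ∷ h) S = c e S * x + ∂ es h S

  ∂-+ : (es : Vec (Edge ν) n) (h y : Vec ℤ n) → ∀ S → ∂ es (zipWith _+_ h y) S ≡ ∂ es h S + ∂ es y S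
  ∂-+ []       []      []      S = refl
  ∂-+ (e ∷ es) (x ∷ h) (z ∷ y) S = trans (cong (_+_ (c e S * (x + z))) (∂-+ es h y S))
    (lemma (c e S) x z (∂ es h S) (∂ es y S))
    where
    lemma : ∀ c x z u v → c * (x + z) + (u + v) ≡ (c * x + u) + (c * z + v)
    lemma = solve-∀

  ∂-0 : (es : Vec (Edge ν) n) → ∀ S → ∂ es (replicate n 0ℤ) S ≡ 0ℤ
  ∂-0 []       S = refl
  ∂-0 (e ∷ es) S = trans (cong₂ _+_ (*-zeroʳ (c e S)) (∂-0 es S)) refl

  -- A demand on the vertices with total zero, given by its sums over vertex sets. This is the form
  -- in which cut conditions and uncrossing use it.
  record Modular (d : Subset ν → ℤ) : Set where
    field
      modular : ∀ S T → d (S ∪ T) + d (S ∩ T) ≡ d S + d T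
      at-⊤    : d ⊤ ≡ 0ℤ
      at-∅    : d ∅ ≡ 0ℤ
  open Modular public

  private
    bit-∨∧ : ∀ x y → bit (x ∨ y) + bit (x ∧ y) ≡ bit x + bit y
    bit-∨∧ true  true  = refl
    bit-∨∧ true  false = refl
    bit-∨∧ false true  = refl
    bit-∨∧ false false = refl

    rearrange-c : ∀ a b a′ b′ → (a - b) + (a′ - b′) ≡ (a + a′) - (b + b′)
    rearrange-c = solve-∀

  bit-modular : ∀ (a : Fin ν) S T →
    bit (lookup (S ∪ T) a) + bit (lookup (S ∩ T) a) ≡ bit (lookup S a) + bit (lookup T a)
  bit-modular a S T rewrite lookup-zipWith _∨_ a S T | lookup-zipWith _∧_ a S T = bit-∨∧ (lookup S a) (lookup T a)

  c-modular : (e : Edge ν) → Modular (c e)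
  c-modular (a , b) .modular S T = begin
    (bit (lookup (S ∪ T) a) - bit (lookup (S ∪ T) b)) + (bit (lookup (S ∩ T) a) - bit (lookup (S ∩ T) b))
      ≡⟨ rearrange-c (bit (lookup (S ∪ T) a)) (bit (lookup (S ∪ T) b)) (bit (lookup (S ∩ T) a)) (bit (lookup (S ∩ T) b)) ⟩
    (bit (lookup (S ∪ T) a) + bit (lookup (S ∩ T) a)) - (bit (lookup (S ∪ T) b) + bit (lookup (S ∩ T) b))
      ≡⟨ cong₂ _-_ (bit-modular a S T) (bit-modular b S T) ⟩
    (bit (lookup S a) + bit (lookup T a)) - (bit (lookup S b) + bit (lookup T b))
      ≡⟨ rearrange-c (bit (lookup S a)) (bit (lookup S b)) (bit (lookup T a)) (bit (lookup T b)) ⟨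
    (bit (lookup S a) - bit (lookup S b)) + (bit (lookup T a) - bit (lookup T b)) ∎
    where open ≡-Reasoning
  c-modular (a , b) .at-⊤ rewrite lookup-replicate a true | lookup-replicate b true = refl
  c-modular (a , b) .at-∅ rewrite lookup-replicate a false | lookup-replicate b false = refl

  module _ {d d′ : Subset ν → ℤ} (M : Modular d) (M′ : Modular d′) (x : ℤ) where
    modular-combine : Modular (λ S → d S * x + d′ S)
    modular-combine .modular S T =
      trans (lemma (d (S ∪ T)) (d (S ∩ T)) x (d′ (S ∪ T)) (d′ (S ∩ T)))
        (trans (cong₂ (λ u v → u * x + v) (M .modular S T) (M′ .modular S T))
          (sym (lemma (d S) (d T) x (d′ S) (d′ T))))
      where
      lemma : ∀ a b x a′ b′ → (a * x + a′) + (b * x + b′) ≡ (a + b) * x + (a′ + b′)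
      lemma = solve-∀
    modular-combine .at-⊤ rewrite M .at-⊤ | M′ .at-⊤ = refl
    modular-combine .at-∅ rewrite M .at-∅ | M′ .at-∅ = refl

  0-modular : Modular {ν} (λ _ → 0ℤ)
  0-modular .modular S T = refl
  0-modular .at-⊤ = refl
  0-modular .at-∅ = refl

  ∂-modular : (es : Vec (Edge ν) n) (h : Vec ℤ n) → Modular (∂ es h)
  ∂-modular []       []      = 0-modular
  ∂-modular (e ∷ es) (x ∷ h) = modular-combine (c-modular e) (∂-modular es h) x

  -- With d = ∂ h this is the boundary of h / q, handled without leaving ℤ.
  modular-quotient : ∀ q .{{_ : NonZero q}} {d d′ : Subset ν → ℤ} → Modular d → (∀ S → d S ≡ d′ S * q) → Modular d′
  modular-quotient q {d} {d′} M eq .modular S T = *-cancelʳ-≡ _ _ q (begin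
    (d′ (S ∪ T) + d′ (S ∩ T)) * q    ≡⟨ *-distribʳ-+ q (d′ (S ∪ T)) (d′ (S ∩ T)) ⟩
    d′ (S ∪ T) * q + d′ (S ∩ T) * q  ≡⟨ cong₂ _+_ (sym (eq (S ∪ T))) (sym (eq (S ∩ T))) ⟩
    d (S ∪ T) + d (S ∩ T)            ≡⟨ M .modular S T ⟩
    d S + d T                        ≡⟨ cong₂ _+_ (eq S) (eq T) ⟩
    d′ S * q + d′ T * q              ≡⟨ *-distribʳ-+ q (d′ S) (d′ T) ⟨
    (d′ S + d′ T) * q                ∎)
    where open ≡-Reasoning
  modular-quotient q M eq .at-⊤ = *-cancelʳ-≡ _ 0ℤ q (trans (sym (eq ⊤)) (M .at-⊤))
  modular-quotient q M eq .at-∅ = *-cancelʳ-≡ _ 0ℤ q (trans (sym (eq ∅)) (M .at-∅))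

  -- An interval (l , w) is {l, …, l + w}; it is never empty.
  capE : ℤ × ℕ → Bool → Bool → ℤ
  capE (l , w) true  false = l + + w
  capE (l , w) false true  = - l
  capE (l , w) true  true  = 0ℤ
  capE (l , w) false false = 0ℤ

  -- The largest net amount that a vector within the bounds can send out of S: the right-hand side
  -- of Hoffman's condition.
  cap : Vec (Edge ν) n → Vec (ℤ × ℕ) n → Subset ν → ℤ
  cap []             []       S = 0ℤ
  cap ((a , b) ∷ es) (I ∷ bs) S = capE I (lookup S a) (lookup S b) + cap es bs S

  -- Equality holds unless one end of the edge lies only in S and the other only in T. Then the edge
  -- crosses neither the union nor the intersection, while its two capacities add up to the width w
  -- ≥ 0.
  capE-submodular : ∀ I x₁ y₁ x₂ y₂ →
    capE I (x₁ ∨ x₂) (y₁ ∨ y₂) + capE I (x₁ ∧ x₂) (y₁ ∧ y₂) ≤ capE I x₁ y₁ + capE I x₂ y₂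
  capE-submodular (l , w) true  false false true  =
    ≤-by-difference {0ℤ} {+ w} (+≤+ ℕ.z≤n) (lemma l (+ w))
    where
    lemma : ∀ l w → l + w + - l - (0ℤ + 0ℤ) ≡ w - 0ℤ
    lemma = solve-∀
  capE-submodular (l , w) false true  true  false =
    ≤-by-difference {0ℤ} {+ w} (+≤+ ℕ.z≤n) (lemma l (+ w))
    where
    lemma : ∀ l w → - l + (l + w) - (0ℤ + 0ℤ) ≡ w - 0ℤ
    lemma = solve-∀
  capE-submodular I true  true  true  y₂    = ≤-refl
  capE-submodular I true  true  false true  = ≤-refl
  capE-submodular I true  true  false false = ≤-refl
  capE-submodular I true  false true  true  = ≤-reflexive (+-comm 0ℤ (capE I true false))
  capE-submodular I true  false true  false = ≤-refl
  capE-submodular I true  false false false = ≤-refl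
  capE-submodular I false true  true  true  = ≤-reflexive (+-comm 0ℤ (capE I false true))
  capE-submodular I false true  false true  = ≤-refl
  capE-submodular I false true  false false = ≤-refl
  capE-submodular I false false true  y₂    = ≤-reflexive (+-comm (capE I true y₂) 0ℤ)
  capE-submodular I false false false true  = ≤-reflexive (+-comm (capE I false true) 0ℤ)
  capE-submodular I false false false false = ≤-refl

  cap-submodular : (es : Vec (Edge ν) n) (bs : Vec (ℤ × ℕ) n) → ∀ S T →
    cap es bs (S ∪ T) + cap es bs (S ∩ T) ≤ cap es bs S + cap es bs T
  cap-submodular []             []       S T = ≤-refl
  cap-submodular ((a , b) ∷ es) (I ∷ bs) S T
    rewrite lookup-zipWith _∨_ a S T | lookup-zipWith _∧_ a S T
          | lookup-zipWith _∨_ b S T | lookup-zipWith _∧_ b S T =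
    ≤-by-difference
      (+-mono-≤ (capE-submodular I (lookup S a) (lookup S b) (lookup T a) (lookup T b)) (cap-submodular es bs S T))
      (lemma (capE I (lookup S a) (lookup S b)) (capE I (lookup T a) (lookup T b))
             (cap es bs S) (cap es bs T)
             (capE I (lookup S a ∨ lookup T a) (lookup S b ∨ lookup T b))
             (capE I (lookup S a ∧ lookup T a) (lookup S b ∧ lookup T b))
             (cap es bs (S ∪ T)) (cap es bs (S ∩ T)))
    where
    lemma : ∀ x y X Y u v U V → (x + X) + (y + Y) - ((u + U) + (v + V)) ≡ (x + y) + (X + Y) - ((u + v) + (U + V))
    lemma = solve-∀

  interval : ℤ × ℕ → ℤ × ℕ
  interval (l , w) = l , suc w

  module _ {d : Subset ν → ℤ} (e : Edge ν) (K : Subset ν → ℤ) (M : Modular d) (l : ℤ) (w : ℕ) where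
    private
      a = proj₁ e
      b = proj₂ e
      u = l + + suc w

    -- Three cut conditions for one edge e. `Full` lets e range over l, ..., u. `Less` withdraws the
    -- top value u. `Last` fixes e at u and charges its share to the demand.
    Full Less Last : Subset ν → Set
    Full S = d S ≤ capE (l , suc w) (lookup S a) (lookup S b) + K S
    Less S = d S ≤ capE (l , w) (lookup S a) (lookup S b) + K S
    Last S = c e S * - u + d S ≤ K S

    private
      1+≤ : ∀ {x y} → ¬ (x ≤ y) → 1ℤ + y ≤ x
      1+≤ x≰y = i<j⇒suc[i]≤j (≰⇒> x≰y)

      -- Withdrawing u lowers the capacity only of sets that e leaves, and only by one. A set that
      -- fails is therefore left by e and was tight before.
      less-fails : ∀ S → Full S → ¬ Less S →
        lookup S a ≡ true × lookup S b ≡ false × u + K S ≤ d S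
      less-fails S full ¬less with lookup S a | lookup S b
      ... | true  | true  = contradiction full ¬less
      ... | true  | false = refl , refl , ≤-by-difference (1+≤ ¬less) (lemma (d S) l (+ w) (K S))
        where
        lemma : ∀ d l w k → d - (l + (1ℤ + w) + k) ≡ d - (1ℤ + (l + w + k))
        lemma = solve-∀
      ... | false | true  = contradiction full ¬less
      ... | false | false = contradiction full ¬less

      -- For sets that e leaves or does not cross, fixing e at u asks for nothing beyond `Full`. A
      -- set that fails is therefore entered by e.
      last-fails : ∀ S → Full S → ¬ Last S →
        lookup S a ≡ false × lookup S b ≡ true × 1ℤ + K S ≤ d S + u
      last-fails S full ¬last with lookup S a | lookup S b
      ... | true  | true  = contradiction (≤-by-difference full (lemma (K S) (d S) u)) ¬last
        where
        lemma : ∀ k d u → k - ((1ℤ - 1ℤ) * - u + d) ≡ 0ℤ + k - d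
        lemma = solve-∀
      ... | true  | false = contradiction (≤-by-difference full (lemma (K S) (d S) u)) ¬last
        where
        lemma : ∀ k d u → k - ((1ℤ - 0ℤ) * - u + d) ≡ u + k - d
        lemma = solve-∀
      ... | false | true  = refl , refl , ≤-by-difference (1+≤ ¬last) (lemma (K S) (d S) u)
        where
        lemma : ∀ k d u → d + u - (1ℤ + k) ≡ (0ℤ - 1ℤ) * - u + d - (1ℤ + k)
        lemma = solve-∀
      ... | false | false = contradiction (≤-by-difference full (lemma (K S) (d S) u)) ¬last
        where
        lemma : ∀ k d u → k - ((0ℤ - 0ℤ) * - u + d) ≡ 0ℤ + k - d
        lemma = solve-∀

    -- If both "lower the capacity of e by one" and "saturate e" violated a cut, then uncrossing the
    -- two violated cuts would violate a cut of the original problem.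
    uncross : (∀ S T → K (S ∪ T) + K (S ∩ T) ≤ K S + K T) → (∀ S → Full S) →
      ∀ S → ¬ Less S → ∀ T → Last T
    uncross sub full S ¬less T = decidable-stable (_ ≤? _) λ ¬last →
      case-split (less-fails S (full S) ¬less) (last-fails T (full T) ¬last)
      where
      case-split : lookup S a ≡ true × lookup S b ≡ false × u + K S ≤ d S →
        lookup T a ≡ false × lookup T b ≡ true × 1ℤ + K T ≤ d T + u → ⊥
      case-split (Sa , Sb , p) (Ta , Tb , q) = contradiction bad λ { (+≤+ ()) }
        where
        -- Both ends of e lie in S ∪ T and neither lies in S ∩ T, so e adds no capacity to these two
        -- cuts.
        ∪-bound : d (S ∪ T) ≤ 0ℤ + K (S ∪ T)
        ∪-bound = subst (λ z → d (S ∪ T) ≤ z + K (S ∪ T))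
          (cong₂ (capE (l , suc w))
            (trans (lookup-zipWith _∨_ a S T) (cong₂ _∨_ Sa Ta))
            (trans (lookup-zipWith _∨_ b S T) (cong₂ _∨_ Sb Tb))) (full (S ∪ T))
        ∩-bound : d (S ∩ T) ≤ 0ℤ + K (S ∩ T)
        ∩-bound = subst (λ z → d (S ∩ T) ≤ z + K (S ∩ T))
          (cong₂ (capE (l , suc w))
            (trans (lookup-zipWith _∧_ a S T) (cong₂ _∧_ Sa Ta))
            (trans (lookup-zipWith _∧_ b S T) (cong₂ _∧_ Sb Tb))) (full (S ∩ T))
        total : (d S + d T) + ((K (S ∪ T) + K (S ∩ T)) + ((u + K S) + (1ℤ + K T)))
              ≤ ((0ℤ + K (S ∪ T)) + (0ℤ + K (S ∩ T))) + ((K S + K T) + (d S + (d T + u)))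
        total = +-mono-≤ (≤-trans (≤-reflexive (sym (M .modular S T))) (+-mono-≤ ∪-bound ∩-bound))
          (+-mono-≤ (sub S T) (+-mono-≤ p q))
        bad : 1ℤ ≤ 0ℤ
        bad = ≤-by-difference total
          (lemma (d S) (d T) (K (S ∪ T)) (K (S ∩ T)) (K S) (K T) u)
          where
          lemma : ∀ x y k₁ k₂ k₃ k₄ u →
            0ℤ - 1ℤ ≡ ((0ℤ + k₁) + (0ℤ + k₂)) + ((k₃ + k₄) + (x + (y + u)))
                       - ((x + y) + ((k₁ + k₂) + ((u + k₃) + (1ℤ + k₄))))
          lemma = solve-∀

  -- The sufficiency half of Hoffman's circulation theorem for the given edges and bounds, with an
  -- integral solution.
  Transport : Vec (Edge ν) n → Vec (ℤ × ℕ) n → Set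
  Transport {ν} {n} es bs = (d : Subset ν → ℤ) → Modular d → (∀ S → d S ≤ cap es bs S) →
    Σ (Vec ℤ n) λ y → y ∈B map interval bs × (∀ S → ∂ es y S ≡ d S)

  private
    fix-head : ∀ (e : Edge ν) (es : Vec (Edge ν) n) bs u {d} → Transport es bs → Modular d →
      (∀ S → c e S * - u + d S ≤ cap es bs S) →
      Σ (Vec ℤ n) λ y → y ∈B map interval bs × (∀ S → ∂ (e ∷ es) (u ∷ y) S ≡ d S)
    fix-head e es bs u {d} rec M bound with rec _ (modular-combine (c-modular e) M (- u)) bound
    ... | y , y∈ , eq = y , y∈ , λ S → trans (cong (_+_ (c e S * u)) (eq S)) (lemma (c e S) u (d S))
      where
      lemma : ∀ c u d → c * u + (c * - u + d) ≡ d
      lemma = solve-∀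

    -- Induction on the width of the first interval. If no cut is violated after withdrawing its top
    -- value, that value is withdrawn. Otherwise `uncross` allows the edge to be fixed there, and
    -- the remaining edges are solved for the reduced demand.
    transport-∷ : ∀ (e : Edge ν) (es : Vec (Edge ν) n) bs l w → Transport es bs → Transport (e ∷ es) ((l , w) ∷ bs)
    transport-∷ e@(a , b) es bs l zero rec d M full with fix-head e es bs l rec M bound
      where
      bound : ∀ S → c e S * - l + d S ≤ cap es bs S
      bound S = ≤-by-difference (full S) (lemma (lookup S a) (lookup S b))
        where
        e₁ : ∀ k d l → k - ((1ℤ - 1ℤ) * - l + d) ≡ 0ℤ + k - d
        e₁ = solve-∀
        e₂ : ∀ k d l → k - ((1ℤ - 0ℤ) * - l + d) ≡ l + 0ℤ + k - d
        e₂ = solve-∀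
        e₃ : ∀ k d l → k - ((0ℤ - 1ℤ) * - l + d) ≡ - l + k - d
        e₃ = solve-∀
        e₄ : ∀ k d l → k - ((0ℤ - 0ℤ) * - l + d) ≡ 0ℤ + k - d
        e₄ = solve-∀
        lemma : ∀ x y → cap es bs S - ((bit x - bit y) * - l + d S) ≡ capE (l , 0) x y + cap es bs S - d S
        lemma true  true  = e₁ (cap es bs S) (d S) l
        lemma true  false = e₂ (cap es bs S) (d S) l
        lemma false true  = e₃ (cap es bs S) (d S) l
        lemma false false = e₄ (cap es bs S) (d S) l
    ... | y , y∈ , eq = l ∷ y , (≤-refl , suc[i]≤j⇒i<j (≤-reflexive (+-comm 1ℤ l))) ∷ y∈ , eq
    transport-∷ e@(a , b) es bs l (suc w) rec d M full
      with anySubset? (λ S → ¬? (d S ≤? capE (l , w) (lookup S a) (lookup S b) + cap es bs S))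
    ... | no none with transport-∷ e es bs l w rec d M (λ S → decidable-stable (_ ≤? _) λ ¬less → none (S , ¬less))
    ...   | y ∷ ys , (l≤y , y<) ∷ y∈ , eq = y ∷ ys , (l≤y , <-trans y< (+-monoʳ-< l (+<+ (ℕ.n<1+n (suc w))))) ∷ y∈ , eq
    transport-∷ e es bs l (suc w) rec d M full | yes (S , ¬less)
      with fix-head e es bs (l + + suc w) rec M (uncross e (cap es bs) M l w (cap-submodular es bs) full S ¬less)
    ... | y , y∈ , eq = (l + + suc w) ∷ y ,
      (i≤i+j l (+ suc w) , +-monoʳ-< l (+<+ (ℕ.n<1+n (suc w)))) ∷ y∈ , eq

  hoffman : (es : Vec (Edge ν) n) (bs : Vec (ℤ × ℕ) n) → Transport es bs
  -- Without edges d ≤ 0 holds on S and on its complement, and the two values add up to d ⊤ + d ∅ =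
  -- 0.
  hoffman [] [] d M bound = [] , [] , λ S → sym (≤-antisym (bound S) (neg S))
    where
    neg : ∀ S → 0ℤ ≤ d S
    neg S = ≤-by-difference (bound (∁ S)) (trans (lemma (d S) (d (∁ S))) (cong (λ z → z - d (∁ S)) sum≡0))
      where
      lemma : ∀ x y → x - 0ℤ ≡ (x + y) - y
      lemma = solve-∀
      sum≡0 : d S + d (∁ S) ≡ 0ℤ
      sum≡0 = begin
        d S + d (∁ S)              ≡⟨ M .modular S (∁ S) ⟨
        d (S ∪ ∁ S) + d (S ∩ ∁ S)  ≡⟨ cong₂ (λ X Y → d X + d Y) (p∪∁p≡⊤ S) (∩-inverseʳ S) ⟩
        d ⊤ + d ∅                  ≡⟨ cong₂ _+_ (M .at-⊤) (M .at-∅) ⟩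
        0ℤ                         ∎
        where open ≡-Reasoning
  hoffman (e ∷ es) ((l , w) ∷ bs) = transport-∷ e es bs l w (hoffman es bs)

-- Closed sets, total cyclicity and integral rounding

module ClosedSets where
  open BoxSums
  open CutPairing
  open import Data.Nat as ℕ using (ℕ; suc)
  import Data.Nat.Properties as ℕ
  open import Data.Integer using (ℤ; +_; -[1+_]; 0ℤ; 1ℤ; _+_; _-_; _*_; -_; _≤_; +≤+; +<+)
  open import Data.Integer.Properties
  open import Data.Integer.Tactic.RingSolver using (solve-∀)
  import Data.Bool as B
  open import Data.Bool using (Bool; true; false)
  open import Data.Fin.Subset using (Subset)
  open import Data.Product using (Σ; _×_; _,_)
  open import Data.Vec using (Vec; []; _∷_; lookup; map; replicate)
  open import Data.Vec.Relation.Unary.All as All using (All; []; _∷_)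
  open import Data.Vec.Relation.Binary.Pointwise.Inductive as Pointwise using (Pointwise; []; _∷_)
  open import Relation.Nullary using (Dec; no)
  open import Relation.Nullary.Decidable using (_×-dec_; _→-dec_)
  open import Relation.Binary.PropositionalEquality using (_≡_; refl; sym; trans; cong; cong₂)

  private variable
    ν n m : ℕ

  Uncut : Edge ν → Subset ν → Set
  Uncut (a , b) S = lookup S a ≡ lookup S b

  -- Such an S is a union of connected components of the graph with edges `es`.
  Inv : Vec (Edge ν) n → Subset ν → Set
  Inv es S = All (λ e → Uncut e S) es

  uncut? : (e : Edge ν) (S : Subset ν) → Dec (Uncut e S)
  uncut? (a , b) S = lookup S a B.≟ lookup S b

  inv? : (es : Vec (Edge ν) n) (S : Subset ν) → Dec (Inv es S)
  inv? es S = All.all? (λ e → uncut? e S) es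

  -- An edge with value x carries its forward arc unless x = q and its backward arc unless x = 0;
  -- S is closed when no arc leaves it.
  CloE : ℤ → Edge ν → ℤ → Subset ν → Set
  CloE q (a , b) x S = (lookup S a ≡ true → lookup S b ≡ false → x ≡ q) ×
                       (lookup S a ≡ false → lookup S b ≡ true → x ≡ 0ℤ)

  Clo : ℤ → Vec (Edge ν) n → Vec ℤ n → Subset ν → Set
  Clo q es h S = Pointwise (λ e x → CloE q e x S) es h

  clo? : ∀ q (es : Vec (Edge ν) n) h S → Dec (Clo q es h S)
  clo? q es h S = Pointwise.decidable (λ (a , b) x →
    (lookup S a B.≟ true →-dec (lookup S b B.≟ false →-dec (x ≟ q))) ×-dec
    (lookup S a B.≟ false →-dec (lookup S b B.≟ true →-dec (x ≟ 0ℤ)))) es h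

  -- Total cyclicity of the arcs of A (directed by h) after contracting the edges of B.
  TC : ℤ → Vec (Edge ν) n → Vec ℤ n → Vec (Edge ν) m → Set
  TC q A h B = ∀ S → Inv B S → Clo q A h S → Inv A S

  tc? : ∀ q (A : Vec (Edge ν) n) h (B : Vec (Edge ν) m) → Dec (TC q A h B)
  tc? q A h B = allSubsets? λ S → inv? B S →-dec (clo? q A h S →-dec inv? A S)

  Scaled : ℤ → ℤ × ℕ → ℤ → Set
  Scaled q (l , w) x = l * q ≤ x × x ≤ (l + + w) * q

  private
    term : ∀ q I {x} y z → Scaled q I x → (bit y - bit z) * x ≤ capE I y z * q
    term q I {x} true true _ = ≤-reflexive (lemma x q)
      where
      lemma : ∀ x q → (1ℤ - 1ℤ) * x ≡ 0ℤ * q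
      lemma = solve-∀
    term q (l , w) {x} true false (_ , x≤) = ≤-trans (≤-reflexive (lemma x)) x≤
      where
      lemma : ∀ x → (1ℤ - 0ℤ) * x ≡ x
      lemma = solve-∀
    term q (l , w) {x} false true (≤x , _) = ≤-by-difference ≤x (lemma l q x)
      where
      lemma : ∀ l q x → - l * q - (0ℤ - 1ℤ) * x ≡ x - l * q
      lemma = solve-∀
    term q I {x} false false _ = ≤-reflexive (lemma x q)
      where
      lemma : ∀ x q → (0ℤ - 0ℤ) * x ≡ 0ℤ * q
      lemma = solve-∀

  ∂≤cap : ∀ q (es : Vec (Edge ν) n) {bs h} → Pointwise (Scaled q) bs h → ∀ S → ∂ es h S ≤ cap es bs S * q
  ∂≤cap q []             []                        S = ≤-refl
  ∂≤cap q ((a , b) ∷ es) {I ∷ bs} (x∈ ∷ h∈) S = ≤-trans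
    (+-mono-≤ (term q I (lookup S a) (lookup S b) x∈) (∂≤cap q es h∈ S))
    (≤-reflexive (sym (*-distribʳ-+ q (capE I (lookup S a) (lookup S b)) (cap es bs S))))

  -- The vector h / q is a fractional solution with boundary d within the bounds `bs`. A fractional
  -- solution already forces the cut conditions, and these suffice for an integral one.
  integral-rounding : ∀ q → .{{_ : ℕ.NonZero q}} → (es : Vec (Edge ν) n) {bs : Vec (ℤ × ℕ) n} {h : Vec ℤ n} →
    Pointwise (Scaled (+ q)) bs h → {d : Subset ν → ℤ} → (∀ S → ∂ es h S ≡ d S * + q) →
    Σ (Vec ℤ n) λ y → y ∈B map interval bs × (∀ S → ∂ es y S ≡ d S)
  integral-rounding (suc q) es {bs} {h} h∈ {d} eq =
    hoffman es bs d (modular-quotient (+ suc q) (∂-modular es h) eq) λ S →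
      *-cancelʳ-≤-pos (d S) (cap es bs S) (+ suc q) (≤-trans (≤-reflexive (sym (eq S))) (∂≤cap (+ suc q) es h∈ S))

  unit : Vec (ℤ × ℕ) n
  unit = replicate _ (0ℤ , 1)

  -- With bounds 0 and 1 the capacity of S is the number of edges that leave S in their reference
  -- direction.
  out : Vec (Edge ν) n → Subset ν → ℤ
  out es = cap es unit

  InRange : ℤ → Vec ℤ n → Set
  InRange {n} q h = Pointwise (Scaled q) (unit {n}) h

  closed-box : ℕ → ∀ n → Box n
  closed-box q n = replicate n (0ℤ , suc q)

  ∈closed-box : ∀ q {h : Vec ℤ n} → h ∈B closed-box q n → InRange (+ q) h
  ∈closed-box q []               = []
  ∈closed-box q {x ∷ _} ((0≤x , x<) ∷ h∈) =
    (≤-trans (≤-reflexive (*-zeroˡ (+ q))) 0≤x ,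
     ≤-trans (i<j⇒i≤pred[j] x<) (≤-reflexive (sym (*-identityˡ (+ q))))) ∷ ∈closed-box q h∈

  private
    split-equality : ∀ {x X y Y} → x ≤ X → y ≤ Y → x + y ≡ X + Y → x ≡ X × y ≡ Y
    split-equality {x} {X} {y} {Y} x≤X y≤Y eq =
      ≤-antisym x≤X (≤-by-difference y≤Y (≡-by-difference eq (lemma₁ x X y Y))) ,
      ≤-antisym y≤Y (≤-by-difference x≤X (≡-by-difference eq (lemma₂ x X y Y)))
      where
      lemma₁ : ∀ x X y Y → x - X - (Y - y) ≡ x + y - (X + Y)
      lemma₁ = solve-∀
      lemma₂ : ∀ x X y Y → y - Y - (X - x) ≡ x + y - (X + Y)
      lemma₂ = solve-∀

    term-tight : ∀ q {x} y z → (bit y - bit z) * x ≡ capE (0ℤ , 1) y z * q →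
      (y ≡ true → z ≡ false → x ≡ q) × (y ≡ false → z ≡ true → x ≡ 0ℤ)
    term-tight q {x} true true eq = (λ _ ()) , λ ()
    term-tight q {x} true false eq = (λ _ _ → ≡-by-difference eq (lemma x q)) , λ ()
      where
      lemma : ∀ x q → x - q ≡ (1ℤ - 0ℤ) * x - (1ℤ * q)
      lemma = solve-∀
    term-tight q {x} false true eq = (λ ()) , λ _ _ → ≡-by-difference (sym eq) (lemma x q)
      where
      lemma : ∀ x q → x - 0ℤ ≡ 0ℤ * q - (0ℤ - 1ℤ) * x
      lemma = solve-∀
    term-tight q {x} false false eq = (λ ()) , λ _ ()

    tight-term : ∀ q {x} y z → (y ≡ true → z ≡ false → x ≡ q) × (y ≡ false → z ≡ true → x ≡ 0ℤ) →
      (bit y - bit z) * x ≡ capE (0ℤ , 1) y z * q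
    tight-term q {x} true  true  _       = refl
    tight-term q {x} true  false (f , _) rewrite f refl refl = refl
    tight-term q {x} false true  (_ , g) rewrite g refl refl = refl
    tight-term q {x} false false _       = refl

  Clo⇒tight : ∀ q (es : Vec (Edge ν) n) {h} S → Clo q es h S → ∂ es h S ≡ out es S * q
  Clo⇒tight q []             S []         = refl
  Clo⇒tight q ((a , b) ∷ es) {x ∷ h} S (ce ∷ ch) = trans
    (cong₂ _+_ (tight-term q (lookup S a) (lookup S b) ce) (Clo⇒tight q es S ch))
    (sym (*-distribʳ-+ q (capE (0ℤ , 1) (lookup S a) (lookup S b)) (out es S)))

  -- The bound of ∂ by the capacity holds edge by edge, so equality of the sums forces equality at
  -- every edge. For an edge crossing S this means the value q or 0 according to its direction.
  tight⇒Clo : ∀ q (es : Vec (Edge ν) n) {h} → InRange q h → ∀ S → ∂ es h S ≡ out es S * q → Clo q es h S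
  tight⇒Clo q []             []        S eq = []
  tight⇒Clo q ((a , b) ∷ es) (x∈ ∷ h∈) S eq
    with split-equality (term q (0ℤ , 1) (lookup S a) (lookup S b) x∈) (∂≤cap q es h∈ S)
           (trans eq (*-distribʳ-+ q (capE (0ℤ , 1) (lookup S a) (lookup S b)) (out es S)))
  ... | e₁ , e₂ = term-tight q (lookup S a) (lookup S b) e₁ ∷ tight⇒Clo q es h∈ S e₂

  module _ (q : ℕ) .{{_ : ℕ.NonZero q}} (es : Vec (Edge ν) n) (B : Vec (Edge ν) m) {h r : Vec ℤ n}
           (h∈ : InRange (+ q) h) (r∈ : InRange 1ℤ r) (eq : ∀ S → ∂ es h S ≡ ∂ es r S * + q) where

    TC-scale : TC 1ℤ es r B → TC (+ q) es h B
    TC-scale tc S invB clo = tc S invB (tight⇒Clo 1ℤ es r∈ S (trans tight (sym (*-identityʳ (out es S)))))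
      where
      tight : ∂ es r S ≡ out es S
      tight = *-cancelʳ-≡ (∂ es r S) (out es S) (+ q) (trans (sym (eq S)) (Clo⇒tight (+ q) es S clo))
        where instance _ = Data.Integer.≢-nonZero {+ q} (λ p → ℕ.≢-nonZero⁻¹ q (+-injective p))

    TC-unscale : TC (+ q) es h B → TC 1ℤ es r B
    TC-unscale tc S invB clo = tc S invB (tight⇒Clo (+ q) es h∈ S
      (trans (eq S) (cong (_* + q) (trans (Clo⇒tight 1ℤ es S clo) (*-identityʳ (out es S))))))

  -- Reversing an edge is encoded by the value 1, keeping it by 0.
  reversal : Bool → ℤ
  reversal true  = 0ℤ
  reversal false = 1ℤ

  reversal-InRange : (o : Vec Bool n) → InRange 1ℤ (map reversal o)
  reversal-InRange []          = []
  reversal-InRange (true ∷ o)  = (+≤+ ℕ.z≤n , +≤+ ℕ.z≤n) ∷ reversal-InRange o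
  reversal-InRange (false ∷ o) = (+≤+ ℕ.z≤n , ≤-refl) ∷ reversal-InRange o

  ∈unit⇒reversal : (y : Vec ℤ n) → y ∈B map interval (unit {n}) → Σ (Vec Bool n) λ o → map reversal o ≡ y
  ∈unit⇒reversal []                 []                = [] , refl
  ∈unit⇒reversal (+ 0 ∷ y)          (_ ∷ y∈) with ∈unit⇒reversal y y∈
  ... | o , eq = true ∷ o , cong (0ℤ ∷_) eq
  ∈unit⇒reversal (+ 1 ∷ y)          (_ ∷ y∈) with ∈unit⇒reversal y y∈
  ... | o , eq = false ∷ o , cong (1ℤ ∷_) eq
  ∈unit⇒reversal (+ suc (suc x) ∷ y) ((_ , +<+ (ℕ.s≤s (ℕ.s≤s ()))) ∷ _)
  ∈unit⇒reversal (-[1+ x ] ∷ y)     ((() , _) ∷ _)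

-- Newton polynomials and sums over faces of a cube

module FacePolynomials where
  open BoxSums
  open CutPairing
  open ClosedSets
  open import Data.Nat as ℕ using (ℕ; zero; suc)
  import Data.Nat.Properties as ℕ
  open import Data.Integer using (ℤ; +_; 0ℤ; 1ℤ; _+_; _-_; _*_; -_; _≤_; _<_)
  open import Data.Integer.Properties
  open import Data.Integer.Tactic.RingSolver using (solve-∀)
  open import Data.Bool using (Bool; true; false)
  open import Data.List as List using (List; []; _∷_)
  open import Data.Product using (_×_; _,_)
  open import Data.Vec using (Vec; []; _∷_; map; zipWith)
  open import Data.Vec.Relation.Binary.Pointwise.Inductive using ([]; _∷_)
  open import Relation.Nullary using (no)
  open import Relation.Binary.PropositionalEquality using (_≡_; refl; sym; trans; cong; cong₂; subst; module ≡-Reasoning)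

  private variable
    ν n : ℕ

  -- b k q = q (q + 1) ⋯ (q + k - 1) / k!
  b : ℕ → ℕ → ℤ
  b zero    q       = 1ℤ
  b (suc k) zero    = 0ℤ
  b (suc k) (suc q) = b (suc k) q + b k (suc q)

  newton : ℕ → List ℤ → ℕ → ℤ
  newton k []       q = 0ℤ
  newton k (c ∷ cs) q = c * b k q + newton (suc k) cs q

  -- In the basis b, the operator inverse to the backward difference is a shift of the coefficients.
  newton-difference : ∀ k cs q → newton (suc k) cs (suc q) ≡ newton (suc k) cs q + newton k cs (suc q)
  newton-difference k []       q = refl
  newton-difference k (c ∷ cs) q = trans (cong (_+_ (c * b (suc k) (suc q))) (newton-difference (suc k) cs q))
    (lemma c (b (suc k) q) (b k (suc q)) (newton (suc (suc k)) cs q) (newton (suc k) cs (suc q)))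
    where
    lemma : ∀ c x y z w → c * (x + y) + (z + w) ≡ c * x + z + (c * y + w)
    lemma = solve-∀

  newton-at-0 : ∀ k cs → newton (suc k) cs 0 ≡ 0ℤ
  newton-at-0 k []       = refl
  newton-at-0 k (c ∷ cs) = trans (cong₂ _+_ (*-zeroʳ c) (newton-at-0 (suc k) cs)) refl

  record Poly₀ (f : ℕ → ℤ) : Set where
    constructor _,_
    field
      coefficients : List ℤ
      agrees       : ∀ q → newton 0 coefficients q ≡ f q

  -- Agreement from q = 1 on. The distinction from `Poly₀` is real: every face count is 1 at q = 0,
  -- but a face without a vertex has count 0 at all positive q, so its polynomial is wrong at 0.
  record Poly₁ (f : ℕ → ℤ) : Set where
    constructor _,_
    field
      coefficients : List ℤ
      agrees       : ∀ q → newton 0 coefficients (suc q) ≡ f (suc q)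

  Poly₀⇒Poly₁ : ∀ {f} → Poly₀ f → Poly₁ f
  Poly₀⇒Poly₁ (cs , eq) = cs , λ q → eq (suc q)

  Poly₁-cong : ∀ {f g} → (∀ q → f (suc q) ≡ g (suc q)) → Poly₁ f → Poly₁ g
  Poly₁-cong eq (cs , p) = cs , λ q → trans (p q) (eq q)

  private
    add : List ℤ → List ℤ → List ℤ
    add []       ds       = ds
    add (c ∷ cs) []       = c ∷ cs
    add (c ∷ cs) (d ∷ ds) = (c + d) ∷ add cs ds

    newton-add : ∀ k cs ds q → newton k (add cs ds) q ≡ newton k cs q + newton k ds q
    newton-add k []       ds       q = sym (+-identityˡ _)
    newton-add k (c ∷ cs) []       q = sym (+-identityʳ _)
    newton-add k (c ∷ cs) (d ∷ ds) q = trans (cong (_+_ ((c + d) * b k q)) (newton-add (suc k) cs ds q))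
      (lemma c d (b k q) (newton (suc k) cs q) (newton (suc k) ds q))
      where
      lemma : ∀ c d x y z → (c + d) * x + (y + z) ≡ c * x + y + (d * x + z)
      lemma = solve-∀

    newton-neg : ∀ k cs q → newton k (List.map -_ cs) q ≡ - newton k cs q
    newton-neg k []       q = refl
    newton-neg k (c ∷ cs) q = trans (cong (_+_ (- c * b k q)) (newton-neg (suc k) cs q))
      (lemma c (b k q) (newton (suc k) cs q))
      where
      lemma : ∀ c x y → - c * x + - y ≡ - (c * x + y)
      lemma = solve-∀

  Poly₁-+ : ∀ {f g} → Poly₁ f → Poly₁ g → Poly₁ (λ q → f q + g q)
  Poly₁-+ (cs , p) (ds , r) = add cs ds , λ q → trans (newton-add 0 cs ds (suc q)) (cong₂ _+_ (p q) (r q))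

  Poly₁-minus : ∀ {f g} → Poly₁ f → Poly₁ g → Poly₁ (λ q → f q - g q)
  Poly₁-minus {f} {g} F (ds , r) = Poly₁-+ {f} {λ q → - g q} F
    (List.map -_ ds , λ q → trans (newton-neg 0 ds (suc q)) (cong -_ (r q)))

  -- Summing g shifts its Newton coefficients by one place. The new constant coefficient is the
  -- value at 0, where all later basis polynomials vanish.
  Poly₀-sum : ∀ {f g} → f 0 ≡ 1ℤ → Poly₁ g → (∀ q → f (suc q) ≡ f q + g (suc q)) → Poly₀ f
  Poly₀-sum {f} {g} f0 (cs , p) step = 1ℤ ∷ cs , eq
    where
    eq : ∀ q → 1ℤ + newton 1 cs q ≡ f q
    eq zero    = trans (cong (_+_ 1ℤ) (newton-at-0 0 cs)) (sym f0)
    eq (suc q) = begin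
      1ℤ + newton 1 cs (suc q)                    ≡⟨ cong (_+_ 1ℤ) (newton-difference 0 cs q) ⟩
      1ℤ + (newton 1 cs q + newton 0 cs (suc q))  ≡⟨ +-assoc 1ℤ (newton 1 cs q) _ ⟨
      1ℤ + newton 1 cs q + newton 0 cs (suc q)    ≡⟨ cong₂ _+_ (eq q) (p q) ⟩
      f q + g (suc q)                             ≡⟨ step q ⟨
      f (suc q)                                   ∎
      where open ≡-Reasoning

  data Face : Set where
    at0 atq full : Face

  data Mode : Set where
    face           : Face → Mode
    [0,q⦆ ⦅0,q] ⦅0,q⦆ : Mode

  domF : ℕ → Face → ℤ × ℕ
  domF q at0  = 0ℤ , 1
  domF q atq  = + q , 1
  domF q full = 0ℤ , suc q

  dom : ℕ → Mode → ℤ × ℕ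
  dom q (face f) = domF q f
  dom q [0,q⦆ = 0ℤ , q
  dom q ⦅0,q] = 1ℤ , q
  dom q ⦅0,q⦆ = 1ℤ , ℕ.pred q

  -- The dimension of the face of the cube, on which the induction over faces runs.
  size : Vec Face n → ℕ
  size []         = 0
  size (full ∷ m) = suc (size m)
  size (at0 ∷ m)  = size m
  size (atq ∷ m)  = size m

  sizeM : Vec Mode n → ℕ
  sizeM []              = 0
  sizeM (face at0 ∷ μ)  = sizeM μ
  sizeM (face atq ∷ μ)  = sizeM μ
  sizeM (face full ∷ μ) = suc (sizeM μ)
  sizeM (_ ∷ μ)         = suc (sizeM μ)

  ΣF : Vec Face n → (ℕ → Vec ℤ n → ℤ) → ℕ → ℤ
  ΣF m w q = ΣB (map (domF q) m) (w q)

  ΣM : Vec Mode n → (ℕ → Vec ℤ n → ℤ) → ℕ → ℤ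
  ΣM μ w q = ΣB (map (dom q) μ) (w q)

  private
    ΣI : ℤ × ℕ → (ℤ → ℤ) → ℤ
    ΣI (l , k) f = Σr l k f

    ΣI-swap : ∀ I (D : Box n) (w : Vec ℤ (suc n) → ℤ) → ΣB D (λ h → ΣI I λ a → w (a ∷ h)) ≡ ΣB (I ∷ D) w
    ΣI-swap (l , k) D w = ΣB-Σr-swap D l k (λ a h → w (a ∷ h))

    -- Summing out the first coordinate gives a weight on the others, to which the induction on the
    -- number of coordinates applies.
    absorb : Face → (ℕ → Vec ℤ (suc n) → ℤ) → ℕ → Vec ℤ n → ℤ
    absorb f w q h = ΣI (domF q f) λ a → w q (a ∷ h)

    upper-split : ∀ q (f : ℤ → ℤ) → ΣI (domF q full) f - ΣI (domF q atq) f ≡ ΣI (dom q [0,q⦆) f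
    upper-split q f = trans (cong (λ z → z - (f (+ q) + 0ℤ)) (Σr-snoc 0ℤ q f)) (lemma (Σr 0ℤ q f) (f (+ q)))
      where
      lemma : ∀ x y → x + y - (y + 0ℤ) ≡ x
      lemma = solve-∀

    lower-split : ∀ q (f : ℤ → ℤ) → ΣI (domF q full) f - ΣI (domF q at0) f ≡ ΣI (dom q ⦅0,q]) f
    lower-split q f = lemma (Σr 1ℤ q f) (f 0ℤ)
      where
      lemma : ∀ x y → y + x - (y + 0ℤ) ≡ x
      lemma = solve-∀

    open-split : ∀ q (f : ℤ → ℤ) →
      ΣI (domF (suc q) full) f - ΣI (domF (suc q) at0) f - ΣI (domF (suc q) atq) f ≡ ΣI (dom (suc q) ⦅0,q⦆) f
    open-split q f = trans (cong (λ z → f 0ℤ + z - (f 0ℤ + 0ℤ) - (f (+ suc q) + 0ℤ)) (Σr-snoc 1ℤ q f))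
      (lemma (Σr 1ℤ q f) (f 0ℤ) (f (+ suc q)))
      where
      lemma : ∀ x y z → y + (x + z) - (y + 0ℤ) - (z + 0ℤ) ≡ x
      lemma = solve-∀

    face-head : (f : Face) (μ : Vec Mode n) (w : ℕ → Vec ℤ (suc n) → ℤ) →
      Poly₁ (ΣM μ (absorb f w)) → Poly₁ (ΣM (face f ∷ μ) w)
    face-head f μ w = Poly₁-cong λ q → ΣI-swap (domF (suc q) f) (map (dom (suc q)) μ) (w (suc q))

  -- Every mode is an integral combination of faces.
  ΣM-polynomial : (μ : Vec Mode n) (w : ℕ → Vec ℤ n → ℤ) →
    (∀ m → size m ℕ.≤ sizeM μ → Poly₁ (ΣF m w)) → Poly₁ (ΣM μ w)
  ΣM-polynomial [] w H = H [] ℕ.z≤n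
  ΣM-polynomial (μ₀ ∷ μ) w H = go μ₀ H
    where
    tail : ℕ → ℤ → ℤ
    tail q a = ΣB (map (dom (suc q)) μ) λ h → w (suc q) (a ∷ h)
    with-face : (f : Face) → (∀ m → size m ℕ.≤ sizeM μ → Poly₁ (ΣF (f ∷ m) w)) → Poly₁ (ΣM (face f ∷ μ) w)
    with-face f H′ = face-head f μ w (ΣM-polynomial μ (absorb f w) λ m m≤ →
      Poly₁-cong (λ q → sym (ΣI-swap (domF (suc q) f) (map (domF (suc q)) m) (w (suc q)))) (H′ m m≤))
    whole : (∀ m → size m ℕ.≤ suc (sizeM μ) → Poly₁ (ΣF m w)) → Poly₁ (ΣM (face full ∷ μ) w)
    whole H = with-face full λ m m≤ → H (full ∷ m) (ℕ.s≤s m≤)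
    go : ∀ μ₀ → (∀ m → size m ℕ.≤ sizeM (μ₀ ∷ μ) → Poly₁ (ΣF m w)) → Poly₁ (ΣM (μ₀ ∷ μ) w)
    go (face at0)  H = with-face at0 λ m m≤ → H (at0 ∷ m) m≤
    go (face atq)  H = with-face atq λ m m≤ → H (atq ∷ m) m≤
    go (face full) H = whole H
    go [0,q⦆ H = Poly₁-cong (λ q → upper-split (suc q) (tail q))
      (Poly₁-minus (whole H) (with-face atq λ m m≤ → H (atq ∷ m) (ℕ.m≤n⇒m≤1+n m≤)))
    go ⦅0,q] H = Poly₁-cong (λ q → lower-split (suc q) (tail q))
      (Poly₁-minus (whole H) (with-face at0 λ m m≤ → H (at0 ∷ m) (ℕ.m≤n⇒m≤1+n m≤)))
    go ⦅0,q⦆ H = Poly₁-cong (λ q → open-split q (tail q))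
      (Poly₁-minus (Poly₁-minus (whole H) (with-face at0 λ m m≤ → H (at0 ∷ m) (ℕ.m≤n⇒m≤1+n m≤)))
        (with-face atq λ m m≤ → H (atq ∷ m) (ℕ.m≤n⇒m≤1+n m≤)))

  -- The points of the face m at which no coordinate sits at the end opposite to the vertex o.
  pull : Face → Bool → Mode
  pull full true  = [0,q⦆
  pull full false = ⦅0,q]
  pull f    _     = face f

  pullV : Vec Face n → Vec Bool n → Vec Mode n
  pullV = zipWith pull

  sizeM-pull : (m : Vec Face n) (o : Vec Bool n) → sizeM (pullV m o) ≡ size m
  sizeM-pull []         []          = refl
  sizeM-pull (at0 ∷ m)  (_ ∷ o)     = sizeM-pull m o
  sizeM-pull (atq ∷ m)  (_ ∷ o)     = sizeM-pull m o
  sizeM-pull (full ∷ m) (true ∷ o)  = cong suc (sizeM-pull m o)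
  sizeM-pull (full ∷ m) (false ∷ o) = cong suc (sizeM-pull m o)

  -- In a full coordinate the half-open interval misses one end. The difference splits into the
  -- difference in the remaining coordinates, with this one left full, and a count with this
  -- coordinate fixed at that end. Both are combinations of faces of smaller dimension.
  pull-difference : (m : Vec Face n) (o : Vec Bool n) (w : ℕ → Vec ℤ n → ℤ) →
    (∀ m′ → size m′ ℕ.< size m → Poly₁ (ΣF m′ w)) → Poly₁ (λ q → ΣF m w q - ΣM (pullV m o) w q)
  pull-difference [] [] w H = [] , λ q → sym (+-inverseʳ (w (suc q) []))
  pull-difference {suc n} (f ∷ m) (o₀ ∷ o) w H = go f o₀ H
    where
    μ = pullV m o
    tail : ℕ → ℤ → ℤ
    tail q a = ΣB (map (dom (suc q)) μ) λ h → w (suc q) (a ∷ h)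
    same-face : ∀ f → (∀ m′ → size m′ ℕ.< size m → Poly₁ (ΣF (f ∷ m′) w)) →
      Poly₁ (λ q → ΣF (f ∷ m) w q - ΣM (face f ∷ μ) w q)
    same-face f H′ = Poly₁-cong
      (λ q → cong₂ _-_ (ΣI-swap (domF (suc q) f) (map (domF (suc q)) m) (w (suc q)))
                       (ΣI-swap (domF (suc q) f) (map (dom (suc q)) μ) (w (suc q))))
      (pull-difference m o (absorb f w) λ m′ m′< →
        Poly₁-cong (λ q → sym (ΣI-swap (domF (suc q) f) (map (domF (suc q)) m′) (w (suc q)))) (H′ m′ m′<))
    smaller : ∀ f → (∀ m′ → size m′ ℕ.< suc (size m) → Poly₁ (ΣF (f ∷ m′) w)) → Poly₁ (ΣM (face f ∷ μ) w)
    smaller f H′ = face-head f μ w (ΣM-polynomial μ (absorb f w) λ m′ m′≤ →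
      Poly₁-cong (λ q → sym (ΣI-swap (domF (suc q) f) (map (domF (suc q)) m′) (w (suc q))))
        (H′ m′ (ℕ.s≤s (subst (size m′ ℕ.≤_) (sizeM-pull m o) m′≤))))
    lemma : ∀ x y z → (x - y) + z ≡ x - (y - z)
    lemma = solve-∀
    go : ∀ f o₀ → (∀ m′ → size m′ ℕ.< size (f ∷ m) → Poly₁ (ΣF m′ w)) →
      Poly₁ (λ q → ΣF (f ∷ m) w q - ΣM (pull f o₀ ∷ μ) w q)
    go at0  o₀    H = same-face at0 λ m′ → H (at0 ∷ m′)
    go atq  o₀    H = same-face atq λ m′ → H (atq ∷ m′)
    go full true  H = Poly₁-cong
      (λ q → trans (lemma (ΣF (full ∷ m) w (suc q)) (ΣM (face full ∷ μ) w (suc q)) (ΣM (face atq ∷ μ) w (suc q)))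
        (cong (_-_ (ΣF (full ∷ m) w (suc q))) (upper-split (suc q) (tail q))))
      (Poly₁-+ (same-face full λ m′ m′< → H (full ∷ m′) (ℕ.s≤s m′<)) (smaller atq λ m′ → H (atq ∷ m′)))
    go full false H = Poly₁-cong
      (λ q → trans (lemma (ΣF (full ∷ m) w (suc q)) (ΣM (face full ∷ μ) w (suc q)) (ΣM (face at0 ∷ μ) w (suc q)))
        (cong (_-_ (ΣF (full ∷ m) w (suc q))) (lower-split (suc q) (tail q))))
      (Poly₁-+ (same-face full λ m′ m′< → H (full ∷ m′) (ℕ.s≤s m′<)) (smaller at0 λ m′ → H (at0 ∷ m′)))

-- Lattice points of flow polytopes, counted by pulling

module LatticePoints where
  open BoxSums
  open CutPairing
  open ClosedSets
  open FacePolynomials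
  open import Data.Nat as ℕ using (ℕ; suc)
  import Data.Nat.Properties as ℕ
  open import Data.Integer using (ℤ; +_; -[1+_]; 0ℤ; 1ℤ; _+_; _-_; _*_; -_; _<_; +≤+; +<+)
  open import Data.Integer.Properties
  open import Data.Integer.Tactic.RingSolver using (solve-∀)
  import Data.Bool as B
  open import Data.Bool using (Bool; true; false)
  open import Data.Fin.Subset using (Subset)
  open import Data.Fin.Subset.Properties using (anySubset?)
  open import Data.List using ([])
  open import Data.Product using (Σ; _×_; _,_)
  open import Data.Unit using (⊤; tt)
  open import Data.Vec using (Vec; []; _∷_; map; replicate; zipWith)
  open import Data.Vec.Relation.Binary.Pointwise.Inductive as Pointwise using (Pointwise; []; _∷_)
  open import Relation.Nullary using (¬_; Dec; yes; no)
  open import Relation.Nullary.Decidable using (_×-dec_)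
  open import Relation.Binary.PropositionalEquality using (_≡_; refl; sym; trans; cong; cong₂)

  private variable
    ν n : ℕ

  -- The cube vertex o lies on the face. As in `reversal`, `true` stands for the coordinate 0 and
  -- `false` for the top value.
  Compatible : Face → Bool → Set
  Compatible at0  o = o ≡ true
  Compatible atq  o = o ≡ false
  Compatible full o = ⊤

  private
    compatible? : ∀ f o → Dec (Compatible f o)
    compatible? at0  o = o B.≟ true
    compatible? atq  o = o B.≟ false
    compatible? full o = yes tt

    bounds : Face → ℤ × ℕ
    bounds at0  = 0ℤ , 0
    bounds atq  = 1ℤ , 0
    bounds full = 0ℤ , 1

    scaled : ∀ q (m : Vec Face n) {h} → h ∈B map (domF q) m → Pointwise (Scaled (+ q)) (map bounds m) h
    scaled q []         []        = []
    scaled q (at0 ∷ m)  ((0≤x , x<1) ∷ h∈) =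
      (≤-trans (≤-reflexive (*-zeroˡ (+ q))) 0≤x ,
       ≤-trans (i<j⇒i≤pred[j] x<1) (≤-reflexive (sym (*-zeroˡ (+ q))))) ∷ scaled q m h∈
    scaled q (atq ∷ m) {x ∷ _} ((q≤x , x<) ∷ h∈) =
      (≤-trans (≤-reflexive (*-identityˡ (+ q))) q≤x ,
       ≤-trans (i<j⇒i≤pred[j] x<) (≤-reflexive (trans (lemma (+ q)) (sym (*-identityˡ (+ q)))))) ∷ scaled q m h∈
      where
      lemma : ∀ q → - 1ℤ + (q + 1ℤ) ≡ q
      lemma = solve-∀
    scaled q (full ∷ m) ((0≤x , x<) ∷ h∈) =
      (≤-trans (≤-reflexive (*-zeroˡ (+ q))) 0≤x ,
       ≤-trans (i<j⇒i≤pred[j] x<) (≤-reflexive (sym (*-identityˡ (+ q))))) ∷ scaled q m h∈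

    vertex : (m : Vec Face n) (y : Vec ℤ n) → y ∈B map interval (map bounds m) →
      Σ (Vec Bool n) λ o → Pointwise Compatible m o × map reversal o ≡ y
    vertex []         []      []        = [] , [] , refl
    vertex (f ∷ m)    (x ∷ y) (x∈ ∷ y∈) with coordinate f x x∈ | vertex m y y∈
      where
      coordinate : ∀ f x → x ∈I interval (bounds f) → Σ Bool λ o → Compatible f o × reversal o ≡ x
      coordinate at0  (+ 0)             _ = true , refl , refl
      coordinate at0  (+ suc x)         (_ , +<+ (ℕ.s≤s ()))
      coordinate atq  (+ 0)             (+≤+ () , _)
      coordinate atq  (+ 1)             _ = false , refl , refl
      coordinate atq  (+ suc (suc x))   (_ , +<+ (ℕ.s≤s (ℕ.s≤s ())))
      coordinate full (+ 0)             _ = true , tt , refl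
      coordinate full (+ 1)             _ = false , tt , refl
      coordinate full (+ suc (suc x))   (_ , +<+ (ℕ.s≤s (ℕ.s≤s ())))
      coordinate at0  -[1+ x ] (() , _)
      coordinate atq  -[1+ x ] (() , _)
      coordinate full -[1+ x ] (() , _)
    ... | o , co , eq | os , cos , eqs = o ∷ os , co ∷ cos , cong₂ _∷_ eq eqs

    ΣB-pull : ∀ q (m : Vec Face n) {o} → Pointwise Compatible m o → (w : Vec ℤ n → ℤ) →
      ΣB (map (dom (suc q)) (pullV m o)) w ≡ ΣB (map (domF q) m) (λ h → w (zipWith _+_ h (map reversal o)))
    ΣB-pull q []         []          w = refl
    ΣB-pull q (at0 ∷ m)  (refl ∷ co) w = cong (λ z → z + 0ℤ) (ΣB-pull q m co _)
    ΣB-pull q (atq ∷ m)  {_ ∷ o} (refl ∷ co) w = cong (λ z → z + 0ℤ)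
      (trans (ΣB-pull q m co _)
        (cong (λ x → ΣB (map (domF q) m) (λ h → w (x ∷ zipWith _+_ h (map reversal o)))) (+-comm 1ℤ (+ q))))
    ΣB-pull q (full ∷ m) {true ∷ o}  (tt ∷ co) w = trans
      (Σr-cong 0ℤ (suc q) λ a → ΣB-pull q m co _)
      (sym (Σr-shift 0ℤ (suc q) 0ℤ λ a → ΣB (map (domF q) m) (λ h → w (a ∷ zipWith _+_ h (map reversal o)))))
    ΣB-pull q (full ∷ m) {false ∷ o} (tt ∷ co) w = trans
      (Σr-cong 1ℤ (suc q) λ a → ΣB-pull q m co _)
      (sym (Σr-shift 0ℤ (suc q) 1ℤ λ a → ΣB (map (domF q) m) (λ h → w (a ∷ zipWith _+_ h (map reversal o)))))

    ΣB-at-0 : (m : Vec Face n) (w : Vec ℤ n → ℤ) → ΣB (map (domF 0) m) w ≡ w (replicate n 0ℤ)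
    ΣB-at-0 []         w = refl
    ΣB-at-0 (at0 ∷ m)  w = trans (+-identityʳ _) (ΣB-at-0 m _)
    ΣB-at-0 (atq ∷ m)  w = trans (+-identityʳ _) (ΣB-at-0 m _)
    ΣB-at-0 (full ∷ m) w = trans (+-identityʳ _) (ΣB-at-0 m _)

  module _ (es : Vec (Edge ν) n) (d : Subset ν → ℤ) where

    Meets : ℕ → Vec ℤ n → Set
    Meets q h = ∀ S → ∂ es h S ≡ d S * + q

    meets? : ∀ q h → Dec (Meets q h)
    meets? q h = allSubsets? λ S → ∂ es h S ≟ d S * + q

    weight : ℕ → Vec ℤ n → ℤ
    weight q h = 𝟙 (meets? q h)

    at-0 : ∀ m → ΣF m weight 0 ≡ 1ℤ
    at-0 m = trans (ΣB-at-0 m (weight 0))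
      (𝟙-yes (meets? 0 _) λ S → trans (∂-0 es S) (sym (*-zeroʳ (d S))))

    Vertex : Vec Face n → Vec Bool n → Set
    Vertex m o = Pointwise Compatible m o × (∀ S → ∂ es (map reversal o) S ≡ d S)

    private
      vertex? : ∀ m o → Dec (Vertex m o)
      vertex? m o = Pointwise.decidable compatible? m o ×-dec allSubsets? λ S → ∂ es (map reversal o) S ≟ d S

      -- This is where integrality of the polytope enters: a point h of the dilate by `suc q`,
      -- divided by `suc q`, rounds to a 0/1 point of the same face with the prescribed boundary,
      -- that is, to a vertex.
      no-points : ∀ m → ¬ Σ (Vec Bool n) (Vertex m) → ∀ q → ΣF m weight (suc q) ≡ 0ℤ
      no-points m none q = trans
        (ΣB-cong′ (map (domF (suc q)) m) λ h h∈ → 𝟙-no (meets? (suc q) h) (λ meets → impossible h h∈ meets))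
        (ΣB-0 (map (domF (suc q)) m))
        where
        impossible : ∀ h → h ∈B map (domF (suc q)) m → ¬ Meets (suc q) h
        impossible h h∈ meets with integral-rounding (suc q) es (scaled (suc q) m h∈) meets
        ... | y , y∈ , eq with vertex m y y∈
        ...   | o , co , refl = none (o , co , eq)

      pulled : ∀ {m o} → Vertex m o → ∀ q → ΣM (pullV m o) weight (suc q) ≡ ΣF m weight q
      pulled {m} {o} (co , eq) q = trans (ΣB-pull q m co (weight (suc q)))
        (ΣB-cong (map (domF q) m) λ h → 𝟙-cong (meets? (suc q) (zipWith _+_ h y)) (meets? q h)
          (λ p S → ≡-by-difference (p S) (trans (lemma (∂ es h S) (d S) (+ q)) (cong (λ z → z - d S * + suc q) (sym (shifted h S)))))
          (λ p S → ≡-by-difference (p S) (trans (cong (λ z → z - d S * + suc q) (shifted h S)) (sym (lemma (∂ es h S) (d S) (+ q))))))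
        where
        y = map reversal o
        shifted : ∀ h S → ∂ es (zipWith _+_ h y) S ≡ ∂ es h S + d S
        shifted h S = trans (∂-+ es h y S) (cong (_+_ (∂ es h S)) (eq S))
        lemma : ∀ x d q → x - d * q ≡ x + d - d * (1ℤ + q)
        lemma = solve-∀

      pulling : ∀ {m o} → Vertex m o → (∀ m′ → size m′ ℕ.< size m → Poly₁ (ΣF m′ weight)) → Poly₀ (ΣF m weight)
      pulling {m} {o} v H = Poly₀-sum (at-0 m) (pull-difference m o weight H) λ q →
        trans (lemma (ΣF m weight (suc q)) (ΣF m weight q))
          (cong (λ z → ΣF m weight q + (ΣF m weight (suc q) - z)) (sym (pulled v q)))
        where
        lemma : ∀ x y → x ≡ y + (x - y)
        lemma = solve-∀

      below : ∀ k m → size m ℕ.< k → Poly₁ (ΣF m weight)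
      below (suc k) m (ℕ.s≤s m≤k) with anySubset? (vertex? m)
      ... | yes (o , v) = Poly₀⇒Poly₁ (pulling v λ m′ m′< → below k m′ (ℕ.<-≤-trans m′< m≤k))
      ... | no none     = [] , λ q → sym (no-points m none q)

    face-polynomial : ∀ m → Poly₁ (ΣF m weight)
    face-polynomial m = below (suc (size m)) m ℕ.≤-refl

    vertex-polynomial : ∀ {m o} → Vertex m o → Poly₀ (ΣF m weight)
    vertex-polynomial v = pulling v λ m′ _ → face-polynomial m′

-- Flows modulo q, bridges and the corank

module FreeFlows where
  open BoxSums
  open CutPairing
  open ClosedSets
  open import Data.Nat as ℕ using (ℕ; zero; suc)
  import Data.Nat.Properties as ℕ
  import Data.Nat.Divisibility as ℕ
  open import Data.Integer using (ℤ; +_; -[1+_]; 0ℤ; 1ℤ; _+_; _-_; _*_; -_; _≤_; _<_; _^_; ∣_∣; +≤+; +<+)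
  open import Data.Integer.Properties
  open import Data.Integer.Divisibility.Signed
  open import Data.Integer.Tactic.RingSolver using (solve-∀)
  open import Data.Bool using (true; false)
  open import Data.Fin as Fin using (Fin)
  import Data.Fin.Properties as Fin
  open import Data.Fin.Subset using (Subset)
  open import Data.Product using (Σ; ∃; _×_; _,_)
  open import Data.Sum using (_⊎_; inj₁; inj₂)
  open import Data.Vec as Vec using (Vec; []; _∷_; _++_; lookup; map; replicate; zipWith; tabulate)
  open import Data.Vec.Properties using (lookup∘tabulate)
  open import Data.Vec.Relation.Unary.All as All using (All; []; _∷_)
  import Data.Vec.Relation.Unary.All.Properties as All
  open import Data.Vec.Relation.Binary.Pointwise.Inductive as Pointwise using (Pointwise; []; _∷_)
  open import Function using (_∘_)
  open import Relation.Nullary using (¬_; Dec; yes; no; does; contradiction)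
  open import Relation.Binary.PropositionalEquality using (_≡_; _≢_; refl; sym; trans; cong; cong₂; subst; module ≡-Reasoning)

  private variable
    ν n m : ℕ

  Div : ℕ → Vec (Edge ν) n → Vec ℤ n → Vec (Edge ν) m → Vec ℤ m → Set
  Div q A g B h = ∀ S → + q ∣ ∂ A g S + ∂ B h S

  div? : ∀ q (A : Vec (Edge ν) n) g (B : Vec (Edge ν) m) h → Dec (Div q A g B h)
  div? q A g B h = allSubsets? λ S → + q ∣? ∂ A g S + ∂ B h S

  module _ {q : ℕ} (e : Edge ν) {A : Vec (Edge ν) n} {g : Vec ℤ n} {B : Vec (Edge ν) m} {h : Vec ℤ m} where
    private
      reassociate : ∀ a S → ∂ (e ∷ A) (a ∷ g) S + ∂ B h S ≡ ∂ A g S + ∂ (e ∷ B) (a ∷ h) S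
      reassociate a S = lemma (c e S * a) (∂ A g S) (∂ B h S)
        where
        lemma : ∀ x y z → x + y + z ≡ y + (x + z)
        lemma = solve-∀

    Div-move : ∀ {a} → Div q (e ∷ A) (a ∷ g) B h → Div q A g (e ∷ B) (a ∷ h)
    Div-move {a} div S = subst (+ q ∣_) (reassociate a S) (div S)

    Div-move⁻¹ : ∀ {a} → Div q A g (e ∷ B) (a ∷ h) → Div q (e ∷ A) (a ∷ g) B h
    Div-move⁻¹ {a} div S = subst (+ q ∣_) (sym (reassociate a S)) (div S)

  free : ℕ → ∀ n → Box n
  free q n = replicate n (0ℤ , q)

  Fl : ℕ → Vec (Edge ν) n → Vec (Edge ν) m → ℤ
  Fl {n = n} {m = m} q A B = ΣB (free q n) λ g → ΣB (free q m) λ h → 𝟙 (div? q A g B h)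

  Fl-move : ∀ q (e : Edge ν) (A : Vec (Edge ν) n) (B : Vec (Edge ν) m) → Fl q (e ∷ A) B ≡ Fl q A (e ∷ B)
  Fl-move {n = n} {m = m} q e A B = sym (trans
    (ΣB-Σr-swap (free q n) 0ℤ q (λ a g → ΣB (free q m) λ h → 𝟙 (div? q A g (e ∷ B) (a ∷ h))))
    (Σr-cong 0ℤ q λ a → ΣB-cong (free q n) λ g → ΣB-cong (free q m) λ h →
      𝟙-cong (div? q A g (e ∷ B) (a ∷ h)) (div? q (e ∷ A) (a ∷ g) B h)
        (Div-move⁻¹ e {A} {g} {B} {h}) (Div-move e {A} {g} {B} {h})))

  ModEq : ℕ → Vec ℤ n → Vec ℤ n → Set
  ModEq q = Pointwise λ x y → ∃ λ k → x ≡ y + k * + q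

  private
    mod-refl : ∀ q x → ∃ λ k → x ≡ x + k * + q
    mod-refl q x = 0ℤ , sym (trans (cong (_+_ x) (*-zeroˡ (+ q))) (+-identityʳ x))

  ModEq-refl : ∀ q (h : Vec ℤ n) → ModEq q h h
  ModEq-refl q h = Pointwise.refl (λ {x} → mod-refl q x)

  ∂-mod : ∀ q (es : Vec (Edge ν) n) {h h′} → ModEq q h h′ → ∀ S → ∃ λ k → ∂ es h S ≡ ∂ es h′ S + k * + q
  ∂-mod q []       []                S = 0ℤ , refl
  ∂-mod q (e ∷ es) {x ∷ h} {y ∷ h′} ((k , refl) ∷ h≡) S with ∂-mod q es h≡ S
  ... | k′ , eq = c e S * k + k′ , trans (cong (_+_ (c e S * (y + k * + q))) eq) (lemma (c e S) y k (+ q) (∂ es h′ S) k′)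
    where
    lemma : ∀ c y k q t k′ → c * (y + k * q) + (t + k′ * q) ≡ c * y + t + (c * k + k′) * q
    lemma = solve-∀

  ΣB-periodic : ∀ q (w : Vec ℤ n → ℤ) → (∀ {h h′} → ModEq q h h′ → w h ≡ w h′) → ∀ z →
    ΣB (free q n) (λ h → w (zipWith _+_ h z)) ≡ ΣB (free q n) w
  ΣB-periodic q w per [] = refl
  ΣB-periodic {suc n} q w per (x ∷ z) = trans
    (Σr-cong 0ℤ q λ a → ΣB-periodic q (λ h → w ((a + x) ∷ h)) (λ h≡ → per (mod-refl q (a + x) ∷ h≡)) z)
    (Σr-periodic q (λ a → ΣB (free q n) λ h → w (a ∷ h))
      (λ a → ΣB-cong (free q n) λ h → per ((1ℤ , cong (_+_ a) (sym (*-identityˡ (+ q)))) ∷ ModEq-refl q h)) 0ℤ x)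

  -- Expressed by cuts instead of walks: no vertex set is crossed by e and by no edge of A or B.
  NonBridge : Edge ν → Vec (Edge ν) n → Vec (Edge ν) m → Set
  NonBridge e A B = ∀ S → Inv A S → Inv B S → Uncut e S

  ∂-++ : (A : Vec (Edge ν) n) (g : Vec ℤ n) (B : Vec (Edge ν) m) (h : Vec ℤ m) → ∀ S →
    ∂ (A ++ B) (g ++ h) S ≡ ∂ A g S + ∂ B h S
  ∂-++ []      []      B h S = sym (+-identityˡ _)
  ∂-++ (e ∷ A) (x ∷ g) B h S = trans (cong (_+_ (c e S * x)) (∂-++ A g B h S)) (sym (+-assoc (c e S * x) _ _))

  uncut⇒c≡0 : (e : Edge ν) → ∀ S → Uncut e S → c e S ≡ 0ℤ
  uncut⇒c≡0 (a , b) S eq rewrite eq = +-inverseʳ (bit (lookup S b))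

  ∂-invariant : (es : Vec (Edge ν) n) (h : Vec ℤ n) → ∀ S → Inv es S → ∂ es h S ≡ 0ℤ
  ∂-invariant []       []      S []        = refl
  ∂-invariant (e ∷ es) (x ∷ h) S (un ∷ inv) =
    trans (cong₂ (λ u v → u * x + v) (uncut⇒c≡0 e S un) (∂-invariant es h S inv)) (trans (+-identityʳ _) (*-zeroˡ x))

  private
    symmetric : Vec (ℤ × ℕ) n
    symmetric = replicate _ (-[1+ 0 ] , 2)

    -- With bounds -1 and 1 every edge crossing S, in either direction, contributes 1 to the
    -- capacity.
    cap-symmetric : (es : Vec (Edge ν) n) → ∀ S → (Inv es S × 0ℤ ≤ cap es symmetric S) ⊎ 1ℤ ≤ cap es symmetric S
    cap-symmetric []             S = inj₁ ([] , ≤-refl)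
    cap-symmetric ((a , b) ∷ es) S with cap-symmetric es S | lookup S a in Sa | lookup S b in Sb
    ... | inj₁ (inv , 0≤) | true  | true  = inj₁ (trans Sa (sym Sb) ∷ inv , +-mono-≤ (≤-refl {0ℤ}) 0≤)
    ... | inj₁ (inv , 0≤) | false | false = inj₁ (trans Sa (sym Sb) ∷ inv , +-mono-≤ (≤-refl {0ℤ}) 0≤)
    ... | inj₁ (inv , 0≤) | true  | false = inj₂ (+-mono-≤ (≤-refl {1ℤ}) 0≤)
    ... | inj₁ (inv , 0≤) | false | true  = inj₂ (+-mono-≤ (≤-refl {1ℤ}) 0≤)
    ... | inj₂ 1≤ | true  | true  = inj₂ (+-mono-≤ (≤-refl {0ℤ}) 1≤)
    ... | inj₂ 1≤ | false | false = inj₂ (+-mono-≤ (≤-refl {0ℤ}) 1≤)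
    ... | inj₂ 1≤ | true  | false = inj₂ (+-mono-≤ (+≤+ (ℕ.z≤n {1})) 1≤)
    ... | inj₂ 1≤ | false | true  = inj₂ (+-mono-≤ (+≤+ (ℕ.z≤n {1})) 1≤)

    c≤1 : (e : Edge ν) → ∀ S → c e S ≤ 1ℤ
    c≤1 (a , b) S with lookup S a | lookup S b
    ... | true  | true  = +≤+ ℕ.z≤n
    ... | true  | false = ≤-refl
    ... | false | true  = Data.Integer.-≤+
    ... | false | false = +≤+ ℕ.z≤n

  -- A signed route from the tail of e to its head that avoids e, obtained from `hoffman` with
  -- bounds -1 and 1. The demand of e on a set is at most 1, and a set crossed by e is also crossed
  -- by an edge of A or B, which supplies capacity 1.
  circulation : (e : Edge ν) (A : Vec (Edge ν) n) (B : Vec (Edge ν) m) → NonBridge e A B →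
    Σ (Vec ℤ n) λ y → Σ (Vec ℤ m) λ z → ∀ S → ∂ A y S + ∂ B z S ≡ c e S
  circulation {n = n} e A B nb with hoffman (A ++ B) symmetric (c e) (c-modular e) bound
    where
    bound : ∀ S → c e S ≤ cap (A ++ B) symmetric S
    bound S with cap-symmetric (A ++ B) S
    ... | inj₁ (inv , 0≤) = ≤-trans (≤-reflexive (uncut⇒c≡0 e S (nb S (All.++ˡ⁻ A inv) (All.++ʳ⁻ A inv)))) 0≤
    ... | inj₂ 1≤ = ≤-trans (c≤1 e S) 1≤
  ... | x , _ , eq with Vec.splitAt n x
  ...   | y , z , refl = y , z , λ S → trans (sym (∂-++ A y B z S)) (eq S)

  ∣-shift : ∀ q {x y} k → x ≡ y + k * + q → + q ∣ y → + q ∣ x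
  ∣-shift q k refl q∣y = ∣m∣n⇒∣m+n q∣y (divides k refl)

  private
    ∂-scale : ∀ a (es : Vec (Edge ν) n) y → ∀ S → ∂ es (map (a *_) y) S ≡ a * ∂ es y S
    ∂-scale a []       []      S = sym (*-zeroʳ a)
    ∂-scale a (e ∷ es) (x ∷ y) S = trans (cong (_+_ (c e S * (a * x))) (∂-scale a es y S)) (lemma (c e S) a x (∂ es y S))
      where
      lemma : ∀ c a x t → c * (a * x) + a * t ≡ a * (c * x + t)
      lemma = solve-∀

    Div-mod : ∀ q (A : Vec (Edge ν) n) (B : Vec (Edge ν) m) {g g′ h h′} → ModEq q g g′ → ModEq q h h′ →
      Div q A g′ B h′ → Div q A g B h
    Div-mod q A B {g} {g′} {h} {h′} g≡ h≡ div S with ∂-mod q A g≡ S | ∂-mod q B h≡ S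
    ... | k , eq | k′ , eq′ = ∣-shift q (k + k′) (trans (cong₂ _+_ eq eq′) (lemma (∂ A g′ S) k (∂ B h′ S) k′ (+ q))) (div S)
      where
      lemma : ∀ x k y k′ q → x + k * q + (y + k′ * q) ≡ x + y + (k + k′) * q
      lemma = solve-∀

    ModEq-sym : ∀ q {g h : Vec ℤ n} → ModEq q g h → ModEq q h g
    ModEq-sym q = Pointwise.sym λ { {x} {y} (k , refl) → - k , lemma y k (+ q) }
      where
      lemma : ∀ y k q → y ≡ y + k * q + - k * q
      lemma = solve-∀

  -- A value a on e can be rerouted along `circulation`, which translates the values on the other
  -- edges. Translations permute the residues modulo q, so all q values of a admit the same number
  -- of flows.
  Fl-nonbridge : ∀ q (e : Edge ν) (A : Vec (Edge ν) n) (B : Vec (Edge ν) m) → NonBridge e A B →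
    Fl q (e ∷ A) B ≡ + q * Fl q A B
  Fl-nonbridge {n = n} {m = m} q e A B nb with circulation e A B nb
  ... | y , z , eq = trans (Σr-cong 0ℤ q slice) (Σr-const 0ℤ q (Fl q A B))
    where
    W : Vec ℤ n → Vec ℤ m → ℤ
    W g h = 𝟙 (div? q A g B h)
    W-mod : ∀ {g g′ h h′} → ModEq q g g′ → ModEq q h h′ → W g h ≡ W g′ h′
    W-mod {g} {g′} {h} {h′} g≡ h≡ = 𝟙-cong (div? q A g B h) (div? q A g′ B h′)
      (Div-mod q A B (ModEq-sym q g≡) (ModEq-sym q h≡)) (Div-mod q A B g≡ h≡)
    slice : ∀ a → ΣB (free q n) (λ g → ΣB (free q m) λ h → 𝟙 (div? q (e ∷ A) (a ∷ g) B h)) ≡ Fl q A B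
    slice a = begin
      ΣB (free q n) (λ g → ΣB (free q m) λ h → 𝟙 (div? q (e ∷ A) (a ∷ g) B h))
        ≡⟨ ΣB-cong (free q n) (λ g → ΣB-cong (free q m) λ h → 𝟙-cong
             (div? q (e ∷ A) (a ∷ g) B h) (div? q A (zipWith _+_ g ay) B (zipWith _+_ h az))
             (λ div S → subst (+ q ∣_) (shifted g h S) (div S)) (λ div S → subst (+ q ∣_) (sym (shifted g h S)) (div S))) ⟩
      ΣB (free q n) (λ g → ΣB (free q m) λ h → W (zipWith _+_ g ay) (zipWith _+_ h az))
        ≡⟨ ΣB-cong (free q n) (λ g → ΣB-periodic q (W (zipWith _+_ g ay)) (W-mod (ModEq-refl q _)) az) ⟩
      ΣB (free q n) (λ g → ΣB (free q m) λ h → W (zipWith _+_ g ay) h)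
        ≡⟨ ΣB-periodic q (λ g → ΣB (free q m) (W g)) (λ g≡ → ΣB-cong (free q m) λ h → W-mod g≡ (ModEq-refl q h)) ay ⟩
      Fl q A B ∎
      where
      open ≡-Reasoning
      ay = map (a *_) y
      az = map (a *_) z
      shifted : ∀ g h S → ∂ (e ∷ A) (a ∷ g) S + ∂ B h S ≡ ∂ A (zipWith _+_ g ay) S + ∂ B (zipWith _+_ h az) S
      shifted g h S = begin
        c e S * a + ∂ A g S + ∂ B h S
          ≡⟨ cong (λ t → t * a + ∂ A g S + ∂ B h S) (sym (eq S)) ⟩
        (∂ A y S + ∂ B z S) * a + ∂ A g S + ∂ B h S
          ≡⟨ lemma (∂ A y S) (∂ B z S) a (∂ A g S) (∂ B h S) ⟩
        (∂ A g S + a * ∂ A y S) + (∂ B h S + a * ∂ B z S)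
          ≡⟨ cong₂ (λ s t → (∂ A g S + s) + (∂ B h S + t)) (sym (∂-scale a A y S)) (sym (∂-scale a B z S)) ⟩
        (∂ A g S + ∂ A ay S) + (∂ B h S + ∂ B az S)
          ≡⟨ cong₂ _+_ (sym (∂-+ A g ay S)) (sym (∂-+ B h az S)) ⟩
        ∂ A (zipWith _+_ g ay) S + ∂ B (zipWith _+_ h az) S ∎
        where
        lemma : ∀ y z a g h → (y + z) * a + g + h ≡ (g + a * y) + (h + a * z)
        lemma = solve-∀

  Bridge : Edge ν → Vec (Edge ν) n → Vec (Edge ν) m → Set
  Bridge {ν} e A B = Σ (Subset ν) λ S → Inv A S × Inv B S × ¬ Uncut e S

  private
    q∤a : ∀ {q a} → 0ℤ < a → a < + q → ¬ + q ∣ a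
    q∤a {q} {+ suc a} _ (+<+ a<q) q∣a = ℕ.>⇒∤ a<q (∣⇒∣ᵤ q∣a)
    q∤a {a = + zero} (+<+ ()) _ _

  -- At the separating set the terms of A and B vanish, and only a or -a remains.
  bridge-value : ∀ {q} {e : Edge ν} {A : Vec (Edge ν) n} {B : Vec (Edge ν) m} → Bridge e A B →
    ∀ {a g h} → Div q (e ∷ A) (a ∷ g) B h → + q ∣ a
  bridge-value {q = q} {e = e@(u , v)} {A} {B} (S , invA , invB , cut) {a} {g} {h} div =
    crossing (lookup S u) (lookup S v) cut (subst (+ q ∣_) eq (div S))
    where
    eq : ∂ (e ∷ A) (a ∷ g) S + ∂ B h S ≡ c e S * a
    eq = trans (cong₂ (λ s t → c e S * a + s + t) (∂-invariant A g S invA) (∂-invariant B h S invB))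
      (trans (+-identityʳ (c e S * a + 0ℤ)) (+-identityʳ (c e S * a)))
    lemma : ∀ a → - ((0ℤ - 1ℤ) * a) ≡ a
    lemma = solve-∀
    crossing : ∀ y z → y ≢ z → + q ∣ (bit y - bit z) * a → + q ∣ a
    crossing true  true  y≢z q∣ = contradiction refl y≢z
    crossing false false y≢z q∣ = contradiction refl y≢z
    crossing true  false y≢z q∣ = subst (+ q ∣_) (*-identityˡ a) q∣
    crossing false true  y≢z q∣ = subst (+ q ∣_) (lemma a) (∣m⇒∣-m q∣)

  bridge-nonzero : ∀ {q} {e : Edge ν} {A : Vec (Edge ν) n} {B : Vec (Edge ν) m} → Bridge e A B →
    ∀ {a g h} → 0ℤ < a → a < + q → ¬ Div q (e ∷ A) (a ∷ g) B h
  bridge-nonzero {A = A} {B} br {a} {g} {h} 0<a a<q div = q∤a 0<a a<q (bridge-value {A = A} {B} br {a} {g} {h} div)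

  module _ {q : ℕ} (e : Edge ν) {A : Vec (Edge ν) n} {g : Vec ℤ n} {B : Vec (Edge ν) m} {h : Vec ℤ m} where
    private
      drop-zero : ∀ S → ∂ (e ∷ A) (0ℤ ∷ g) S ≡ ∂ A g S
      drop-zero S = trans (cong (λ t → t + ∂ A g S) (*-zeroʳ (c e S))) (+-identityˡ _)

    Div-zero : Div q (e ∷ A) (0ℤ ∷ g) B h → Div q A g B h
    Div-zero div S = subst (λ t → + q ∣ t + ∂ B h S) (drop-zero S) (div S)

    Div-zero⁻¹ : Div q A g B h → Div q (e ∷ A) (0ℤ ∷ g) B h
    Div-zero⁻¹ div S = subst (λ t → + q ∣ t + ∂ B h S) (sym (drop-zero S)) (div S)

  Fl-bridge : ∀ q (e : Edge ν) (A : Vec (Edge ν) n) (B : Vec (Edge ν) m) → Bridge e A B →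
    Fl (suc q) (e ∷ A) B ≡ Fl (suc q) A B
  Fl-bridge {n = n} {m = m} q e A B br = trans (cong₂ _+_
    (ΣB-cong (free (suc q) n) λ g → ΣB-cong (free (suc q) m) λ h →
      𝟙-cong (div? (suc q) (e ∷ A) (0ℤ ∷ g) B h) (div? (suc q) A g B h) (Div-zero e {A} {g} {B} {h}) (Div-zero⁻¹ e {A} {g} {B} {h}))
    (trans (Σr-cong′ 1ℤ q λ a 1≤a a< →
        trans (ΣB-cong (free (suc q) n) λ g → trans (ΣB-cong (free (suc q) m) λ h →
          𝟙-no (div? (suc q) (e ∷ A) (a ∷ g) B h) (bridge-nonzero {A = A} {B} br {a} {g} {h} (suc[i]≤j⇒i<j 1≤a) a<)) (ΣB-0 (free (suc q) m)))
        (ΣB-0 (free (suc q) n)))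
      (Σr-0 1ℤ q)))
    (+-identityʳ _)

  -- The dimension of the cycle space of A and B together, characterised by flow counts. In this
  -- form it is unchanged when an edge moves from A to B; the field `euler` of `Components` links it
  -- to the formula with vertices and components.
  Corank : Vec (Edge ν) n → Vec (Edge ν) m → ℕ → Set
  Corank A B r = ∀ q → Fl (suc q) A B ≡ (+ suc q) ^ r

  -- Built by inserting the edges one at a time. Being in the same component is tested by invariant
  -- sets (`joined`), so no paths have to be constructed.
  record Components {ν n} (X : Vec (Edge ν) n) : Set where
    field
      {count}    : ℕ
      {corank}   : ℕ
      comp       : Fin ν → Fin count
      surjective : ∀ j → ∃ λ v → comp v ≡ j
      respects   : All (λ (a , b) → comp a ≡ comp b) X
      joined     : ∀ u v → comp u ≡ comp v → ∀ S → Inv X S → lookup S u ≡ lookup S v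
      isCorank   : Corank [] X corank
      euler      : n ℕ.+ count ≡ ν ℕ.+ corank

  class : ∀ {k} → (Fin ν → Fin k) → Fin k → Subset ν
  class comp j = tabulate λ v → does (comp v Fin.≟ j)

  class-Inv : ∀ {k} {comp : Fin ν → Fin k} {X : Vec (Edge ν) n} →
    All (λ (a , b) → comp a ≡ comp b) X → ∀ j → Inv X (class comp j)
  class-Inv {comp = comp} resp j = All.map (λ {(a , b)} eq →
    trans (lookup∘tabulate _ a) (trans (cong (λ i → does (i Fin.≟ j)) eq) (sym (lookup∘tabulate _ b)))) resp

  class-∈ : ∀ {k} (comp : Fin ν → Fin k) {v j} → comp v ≡ j → lookup (class comp j) v ≡ true
  class-∈ comp {v} {j} eq = trans (lookup∘tabulate _ v) (does-yes (comp v Fin.≟ j) eq)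
    where
    does-yes : ∀ {P : Set} (d : Dec P) → P → does d ≡ true
    does-yes (yes _) p = refl
    does-yes (no ¬p) p = contradiction p ¬p

  class-∋ : ∀ {k} (comp : Fin ν → Fin k) {v j} → lookup (class comp j) v ≡ true → comp v ≡ j
  class-∋ comp {v} {j} eq = yes-does (comp v Fin.≟ j) (trans (sym (lookup∘tabulate _ v)) eq)
    where
    yes-does : ∀ {P : Set} (d : Dec P) → does d ≡ true → P
    yes-does (yes p) _ = p

  private
    -- Class j is sent to where class i goes, and the gap left by j is closed.
    merge : ∀ {k} (i j : Fin (suc k)) → i ≢ j → Fin (suc k) → Fin k
    merge i j i≢j l with j Fin.≟ l
    ... | yes _  = Fin.punchOut (i≢j ∘ sym)
    ... | no j≢l = Fin.punchOut j≢l

    merge-≡ : ∀ {k} (i j : Fin (suc k)) (i≢j : i ≢ j) → merge i j i≢j i ≡ merge i j i≢j j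
    merge-≡ i j i≢j with j Fin.≟ i | j Fin.≟ j
    ... | yes j≡i | _       = contradiction (sym j≡i) i≢j
    ... | no _    | yes _   = Fin.punchOut-cong j refl
    ... | no _    | no j≢j  = contradiction refl j≢j

    merge-cases : ∀ {k} (i j : Fin (suc k)) (i≢j : i ≢ j) l l′ → merge i j i≢j l ≡ merge i j i≢j l′ →
      l ≡ l′ ⊎ (l ≡ i × l′ ≡ j) ⊎ (l ≡ j × l′ ≡ i)
    merge-cases i j i≢j l l′ eq with j Fin.≟ l | j Fin.≟ l′
    ... | yes refl | yes refl = inj₁ refl
    ... | yes refl | no j≢l′  = inj₂ (inj₂ (refl , sym (Fin.punchOut-injective _ j≢l′ eq)))
    ... | no j≢l   | yes refl = inj₂ (inj₁ (Fin.punchOut-injective j≢l _ eq , refl))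
    ... | no j≢l   | no j≢l′  = inj₁ (Fin.punchOut-injective j≢l j≢l′ eq)

    merge-surjective : ∀ {k} (i j : Fin (suc k)) (i≢j : i ≢ j) l → ∃ λ l′ → merge i j i≢j l′ ≡ l
    merge-surjective i j i≢j l = Fin.punchIn j l , lemma
      where
      lemma : merge i j i≢j (Fin.punchIn j l) ≡ l
      lemma with j Fin.≟ Fin.punchIn j l
      ... | yes eq = contradiction (sym eq) (Fin.punchInᵢ≢i j l)
      ... | no _   = trans (Fin.punchOut-cong j refl) (Fin.punchOut-punchIn j)

  module _ {X : Vec (Edge ν) n} (C : Components X) where
    open Components C

    add-chord : ∀ {a b} → comp a ≡ comp b → Components ((a , b) ∷ X)
    add-chord {a} {b} ca≡cb = record
      { comp       = comp
      ; surjective = surjective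
      ; respects   = ca≡cb ∷ respects
      ; joined     = λ { u v eq S (_ ∷ inv) → joined u v eq S inv }
      ; isCorank   = λ q → trans (sym (Fl-move (suc q) (a , b) [] X))
          (trans (Fl-nonbridge (suc q) (a , b) [] X (λ S _ inv → joined a b ca≡cb S inv)) (cong (_*_ (+ suc q)) (isCorank q)))
      ; euler      = trans (cong suc euler) (sym (ℕ.+-suc ν corank))
      }

  add-bridge : {X : Vec (Edge ν) n} (C : Components X) → ∀ {a b} →
    Components.comp C a ≢ Components.comp C b → Components ((a , b) ∷ X)
  add-bridge record { count = zero ; comp = comp } {a} _ = contradiction (comp a) λ ()
  add-bridge {ν} {n} {X} C@record { count = suc k } {a} {b} ca≢cb = record
    { comp       = glue ∘ comp
    ; surjective = λ l → let l′ , p = merge-surjective (comp a) (comp b) ca≢cb l ; v , r = surjective l′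
                         in v , trans (cong glue r) p
    ; respects   = merge-≡ (comp a) (comp b) ca≢cb ∷ All.map (cong glue) respects
    ; joined     = λ { u v eq S (un ∷ inv) → joined′ u v S un inv (merge-cases (comp a) (comp b) ca≢cb (comp u) (comp v) eq) }
    ; isCorank   = λ q → trans (sym (Fl-move (suc q) (a , b) [] X)) (trans (Fl-bridge q (a , b) [] X bridge) (isCorank q))
    ; euler      = trans (sym (ℕ.+-suc n k)) euler
    }
    where
    open Components C
    glue = merge (comp a) (comp b) ca≢cb
    joined′ : ∀ u v S → lookup S a ≡ lookup S b → Inv X S →
      comp u ≡ comp v ⊎ (comp u ≡ comp a × comp v ≡ comp b) ⊎ (comp u ≡ comp b × comp v ≡ comp a) → lookup S u ≡ lookup S v
    joined′ u v S un inv (inj₁ eq) = joined u v eq S inv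
    joined′ u v S un inv (inj₂ (inj₁ (p , r))) = trans (joined u a p S inv) (trans un (joined b v (sym r) S inv))
    joined′ u v S un inv (inj₂ (inj₂ (p , r))) = trans (joined u b p S inv) (trans (sym un) (joined a v (sym r) S inv))
    bridge : Bridge (a , b) [] X
    bridge = class comp (comp a) , [] , class-Inv respects (comp a) ,
      λ un → ca≢cb (sym (class-∋ comp (trans (sym un) (class-∈ comp refl))))

  components : (X : Vec (Edge ν) n) → Components X
  components {ν} [] = record
    { comp       = λ v → v
    ; surjective = λ j → j , refl
    ; respects   = []
    ; joined     = λ { u .u refl S _ → refl }
    ; isCorank   = λ q → 𝟙-yes (div? {ν} (suc q) [] [] [] []) (λ S → divides 0ℤ refl)
    ; euler      = sym (ℕ.+-identityʳ ν)
    }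
  components ((a , b) ∷ X) with components X
  ... | C with Components.comp C a Fin.≟ Components.comp C b
  ...   | yes ca≡cb = add-chord C ca≡cb
  ...   | no ca≢cb  = add-bridge C ca≢cb

  corank-exists : (A : Vec (Edge ν) n) (B : Vec (Edge ν) m) → ∃ (Corank A B)
  corank-exists []      B = Components.corank (components B) , Components.isCorank (components B)
  corank-exists (e ∷ A) B = let r , cor = corank-exists A (e ∷ B) in
    r , λ q → trans (Fl-move (suc q) e A B) (cor q)

-- Deletion and contraction for both flow counts

module DeletionContraction where
  open BoxSums
  open CutPairing
  open ClosedSets
  open FreeFlows
  open import Data.Nat as ℕ using (ℕ; zero; suc)
  import Data.Nat.Properties as ℕ
  open import Data.Integer using (ℤ; +_; 0ℤ; 1ℤ; _+_; _-_; _*_; -_; _≤_; _<_; +≤+)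
  open import Data.Integer.Properties
  open import Data.Integer.Divisibility.Signed
  open import Data.Integer.Tactic.RingSolver using (solve-∀)
  open import Data.Bool using (Bool; true; false; _∨_; _∧_; not)
  open import Data.Empty using (⊥)
  open import Data.Fin.Subset using (Subset; _∪_; _∩_; ∁)
  open import Data.Fin.Subset.Properties using (anySubset?)
  open import Data.Product using (∃; _×_; _,_; proj₁; proj₂)
  open import Data.Vec using (Vec; []; _∷_; lookup; replicate)
  open import Data.Vec.Properties using (lookup-zipWith; lookup-map)
  open import Data.Vec.Relation.Unary.All as All using (All; []; _∷_)
  open import Data.Vec.Relation.Binary.Pointwise.Inductive using ([]; _∷_)
  open import Function using (_∘_)
  open import Relation.Nullary using (¬_; Dec; yes; no; contradiction)
  open import Relation.Nullary.Decidable using (_×-dec_; ¬?; decidable-stable)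
  open import Relation.Binary.PropositionalEquality using (_≡_; _≢_; refl; sym; trans; cong; cong₂; module ≡-Reasoning)

  private variable
    ν n m : ℕ

  nz : ℕ → ∀ n → Box n
  nz q n = replicate n (1ℤ , ℕ.pred q)

  -- Nowhere-zero ℤ_q-flows after contracting the edges of B.
  Φ : ℕ → Vec (Edge ν) n → Vec (Edge ν) m → ℤ
  Φ {n = n} {m = m} q A B = ΣB (nz q n) λ g → ΣB (free q m) λ h → 𝟙 (div? q A g B h)

  -- ℤ_q-flows together with a totally cyclic orientation of their zero edges in A; a zero
  -- value is written 0 or q according to the direction of the edge.
  Ψ : ℕ → Vec (Edge ν) n → Vec (Edge ν) m → ℤ
  Ψ {n = n} {m = m} q A B = ΣB (closed-box q n) λ g → ΣB (free q m) λ h → 𝟙 (div? q A g B h ×-dec tc? (+ q) A g B)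

  𝟙-× : ∀ {P Q : Set} (d : Dec P) (e : Dec Q) → 𝟙 (d ×-dec e) ≡ 𝟙 d * 𝟙 e
  𝟙-× (yes _) (yes _) = refl
  𝟙-× (yes _) (no _)  = refl
  𝟙-× (no _)  (yes _) = refl
  𝟙-× (no _)  (no _)  = refl

  -- The free value of the contracted edge is either nonzero, which gives a flow counted on the
  -- left, or zero, which amounts to deleting e.
  Φ-delete-contract : ∀ q (e : Edge ν) (A : Vec (Edge ν) n) (B : Vec (Edge ν) m) →
    Φ (suc q) (e ∷ A) B ≡ Φ (suc q) A (e ∷ B) - Φ (suc q) A B
  Φ-delete-contract {n = n} {m = m} q e A B = sym (begin
    Φ (suc q) A (e ∷ B) - Φ (suc q) A B
      ≡⟨ cong (λ t → t - Φ (suc q) A B) (trans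
           (ΣB-Σr-swap (nz (suc q) n) 0ℤ (suc q) (λ a g → ΣB (free (suc q) m) λ h → 𝟙 (div? (suc q) A g (e ∷ B) (a ∷ h))))
           (Σr-cong 0ℤ (suc q) λ a → ΣB-cong (nz (suc q) n) λ g → ΣB-cong (free (suc q) m) λ h →
             𝟙-cong (div? (suc q) A g (e ∷ B) (a ∷ h)) (div? (suc q) (e ∷ A) (a ∷ g) B h)
               (Div-move⁻¹ e {A} {g} {B} {h}) (Div-move e {A} {g} {B} {h}))) ⟩
    F 0ℤ + Σr 1ℤ q F - Φ (suc q) A B
      ≡⟨ cong (λ t → t + Σr 1ℤ q F - Φ (suc q) A B) (ΣB-cong (nz (suc q) n) λ g → ΣB-cong (free (suc q) m) λ h →
           𝟙-cong (div? (suc q) (e ∷ A) (0ℤ ∷ g) B h) (div? (suc q) A g B h) (Div-zero e {A} {g} {B} {h}) (Div-zero⁻¹ e {A} {g} {B} {h})) ⟩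
    Φ (suc q) A B + Σr 1ℤ q F - Φ (suc q) A B
      ≡⟨ lemma (Φ (suc q) A B) (Σr 1ℤ q F) ⟩
    Φ (suc q) (e ∷ A) B ∎)
    where
    open ≡-Reasoning
    F : ℤ → ℤ
    F a = ΣB (nz (suc q) n) λ g → ΣB (free (suc q) m) λ h → 𝟙 (div? (suc q) (e ∷ A) (a ∷ g) B h)
    lemma : ∀ x y → x + y - x ≡ y
    lemma = solve-∀

  Φ-bridge : ∀ q (e : Edge ν) (A : Vec (Edge ν) n) (B : Vec (Edge ν) m) → Bridge e A B → Φ (suc q) (e ∷ A) B ≡ 0ℤ
  Φ-bridge {n = n} {m = m} q e A B br = trans
    (Σr-cong′ 1ℤ q λ a 1≤a a< →
      trans (ΣB-cong (nz (suc q) n) λ g → trans (ΣB-cong (free (suc q) m) λ h →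
        𝟙-no (div? (suc q) (e ∷ A) (a ∷ g) B h) (bridge-nonzero {A = A} {B} br {a} {g} {h} (suc[i]≤j⇒i<j 1≤a) a<)) (ΣB-0 (free (suc q) m)))
      (ΣB-0 (nz (suc q) n)))
    (Σr-0 1ℤ q)

  Uncut⇒CloE : ∀ {q x} (e : Edge ν) {S} → Uncut e S → CloE q e x S
  Uncut⇒CloE e un = (λ t f → contradiction (trans (sym t) (trans un f)) λ ()) ,
                    (λ f t → contradiction (trans (sym f) (trans un t)) λ ())

  Inv⇒Clo : ∀ {q} (A : Vec (Edge ν) n) {g S} → Inv A S → Clo q A g S
  Inv⇒Clo []      {[]}    []         = []
  Inv⇒Clo (e ∷ A) {x ∷ g} {S} (un ∷ inv) = Uncut⇒CloE e {S} un ∷ Inv⇒Clo A {g} {S} inv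

  private
    lookup-∪ : ∀ (S T : Subset ν) a → lookup (S ∪ T) a ≡ lookup S a ∨ lookup T a
    lookup-∪ S T a = lookup-zipWith _∨_ a S T
    lookup-∩ : ∀ (S T : Subset ν) a → lookup (S ∩ T) a ≡ lookup S a ∧ lookup T a
    lookup-∩ S T a = lookup-zipWith _∧_ a S T

    CloE-∪ : ∀ {q x} (e : Edge ν) {S T} → CloE q e x S → CloE q e x T → CloE q e x (S ∪ T)
    CloE-∪ (a , b) {S} {T} (p , r) (p′ , r′) rewrite lookup-∪ S T a | lookup-∪ S T b
      with lookup S a | lookup S b | lookup T a | lookup T b
    ... | true  | false | _     | false = (λ _ _ → p refl refl) , λ ()
    ... | false | false | true  | false = (λ _ _ → p′ refl refl) , λ ()
    ... | false | true  | false | _     = (λ _ ()) , λ _ _ → r refl refl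
    ... | false | false | false | true  = (λ _ ()) , λ _ _ → r′ refl refl
    ... | true  | true  | _     | _     = (λ _ ()) , λ ()
    ... | true  | false | _     | true  = (λ _ ()) , λ ()
    ... | false | true  | true  | _     = (λ _ ()) , λ ()
    ... | false | false | true  | true  = (λ _ ()) , λ ()
    ... | false | false | false | false = (λ ()) , λ _ ()

    CloE-∩ : ∀ {q x} (e : Edge ν) {S T} → CloE q e x S → CloE q e x T → CloE q e x (S ∩ T)
    CloE-∩ (a , b) {S} {T} (p , r) (p′ , r′) rewrite lookup-∩ S T a | lookup-∩ S T b
      with lookup S a | lookup S b | lookup T a | lookup T b
    ... | true  | false | true  | _     = (λ _ _ → p refl refl) , λ ()
    ... | true  | true  | true  | false = (λ _ _ → p′ refl refl) , λ ()
    ... | false | true  | _     | true  = (λ ()) , λ _ _ → r refl refl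
    ... | true  | true  | false | true  = (λ ()) , λ _ _ → r′ refl refl
    ... | false | false | _     | _     = (λ ()) , λ _ ()
    ... | true  | false | false | _     = (λ ()) , λ _ ()
    ... | false | true  | _     | false = (λ ()) , λ _ ()
    ... | true  | true  | false | false = (λ ()) , λ _ ()
    ... | true  | true  | true  | true  = (λ _ ()) , λ ()

    Clo-∪ : ∀ {q} (A : Vec (Edge ν) n) {g S T} → Clo q A g S → Clo q A g T → Clo q A g (S ∪ T)
    Clo-∪ []      []       []       = []
    Clo-∪ (e ∷ A) {_ ∷ g} {S} {T} (p ∷ ps) (r ∷ rs) = CloE-∪ e {S} {T} p r ∷ Clo-∪ A {g} {S} {T} ps rs

    Clo-∩ : ∀ {q} (A : Vec (Edge ν) n) {g S T} → Clo q A g S → Clo q A g T → Clo q A g (S ∩ T)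
    Clo-∩ []      []       []       = []
    Clo-∩ (e ∷ A) {_ ∷ g} {S} {T} (p ∷ ps) (r ∷ rs) = CloE-∩ e {S} {T} p r ∷ Clo-∩ A {g} {S} {T} ps rs

    Inv-∪ : (A : Vec (Edge ν) n) → ∀ {S T} → Inv A S → Inv A T → Inv A (S ∪ T)
    Inv-∪ []            []       []       = []
    Inv-∪ ((a , b) ∷ A) {S} {T} (p ∷ ps) (r ∷ rs) =
      trans (lookup-∪ S T a) (trans (cong₂ _∨_ p r) (sym (lookup-∪ S T b))) ∷ Inv-∪ A {S} {T} ps rs

    Inv-∩ : (A : Vec (Edge ν) n) → ∀ {S T} → Inv A S → Inv A T → Inv A (S ∩ T)
    Inv-∩ []            []       []       = []
    Inv-∩ ((a , b) ∷ A) {S} {T} (p ∷ ps) (r ∷ rs) =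
      trans (lookup-∩ S T a) (trans (cong₂ _∧_ p r) (sym (lookup-∩ S T b))) ∷ Inv-∩ A {S} {T} ps rs

    Inv-∁ : (A : Vec (Edge ν) n) → ∀ {S} → Inv A S → Inv A (∁ S)
    Inv-∁ []            []       = []
    Inv-∁ ((a , b) ∷ A) {S} (p ∷ ps) = trans (lookup-map a not S) (trans (cong not p) (sym (lookup-map b not S))) ∷ Inv-∁ A {S} ps

    -- Two closed sets whose union and intersection cut no edge could only cut an edge in opposite
    -- directions, which would force the values q and 0 on it.
    uncrossed : ∀ {q} → 0ℤ ≢ q → (A : Vec (Edge ν) n) → ∀ {g S T} → Clo q A g S → Clo q A g T →
      Inv A (S ∪ T) → Inv A (S ∩ T) → Inv A S
    uncrossed 0≢q [] [] [] [] [] = []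
    uncrossed {q = q} 0≢q ((a , b) ∷ A) {x ∷ g} {S} {T} (p ∷ ps) (r ∷ rs) (u ∷ us) (i ∷ is) =
      edge (lookup S a) (lookup S b) (lookup T a) (lookup T b) p r
        (trans (sym (lookup-∪ S T a)) (trans u (lookup-∪ S T b)))
        (trans (sym (lookup-∩ S T a)) (trans i (lookup-∩ S T b))) ∷ uncrossed 0≢q A {g} {S} {T} ps rs us is
      where
      edge : ∀ s s′ t t′ → (s ≡ true → s′ ≡ false → x ≡ q) × (s ≡ false → s′ ≡ true → x ≡ 0ℤ) →
        (t ≡ true → t′ ≡ false → x ≡ q) × (t ≡ false → t′ ≡ true → x ≡ 0ℤ) →
        s ∨ t ≡ s′ ∨ t′ → s ∧ t ≡ s′ ∧ t′ → s ≡ s′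
      edge true  true  t     t′    p r u i = refl
      edge false false t     t′    p r u i = refl
      edge true  false false true  (p , _) (_ , r) u i = contradiction (trans (sym (r refl refl)) (p refl refl)) 0≢q
      edge true  false true  t′    p r u ()
      edge true  false false false p r () i
      edge false true  true  false (_ , p) (r , _) u i = contradiction (trans (sym (p refl refl)) (r refl refl)) 0≢q
      edge false true  t     true  p r u ()
      edge false true  false false p r () i

    ¬TC⇒cut : ∀ {q} {A : Vec (Edge ν) n} {g} {B : Vec (Edge ν) m} → ¬ TC q A g B →
      ∃ λ S → Inv B S × Clo q A g S × ¬ Inv A S
    ¬TC⇒cut {q = q} {A} {g} {B} ¬tc with anySubset? (λ S → inv? B S ×-dec clo? q A g S ×-dec ¬? (inv? A S))
    ... | yes cut = cut
    ... | no none = contradiction (λ S invB clo → decidable-stable (inv? A S) λ ¬inv → none (S , invB , clo , ¬inv)) ¬tc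

  module _ {p : ℕ} {e : Edge ν} {A : Vec (Edge ν) n} {g : Vec ℤ n} {B : Vec (Edge ν) m} where
    private
      q = + suc p
      u = proj₁ e
      v = proj₂ e
      0≢q : 0ℤ ≢ q
      0≢q ()

    TC-contract : ∀ {x} → TC q (e ∷ A) (x ∷ g) B → TC q A g (e ∷ B)
    TC-contract tc S (un ∷ invB) clo with tc S invB (Uncut⇒CloE e {S} un ∷ clo)
    ... | _ ∷ invA = invA

    -- An edge with a value strictly between the ends carries both arcs. No closed set can cut it,
    -- exactly as if it were contracted.
    TC-uncontract : ∀ {x} → x ≢ 0ℤ → x ≢ q → TC q A g (e ∷ B) → TC q (e ∷ A) (x ∷ g) B
    TC-uncontract {x} x≢0 x≢q tc S invB (ce ∷ clo) = un ∷ tc S (un ∷ invB) clo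
      where
      edge : ∀ s t → (s ≡ true → t ≡ false → x ≡ q) × (s ≡ false → t ≡ true → x ≡ 0ℤ) → s ≡ t
      edge true  true  _       = refl
      edge true  false (f , _) = contradiction (f refl refl) x≢q
      edge false true  (_ , f) = contradiction (f refl refl) x≢0
      edge false false _       = refl
      un = edge (lookup S u) (lookup S v) ce

    module _ (nb : NonBridge e A B) where
      private
        insert : ∀ {x} → TC q A g B → TC q (e ∷ A) (x ∷ g) B
        insert tc S invB (_ ∷ clo) = nb S (tc S invB clo) invB ∷ tc S invB clo

        -- Given S closed without e, one direction of e keeps it closed. With value 0 the only arc
        -- of e starts at u, which is harmless for u outside S. With value q it ends at u, which is
        -- harmless for u inside S.
        both⇒delete : TC q (e ∷ A) (0ℤ ∷ g) B → TC q (e ∷ A) (q ∷ g) B → TC q A g B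
        both⇒delete tc₀ tc₁ S invB clo = edge (lookup S u) (lookup S v) refl refl
          where
          edge : ∀ s t → lookup S u ≡ s → lookup S v ≡ t → Inv A S
          edge false t eq eq′ = All.tail (tc₀ S invB (((λ s _ → contradiction (trans (sym eq) s) λ ()) , λ _ _ → refl) ∷ clo))
          edge true  t eq eq′ = All.tail (tc₁ S invB (((λ _ _ → refl) , λ s _ → contradiction (trans (sym eq) s) λ ()) ∷ clo))

        -- If both directions fail, closed sets S and T witness it. The first must be entered by e
        -- and the second left by e in the reference direction, so e crosses neither S ∪ T nor S ∩
        -- T. Both of these are closed in the contraction and hence cut no edge of A. By `uncrossed`
        -- neither does S, so S is crossed by e alone, and e would be a bridge.
        one-of : TC q A g (e ∷ B) → ¬ TC q (e ∷ A) (0ℤ ∷ g) B → ¬ TC q (e ∷ A) (q ∷ g) B → ⊥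
        one-of tc ¬tc₀ ¬tc₁ with ¬TC⇒cut {A = e ∷ A} {0ℤ ∷ g} {B} ¬tc₀ | ¬TC⇒cut {A = e ∷ A} {q ∷ g} {B} ¬tc₁
        ... | S , invBS , (ceS ∷ cloS) , ¬invS | T , invBT , (ceT ∷ cloT) , ¬invT =
          edge (lookup S u) (lookup S v) (lookup T u) (lookup T v) refl refl refl refl
          where
          cutS : lookup S u ≢ lookup S v
          cutS un = ¬invS (un ∷ tc S (un ∷ invBS) cloS)
          cutT : lookup T u ≢ lookup T v
          cutT un = ¬invT (un ∷ tc T (un ∷ invBT) cloT)
          edge : ∀ s s′ t t′ → lookup S u ≡ s → lookup S v ≡ s′ → lookup T u ≡ t → lookup T v ≡ t′ → ⊥
          edge true  false _ _ Su Sv Tu Tv = 0≢q (proj₁ ceS Su Sv)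
          edge _ _ false true  Su Sv Tu Tv = 0≢q (sym (proj₂ ceT Tu Tv))
          edge true  true  _ _ Su Sv Tu Tv = cutS (trans Su (sym Sv))
          edge false false _ _ Su Sv Tu Tv = cutS (trans Su (sym Sv))
          edge false true true  true  Su Sv Tu Tv = cutT (trans Tu (sym Tv))
          edge false true false false Su Sv Tu Tv = cutT (trans Tu (sym Tv))
          edge false true true false Su Sv Tu Tv = cutS (nb S invAS invBS)
            where
            ∪-uncut : Uncut e (S ∪ T)
            ∪-uncut = trans (trans (lookup-∪ S T u) (cong₂ _∨_ Su Tu)) (sym (trans (lookup-∪ S T v) (cong₂ _∨_ Sv Tv)))
            ∩-uncut : Uncut e (S ∩ T)
            ∩-uncut = trans (trans (lookup-∩ S T u) (cong₂ _∧_ Su Tu)) (sym (trans (lookup-∩ S T v) (cong₂ _∧_ Sv Tv)))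
            invAS : Inv A S
            invAS = uncrossed 0≢q A {g} {S} {T} cloS cloT
              (tc (S ∪ T) (∪-uncut ∷ Inv-∪ B {S} {T} invBS invBT) (Clo-∪ A {g} {S} {T} cloS cloT))
              (tc (S ∩ T) (∩-uncut ∷ Inv-∩ B {S} {T} invBS invBT) (Clo-∩ A {g} {S} {T} cloS cloT))

      -- Both sides count the good directions of e: at least one is good iff the contraction is
      -- totally cyclic, and both are good iff the deletion is totally cyclic as well.
      TC-delete-contract : 𝟙 (tc? q (e ∷ A) (0ℤ ∷ g) B) + 𝟙 (tc? q (e ∷ A) (q ∷ g) B) ≡ 𝟙 (tc? q A g (e ∷ B)) + 𝟙 (tc? q A g B)
      TC-delete-contract with tc? q (e ∷ A) (0ℤ ∷ g) B | tc? q (e ∷ A) (q ∷ g) B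
      ... | yes tc₀ | yes tc₁ = sym (cong₂ _+_ (𝟙-yes (tc? q A g (e ∷ B)) (TC-contract tc₀)) (𝟙-yes (tc? q A g B) (both⇒delete tc₀ tc₁)))
      ... | yes tc₀ | no ¬tc₁ = sym (cong₂ _+_ (𝟙-yes (tc? q A g (e ∷ B)) (TC-contract tc₀)) (𝟙-no (tc? q A g B) (¬tc₁ ∘ insert)))
      ... | no ¬tc₀ | yes tc₁ = sym (cong₂ _+_ (𝟙-yes (tc? q A g (e ∷ B)) (TC-contract tc₁)) (𝟙-no (tc? q A g B) (¬tc₀ ∘ insert)))
      ... | no ¬tc₀ | no ¬tc₁ = sym (cong₂ _+_ (𝟙-no (tc? q A g (e ∷ B)) (λ tc → one-of tc ¬tc₀ ¬tc₁)) (𝟙-no (tc? q A g B) (¬tc₀ ∘ insert)))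

  private
    Div-q : ∀ {q : ℕ} (e : Edge ν) {A : Vec (Edge ν) n} {g : Vec ℤ n} {B : Vec (Edge ν) m} {h : Vec ℤ m} →
      (Div q (e ∷ A) (+ q ∷ g) B h → Div q A g B h) × (Div q A g B h → Div q (e ∷ A) (+ q ∷ g) B h)
    Div-q {q = q} e {A} {g} {B} {h} =
      (λ div S → ∣-shift q (- c e S) (lemma₁ (c e S) (+ q) (∂ A g S) (∂ B h S)) (div S)) ,
      (λ div S → ∣-shift q (c e S) (lemma₂ (c e S) (+ q) (∂ A g S) (∂ B h S)) (div S))
      where
      lemma₁ : ∀ c q x y → x + y ≡ c * q + x + y + - c * q
      lemma₁ = solve-∀
      lemma₂ : ∀ c q x y → c * q + x + y ≡ x + y + c * q
      lemma₂ = solve-∀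

  -- Values strictly between 0 and q match the same values of the contracted edge. The ends 0 and q
  -- are one residue with two directions; together they yield the value 0 of the contracted edge and
  -- the deletion, by `TC-delete-contract`.
  Ψ-delete-contract : ∀ q (e : Edge ν) (A : Vec (Edge ν) n) (B : Vec (Edge ν) m) → NonBridge e A B →
    Ψ (suc q) (e ∷ A) B ≡ Ψ (suc q) A (e ∷ B) + Ψ (suc q) A B
  Ψ-delete-contract {n = n} {m = m} p e A B nb = begin
    F 0ℤ + Σr 1ℤ (suc p) F
      ≡⟨ cong (_+_ (F 0ℤ)) (trans (Σr-snoc 1ℤ p F) (cong (λ t → t + F q) (Σr-cong′ 1ℤ p middle))) ⟩
    F 0ℤ + (Σr 1ℤ p U + F q)
      ≡⟨ lemma₁ (F 0ℤ) (Σr 1ℤ p U) (F q) ⟩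
    (F 0ℤ + F q) + Σr 1ℤ p U
      ≡⟨ cong (λ t → t + Σr 1ℤ p U) ends ⟩
    (U 0ℤ + Ψ (suc p) A B) + Σr 1ℤ p U
      ≡⟨ lemma₂ (U 0ℤ) (Ψ (suc p) A B) (Σr 1ℤ p U) ⟩
    Σr 0ℤ (suc p) U + Ψ (suc p) A B
      ≡⟨ cong (λ t → t + Ψ (suc p) A B) (sym (ΣB-Σr-swap Γ 0ℤ (suc p) λ a g → ΣB Λ λ h → u a g h)) ⟩
    Ψ (suc p) A (e ∷ B) + Ψ (suc p) A B ∎
    where
    open ≡-Reasoning
    q = + suc p
    Γ = closed-box (suc p) n
    Λ = free (suc p) m
    f u : ℤ → Vec ℤ n → Vec ℤ m → ℤ
    f a g h = 𝟙 (div? (suc p) (e ∷ A) (a ∷ g) B h ×-dec tc? q (e ∷ A) (a ∷ g) B)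
    u a g h = 𝟙 (div? (suc p) A g (e ∷ B) (a ∷ h) ×-dec tc? q A g (e ∷ B))
    F U : ℤ → ℤ
    F a = ΣB Γ λ g → ΣB Λ λ h → f a g h
    U a = ΣB Γ λ g → ΣB Λ λ h → u a g h
    lemma₁ : ∀ x y z → x + (y + z) ≡ (x + z) + y
    lemma₁ = solve-∀
    lemma₂ : ∀ x y z → (x + y) + z ≡ (x + z) + y
    lemma₂ = solve-∀
    middle : ∀ a → 1ℤ ≤ a → a < 1ℤ + + p → F a ≡ U a
    middle a 1≤a a<q = ΣB-cong Γ λ g → ΣB-cong Λ λ h →
      𝟙-cong (div? (suc p) (e ∷ A) (a ∷ g) B h ×-dec tc? q (e ∷ A) (a ∷ g) B)
             (div? (suc p) A g (e ∷ B) (a ∷ h) ×-dec tc? q A g (e ∷ B))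
        (λ (d , t) → Div-move e {A} {g} {B} {h} d , TC-contract t)
        (λ (d , t) → Div-move⁻¹ e {A} {g} {B} {h} d ,
          TC-uncontract (λ { refl → contradiction 1≤a λ { (+≤+ ()) } }) (λ a≡q → <-irrefl a≡q a<q) t)
    pointwise : ∀ g h → f 0ℤ g h + f q g h ≡ u 0ℤ g h + 𝟙 (div? (suc p) A g B h ×-dec tc? q A g B)
    pointwise g h = begin
      f 0ℤ g h + f q g h
        ≡⟨ cong₂ _+_
             (trans (𝟙-× (div? (suc p) (e ∷ A) (0ℤ ∷ g) B h) (tc? q (e ∷ A) (0ℤ ∷ g) B)) (cong (_* T₀)
               (𝟙-cong (div? (suc p) (e ∷ A) (0ℤ ∷ g) B h) (div? (suc p) A g B h) (Div-zero e {A} {g} {B} {h}) (Div-zero⁻¹ e {A} {g} {B} {h}))))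
             (trans (𝟙-× (div? (suc p) (e ∷ A) (q ∷ g) B h) (tc? q (e ∷ A) (q ∷ g) B)) (cong (_* T₁)
               (𝟙-cong (div? (suc p) (e ∷ A) (q ∷ g) B h) (div? (suc p) A g B h)
                 (proj₁ (Div-q e {A} {g} {B} {h})) (proj₂ (Div-q e {A} {g} {B} {h}))))) ⟩
      D * T₀ + D * T₁
        ≡⟨ *-distribˡ-+ D T₀ T₁ ⟨
      D * (T₀ + T₁)
        ≡⟨ cong (D *_) (TC-delete-contract nb) ⟩
      D * (T₂ + T₃)
        ≡⟨ *-distribˡ-+ D T₂ T₃ ⟩
      D * T₂ + D * T₃
        ≡⟨ cong₂ _+_
             (trans (cong (_* T₂) (𝟙-cong (div? (suc p) A g B h) (div? (suc p) A g (e ∷ B) (0ℤ ∷ h))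
                 (λ d → Div-move e {A} {g} {B} {h} (Div-zero⁻¹ e {A} {g} {B} {h} d))
                 (λ d → Div-zero e {A} {g} {B} {h} (Div-move⁻¹ e {A} {g} {B} {h} d))))
               (sym (𝟙-× (div? (suc p) A g (e ∷ B) (0ℤ ∷ h)) (tc? q A g (e ∷ B)))))
             (sym (𝟙-× (div? (suc p) A g B h) (tc? q A g B))) ⟩
      u 0ℤ g h + 𝟙 (div? (suc p) A g B h ×-dec tc? q A g B) ∎
      where
      D  = 𝟙 (div? (suc p) A g B h)
      T₀ = 𝟙 (tc? q (e ∷ A) (0ℤ ∷ g) B)
      T₁ = 𝟙 (tc? q (e ∷ A) (q ∷ g) B)
      T₂ = 𝟙 (tc? q A g (e ∷ B))
      T₃ = 𝟙 (tc? q A g B)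
    ends : F 0ℤ + F q ≡ U 0ℤ + Ψ (suc p) A B
    ends = begin
      F 0ℤ + F q
        ≡⟨ ΣB-+ Γ _ _ ⟨
      ΣB Γ (λ g → ΣB Λ (f 0ℤ g) + ΣB Λ (f q g))
        ≡⟨ ΣB-cong Γ (λ g → trans (sym (ΣB-+ Λ _ _)) (trans (ΣB-cong Λ (pointwise g)) (ΣB-+ Λ _ _))) ⟩
      ΣB Γ (λ g → ΣB Λ (u 0ℤ g) + ΣB Λ (λ h → 𝟙 (div? (suc p) A g B h ×-dec tc? q A g B)))
        ≡⟨ ΣB-+ Γ _ _ ⟩
      U 0ℤ + Ψ (suc p) A B ∎

  -- Divisibility leaves only the values 0 and q, so e carries a single arc. Of S and its
  -- complement, the one that this arc does not leave is closed and yet cut by e.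
  Ψ-bridge : ∀ q (e : Edge ν) (A : Vec (Edge ν) n) (B : Vec (Edge ν) m) → Bridge e A B → Ψ (suc q) (e ∷ A) B ≡ 0ℤ
  Ψ-bridge {n = n} {m = m} p e@(u , v) A B br@(S , invA , invB , cut) = trans
    (ΣB-cong′ (closed-box (suc p) (suc n)) 
      {λ g → ΣB (free (suc p) m) λ h → 𝟙 (div? (suc p) (e ∷ A) g B h ×-dec tc? q (e ∷ A) g B)} {λ _ → 0ℤ} λ { (a ∷ g) ((0≤a , a<) ∷ _) →
      trans (ΣB-cong (free (suc p) m) λ h → 𝟙-no (div? (suc p) (e ∷ A) (a ∷ g) B h ×-dec tc? q (e ∷ A) (a ∷ g) B) λ (d , t) →
        impossible a g h 0≤a a< d t) (ΣB-0 (free (suc p) m)) })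
    (ΣB-0 (closed-box (suc p) (suc n)))
    where
    q = + suc p
    module _ (a : ℤ) (g : Vec ℤ n) (h : Vec ℤ m) (0≤a : 0ℤ ≤ a) (a≤q : a < 0ℤ + + suc (suc p))
             (d : Div (suc p) (e ∷ A) (a ∷ g) B h) (t : TC q (e ∷ A) (a ∷ g) B) where
      cut-∁ : ¬ Uncut e (∁ S)
      cut-∁ un = cut (not-injective (trans (sym (lookup-map u not S)) (trans un (lookup-map v not S))))
        where open import Data.Bool.Properties using (not-injective)
      refute : ∀ T → Inv A T → Inv B T → ¬ Uncut e T → CloE q e a T → ⊥
      refute T iA iB ¬un ce = ¬un (All.head (t T iB (ce ∷ Inv⇒Clo A {g} {T} iA)))
      at-end : ∀ s s′ → lookup S u ≡ s → lookup S v ≡ s′ → (a ≡ 0ℤ → ⊥) × (a ≡ q → ⊥)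
      at-end true true Su Sv = contradiction (trans Su (sym Sv)) cut
      at-end false false Su Sv = contradiction (trans Su (sym Sv)) cut
      at-end true false Su Sv =
        (λ a≡0 → refute (∁ S) (Inv-∁ A {S} invA) (Inv-∁ B {S} invB) cut-∁
          ((λ f _ → contradiction (trans (sym f) (trans (lookup-map u not S) (cong not Su))) λ ()) , λ _ _ → a≡0)) ,
        (λ a≡q → refute S invA invB cut ((λ _ _ → a≡q) , λ f _ → contradiction (trans (sym f) Su) λ ()))
      at-end false true Su Sv =
        (λ a≡0 → refute S invA invB cut ((λ f _ → contradiction (trans (sym f) Su) λ ()) , λ _ _ → a≡0)) ,
        (λ a≡q → refute (∁ S) (Inv-∁ A {S} invA) (Inv-∁ B {S} invB) cut-∁
          ((λ _ _ → a≡q) , λ f _ → contradiction (trans (sym f) (trans (lookup-map u not S) (cong not Su))) λ ()))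
      impossible : ⊥
      impossible = bridge-nonzero {A = A} {B} br {a} {g} {h} (≤∧≢⇒< 0≤a (a≢0 ∘ sym)) (≤∧≢⇒< (i<j⇒i≤pred[j] a≤q) a≢q) d
        where
        a≢0 = proj₁ (at-end (lookup S u) (lookup S v) refl refl)
        a≢q = proj₂ (at-end (lookup S u) (lookup S v) refl refl)

  Ψ-edgeless : ∀ q (B : Vec (Edge ν) m) → Ψ q [] B ≡ Fl q [] B
  Ψ-edgeless {m = m} q B = ΣB-cong (free q m) λ h →
    𝟙-cong (div? q [] [] B h ×-dec tc? (+ q) [] [] B) (div? q [] [] B h) proj₁ (λ d → d , λ S _ _ → [])

-- Rational polynomials and the passage from ℤ to ℚ

module RationalPolynomials where
  open FacePolynomials using (b; newton)
  open import Defs using (Poly; eval; ℕtoℚ; signPow; sumℚ)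
  open import Data.Nat as ℕ using (ℕ; zero; suc)
  import Data.Nat.Properties as ℕ
  open import Data.Integer as ℤ using (ℤ; +_; 0ℤ; 1ℤ)
  import Data.Integer.Properties as ℤ
  import Data.Integer.Tactic.RingSolver as ℤ
  open import Data.Rational using (ℚ; 0ℚ; 1ℚ; _+_; _-_; _*_; -_; 1/_; _/_; ≢-nonZero; toℚᵘ)
  open import Data.Rational.Properties
  import Data.Rational.Unnormalised as ℚᵘ
  import Data.Rational.Unnormalised.Properties as ℚᵘ
  open import Data.Fin using (Fin; zero; suc; fromℕ)
  open import Data.List using (List; []; _∷_; map; length)
  open import Data.Maybe using (just; nothing)
  open import Data.Product using (Σ; _×_; _,_)
  open import Data.Vec as Vec using (Vec; []; _∷_; toList; _∷ʳ_; lookup; zipWith)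
  open import Function using (_∘_)
  open import Relation.Nullary using (yes; no)
  open import Relation.Binary.PropositionalEquality using (_≡_; _≢_; refl; sym; trans; cong; cong₂; module ≡-Reasoning)
  open import Tactic.RingSolver using (solve-∀)
  open import Tactic.RingSolver.Core.AlmostCommutativeRing using (AlmostCommutativeRing; fromCommutativeRing)
  open import Level using (0ℓ)

  private variable
    n : ℕ

  private
    ℚ-ring : AlmostCommutativeRing 0ℓ 0ℓ
    ℚ-ring = fromCommutativeRing +-*-commutativeRing λ p → is-zero p
      where
      open import Data.Maybe using (Maybe)
      is-zero : ∀ p → Maybe (0ℚ ≡ p)
      is-zero p with 0ℚ ≟ p
      ... | yes eq = just eq
      ... | no _   = nothing

  ι : ℤ → ℚ
  ι z = z / 1

  private
    toℚᵘ-ι : ∀ z → toℚᵘ (ι z) ℚᵘ.≃ ℚᵘ.mkℚᵘ z 0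
    toℚᵘ-ι z = toℚᵘ-fromℚᵘ (ℚᵘ.mkℚᵘ z 0)

  ι-+ : ∀ x y → ι (x ℤ.+ y) ≡ ι x + ι y
  ι-+ x y = toℚᵘ-injective (begin
    toℚᵘ (ι (x ℤ.+ y))                   ≈⟨ toℚᵘ-ι (x ℤ.+ y) ⟩
    ℚᵘ.mkℚᵘ (x ℤ.+ y) 0                  ≈⟨ ℚᵘ.*≡* (lemma x y) ⟩
    ℚᵘ.mkℚᵘ x 0 ℚᵘ.+ ℚᵘ.mkℚᵘ y 0         ≈⟨ ℚᵘ.+-cong (toℚᵘ-ι x) (toℚᵘ-ι y) ⟨
    toℚᵘ (ι x) ℚᵘ.+ toℚᵘ (ι y)           ≈⟨ toℚᵘ-homo-+ (ι x) (ι y) ⟨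
    toℚᵘ (ι x + ι y)                     ∎)
    where
    open import Relation.Binary.Reasoning.Setoid ℚᵘ.≃-setoid
    lemma : ∀ x y → (x ℤ.+ y) ℤ.* 1ℤ ≡ (x ℤ.* 1ℤ ℤ.+ y ℤ.* 1ℤ) ℤ.* 1ℤ
    lemma = ℤ.solve-∀

  ι-* : ∀ x y → ι (x ℤ.* y) ≡ ι x * ι y
  ι-* x y = toℚᵘ-injective (begin
    toℚᵘ (ι (x ℤ.* y))                   ≈⟨ toℚᵘ-ι (x ℤ.* y) ⟩
    ℚᵘ.mkℚᵘ x 0 ℚᵘ.* ℚᵘ.mkℚᵘ y 0         ≈⟨ ℚᵘ.*-cong (toℚᵘ-ι x) (toℚᵘ-ι y) ⟨
    toℚᵘ (ι x) ℚᵘ.* toℚᵘ (ι y)           ≈⟨ toℚᵘ-homo-* (ι x) (ι y) ⟨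
    toℚᵘ (ι x * ι y)                     ∎)
    where open import Relation.Binary.Reasoning.Setoid ℚᵘ.≃-setoid

  ι-neg : ∀ x → ι (ℤ.- x) ≡ - ι x
  ι-neg x = begin
    ι (ℤ.- x)                  ≡⟨ lemma (ι (ℤ.- x)) (ι x) ⟩
    ι (ℤ.- x) + ι x - ι x      ≡⟨ cong (_- ι x) (trans (sym (ι-+ (ℤ.- x) x)) (cong ι (ℤ.+-inverseˡ x))) ⟩
    0ℚ - ι x                   ≡⟨ +-identityˡ (- ι x) ⟩
    - ι x                      ∎
    where
    open ≡-Reasoning
    lemma : ∀ a b → a ≡ a + b - b
    lemma = solve-∀ ℚ-ring

  ι-injective : ∀ {x y} → ι x ≡ ι y → x ≡ y
  ι-injective {x} {y} eq with fromℚᵘ-injective {ℚᵘ.mkℚᵘ x 0} {ℚᵘ.mkℚᵘ y 0} eq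
  ... | ℚᵘ.*≡* x≡y = ℤ.*-cancelʳ-≡ x y 1ℤ x≡y

  private
    ι-suc≢0 : ∀ k → ι (+ suc k) ≢ 0ℚ
    ι-suc≢0 k eq with ι-injective {+ suc k} {0ℤ} eq
    ... | ()

  recip : ℕ → ℚ
  recip k = 1/_ (ι (+ suc k)) {{≢-nonZero (ι-suc≢0 k)}}

  recip-inverse : ∀ k → recip k * ι (+ suc k) ≡ 1ℚ
  recip-inverse k = *-inverseˡ (ι (+ suc k)) {{≢-nonZero (ι-suc≢0 k)}}

  ι-suc-cancel : ∀ k {x} → ι (+ suc k) * x ≡ 0ℚ → x ≡ 0ℚ
  ι-suc-cancel k {x} eq = begin
    x                             ≡⟨ *-identityˡ x ⟨
    1ℚ * x                        ≡⟨ cong (_* x) (recip-inverse k) ⟨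
    recip k * ι (+ suc k) * x     ≡⟨ *-assoc (recip k) (ι (+ suc k)) x ⟩
    recip k * (ι (+ suc k) * x)   ≡⟨ cong (recip k *_) eq ⟩
    recip k * 0ℚ                  ≡⟨ *-zeroʳ (recip k) ⟩
    0ℚ                            ∎
    where open ≡-Reasoning

  addP : Poly → Poly → Poly
  addP []      r       = r
  addP (x ∷ p) []      = x ∷ p
  addP (x ∷ p) (y ∷ r) = (x + y) ∷ addP p r

  private
    add-step : ∀ c d t x y → (c + d) + t * (x + y) ≡ (c + t * x) + (d + t * y)
    add-step = solve-∀ ℚ-ring

  eval-addP : ∀ p r t → eval (addP p r) t ≡ eval p t + eval r t
  eval-addP []      r       t = sym (+-identityˡ _)
  eval-addP (x ∷ p) []      t = sym (+-identityʳ _)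
  eval-addP (x ∷ p) (y ∷ r) t = trans (cong (λ z → (x + y) + t * z) (eval-addP p r t)) (add-step x y t (eval p t) (eval r t))

  scaleP : ℚ → Poly → Poly
  scaleP a = map (a *_)

  eval-scaleP : ∀ a p t → eval (scaleP a p) t ≡ a * eval p t
  eval-scaleP a []      t = sym (*-zeroʳ a)
  eval-scaleP a (x ∷ p) t = trans (cong (λ z → a * x + t * z) (eval-scaleP a p t)) (lemma a x t (eval p t))
    where
    lemma : ∀ a x t z → a * x + t * (a * z) ≡ a * (x + t * z)
    lemma = solve-∀ ℚ-ring

  private
    -- Synthetic division by t - a.
    quotient : Poly → ℚ → Poly
    quotient []      a = []
    quotient (x ∷ p) a = eval p a ∷ quotient p a

    eval-quotient : ∀ p a t → eval p t ≡ eval p a + (t - a) * eval (quotient p a) t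
    eval-quotient []      a t = lemma t a
      where
      lemma : ∀ t a → 0ℚ ≡ 0ℚ + (t - a) * 0ℚ
      lemma = solve-∀ ℚ-ring
    eval-quotient (x ∷ p) a t = trans (cong (λ z → x + t * z) (eval-quotient p a t))
      (lemma t a x (eval p a) (eval (quotient p a) t))
      where
      lemma : ∀ t a c e f → c + t * (e + (t - a) * f) ≡ c + a * e + (t - a) * (e + t * f)
      lemma = solve-∀ ℚ-ring

    -- The quotient has the length of p although its last coefficient is eval [] a = 0; dropping it
    -- makes the recursion structural.
    trim : ∀ x p a → Σ Poly λ r → length r ≡ length p × (∀ t → eval (quotient (x ∷ p) a) t ≡ eval r t)
    trim x []      a = [] , refl , λ t → lemma t
      where
      lemma : ∀ t → 0ℚ + t * 0ℚ ≡ 0ℚ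
      lemma = solve-∀ ℚ-ring
    trim x (y ∷ p) a with trim y p a
    ... | r , len , eq = eval (y ∷ p) a ∷ r , cong suc len , λ t → cong (λ z → eval (y ∷ p) a + t * z) (eq t)

    -- Dividing by t - k leaves a shorter polynomial that vanishes from k + 1 on, because the factor
    -- t - k equals j + 1 ≠ 0 at t = k + 1 + j. The length l carries the recursion.
    vanish : ∀ l p → length p ≡ l → ∀ k → (∀ j → eval p (ℕtoℚ (k ℕ.+ j)) ≡ 0ℚ) → ∀ t → eval p t ≡ 0ℚ
    vanish l       []      _   k zeros t = refl
    vanish (suc l) (x ∷ p) len k zeros t with trim x p (ℕtoℚ k)
    ... | r , len′ , eq = begin
      eval (x ∷ p) t
        ≡⟨ factor t ⟩
      (t - ℕtoℚ k) * eval r t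
        ≡⟨ cong ((t - ℕtoℚ k) *_) (vanish l r (trans len′ (ℕ.suc-injective len)) (suc k) zeros′ t) ⟩
      (t - ℕtoℚ k) * 0ℚ
        ≡⟨ *-zeroʳ (t - ℕtoℚ k) ⟩
      0ℚ ∎
      where
      open ≡-Reasoning
      factor : ∀ t → eval (x ∷ p) t ≡ (t - ℕtoℚ k) * eval r t
      factor t = begin
        eval (x ∷ p) t
          ≡⟨ eval-quotient (x ∷ p) (ℕtoℚ k) t ⟩
        eval (x ∷ p) (ℕtoℚ k) + (t - ℕtoℚ k) * eval (quotient (x ∷ p) (ℕtoℚ k)) t
          ≡⟨ cong₂ (λ u v → u + (t - ℕtoℚ k) * v)
               (trans (cong (eval (x ∷ p) ∘ ℕtoℚ) (sym (ℕ.+-identityʳ k))) (zeros 0)) (eq t) ⟩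
        0ℚ + (t - ℕtoℚ k) * eval r t
          ≡⟨ +-identityˡ _ ⟩
        (t - ℕtoℚ k) * eval r t ∎
      zeros′ : ∀ j → eval r (ℕtoℚ (suc k ℕ.+ j)) ≡ 0ℚ
      zeros′ j = ι-suc-cancel j (begin
        ι (+ suc j) * eval r s         ≡⟨ cong (_* eval r s) difference ⟩
        (s - ℕtoℚ k) * eval r s        ≡⟨ factor s ⟨
        eval (x ∷ p) s                 ≡⟨ cong (eval (x ∷ p) ∘ ℕtoℚ) (sym (ℕ.+-suc k j)) ⟩
        eval (x ∷ p) (ℕtoℚ (k ℕ.+ suc j)) ≡⟨ zeros (suc j) ⟩
        0ℚ                             ∎)
        where
        s = ℕtoℚ (suc k ℕ.+ j)
        lemma : ∀ a b → b ≡ a + b - a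
        lemma = solve-∀ ℚ-ring
        difference : ι (+ suc j) ≡ s - ℕtoℚ k
        difference = trans (lemma (ι (+ k)) (ι (+ suc j)))
          (cong (_- ℕtoℚ k) (trans (sym (ι-+ (+ k) (+ suc j))) (cong ℕtoℚ (ℕ.+-suc k j))))

  eval-unique : ∀ p r → (∀ q → eval p (ℕtoℚ (suc q)) ≡ eval r (ℕtoℚ (suc q))) → ∀ t → eval p t ≡ eval r t
  eval-unique p r agree t = begin
    eval p t                                    ≡⟨ lemma (eval p t) (eval r t) ⟩
    (eval p t + - 1ℚ * eval r t) + eval r t     ≡⟨ cong (_+ eval r t) (sym (eval-diff t)) ⟩
    eval diff t + eval r t                      ≡⟨ cong (_+ eval r t) (vanish (length diff) diff refl 1 zeros t) ⟩
    0ℚ + eval r t                               ≡⟨ +-identityˡ _ ⟩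
    eval r t                                    ∎
    where
    open ≡-Reasoning
    diff = addP p (scaleP (- 1ℚ) r)
    eval-diff : ∀ t → eval diff t ≡ eval p t + - 1ℚ * eval r t
    eval-diff t = trans (eval-addP p (scaleP (- 1ℚ) r) t) (cong (_+_ (eval p t)) (eval-scaleP (- 1ℚ) r t))
    lemma : ∀ a b → a ≡ (a + - 1ℚ * b) + b
    lemma = solve-∀ ℚ-ring
    lemma′ : ∀ b → b + - 1ℚ * b ≡ 0ℚ
    lemma′ = solve-∀ ℚ-ring
    zeros : ∀ j → eval diff (ℕtoℚ (1 ℕ.+ j)) ≡ 0ℚ
    zeros j = trans (eval-diff _) (trans (cong (λ z → z + - 1ℚ * eval r (ℕtoℚ (suc j))) (agree j)) (lemma′ (eval r (ℕtoℚ (suc j)))))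

  sumP : (Fin n → Poly) → Poly
  sumP {zero}  ps = []
  sumP {suc n} ps = addP (ps zero) (sumP (ps ∘ suc))

  eval-sumP : (ps : Fin n → Poly) → ∀ t → eval (sumP ps) t ≡ sumℚ (λ i → eval (ps i) t)
  eval-sumP {zero}  ps t = refl
  eval-sumP {suc n} ps t = trans (eval-addP (ps zero) (sumP (ps ∘ suc)) t) (cong (_+_ (eval (ps zero) t)) (eval-sumP (ps ∘ suc) t))

  private
    -- The recursions of the rising factorial in k and in q, proved simultaneously because each
    -- induction step uses the other identity. The first one makes b a rational polynomial in q.
    b-next : ∀ k q → + suc k ℤ.* b (suc k) q ≡ (+ q ℤ.+ + k) ℤ.* b k q
    b-shift : ∀ k q → + q ℤ.* b k (suc q) ≡ (+ q ℤ.+ + k) ℤ.* b k q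
    b-next zero    zero    = refl
    b-next (suc k) zero    = trans (ℤ.*-zeroʳ (+ suc (suc k))) (sym (ℤ.*-zeroʳ (0ℤ ℤ.+ + suc k)))
    b-next k       (suc q) = begin
      + suc k ℤ.* (b (suc k) q ℤ.+ b k (suc q))
        ≡⟨ ℤ.*-distribˡ-+ (+ suc k) (b (suc k) q) (b k (suc q)) ⟩
      + suc k ℤ.* b (suc k) q ℤ.+ + suc k ℤ.* b k (suc q)
        ≡⟨ cong (ℤ._+ (+ suc k ℤ.* b k (suc q))) (trans (b-next k q) (sym (b-shift k q))) ⟩
      + q ℤ.* b k (suc q) ℤ.+ + suc k ℤ.* b k (suc q)
        ≡⟨ lemma (+ q) (+ k) (b k (suc q)) ⟩
      (+ suc q ℤ.+ + k) ℤ.* b k (suc q) ∎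
      where
      open ≡-Reasoning
      lemma : ∀ q k x → q ℤ.* x ℤ.+ (1ℤ ℤ.+ k) ℤ.* x ≡ (1ℤ ℤ.+ q ℤ.+ k) ℤ.* x
      lemma = ℤ.solve-∀
    b-shift zero    q = cong (ℤ._* 1ℤ) (sym (ℤ.+-identityʳ (+ q)))
    b-shift (suc k) q = begin
      + q ℤ.* (b (suc k) q ℤ.+ b k (suc q))
        ≡⟨ ℤ.*-distribˡ-+ (+ q) (b (suc k) q) (b k (suc q)) ⟩
      + q ℤ.* b (suc k) q ℤ.+ + q ℤ.* b k (suc q)
        ≡⟨ cong (ℤ._+_ (+ q ℤ.* b (suc k) q)) (trans (b-shift k q) (sym (b-next k q))) ⟩
      + q ℤ.* b (suc k) q ℤ.+ + suc k ℤ.* b (suc k) q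
        ≡⟨ ℤ.*-distribʳ-+ (b (suc k) q) (+ q) (+ suc k) ⟨
      (+ q ℤ.+ + suc k) ℤ.* b (suc k) q ∎
      where open ≡-Reasoning

    bP : ℕ → Poly
    bP zero    = 1ℚ ∷ []
    bP (suc k) = scaleP (recip k) (addP (0ℚ ∷ bP k) (scaleP (ℕtoℚ k) (bP k)))

    eval-bP : ∀ k q → eval (bP k) (ℕtoℚ q) ≡ ι (b k q)
    eval-bP zero    q = lemma (ℕtoℚ q)
      where
      lemma : ∀ t → 1ℚ + t * 0ℚ ≡ 1ℚ
      lemma = solve-∀ ℚ-ring
    eval-bP (suc k) q = begin
      eval (bP (suc k)) t
        ≡⟨ eval-scaleP (recip k) (addP (0ℚ ∷ bP k) (scaleP (ℕtoℚ k) (bP k))) t ⟩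
      recip k * eval (addP (0ℚ ∷ bP k) (scaleP (ℕtoℚ k) (bP k))) t
        ≡⟨ cong (recip k *_) (trans (eval-addP (0ℚ ∷ bP k) (scaleP (ℕtoℚ k) (bP k)) t) (cong (_+_ (0ℚ + t * eval (bP k) t)) (eval-scaleP (ℕtoℚ k) (bP k) t))) ⟩
      recip k * ((0ℚ + t * eval (bP k) t) + ℕtoℚ k * eval (bP k) t)
        ≡⟨ cong (recip k *_) (lemma t (ℕtoℚ k) (eval (bP k) t)) ⟩
      recip k * ((t + ℕtoℚ k) * eval (bP k) t)
        ≡⟨ cong (recip k *_) (cong₂ _*_ (sym (ι-+ (+ q) (+ k))) (eval-bP k q)) ⟩
      recip k * (ι (+ q ℤ.+ + k) * ι (b k q))
        ≡⟨ cong (recip k *_) (trans (sym (ι-* (+ q ℤ.+ + k) (b k q))) (trans (cong ι (sym (b-next k q))) (ι-* (+ suc k) (b (suc k) q)))) ⟩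
      recip k * (ι (+ suc k) * ι (b (suc k) q))
        ≡⟨ *-assoc (recip k) (ι (+ suc k)) (ι (b (suc k) q)) ⟨
      recip k * ι (+ suc k) * ι (b (suc k) q)
        ≡⟨ cong (_* ι (b (suc k) q)) (recip-inverse k) ⟩
      1ℚ * ι (b (suc k) q)
        ≡⟨ *-identityˡ _ ⟩
      ι (b (suc k) q) ∎
      where
      open ≡-Reasoning
      t = ℕtoℚ q
      lemma : ∀ t k x → (0ℚ + t * x) + k * x ≡ (t + k) * x
      lemma = solve-∀ ℚ-ring

  newtonP : ℕ → List ℤ → Poly
  newtonP k []       = []
  newtonP k (x ∷ xs) = addP (scaleP (ι x) (bP k)) (newtonP (suc k) xs)

  eval-newtonP : ∀ k xs q → eval (newtonP k xs) (ℕtoℚ q) ≡ ι (newton k xs q)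
  eval-newtonP k []       q = refl
  eval-newtonP k (x ∷ xs) q = begin
    eval (addP (scaleP (ι x) (bP k)) (newtonP (suc k) xs)) (ℕtoℚ q)
      ≡⟨ eval-addP (scaleP (ι x) (bP k)) (newtonP (suc k) xs) (ℕtoℚ q) ⟩
    eval (scaleP (ι x) (bP k)) (ℕtoℚ q) + eval (newtonP (suc k) xs) (ℕtoℚ q)
      ≡⟨ cong₂ _+_ (trans (eval-scaleP (ι x) (bP k) (ℕtoℚ q)) (trans (cong (ι x *_) (eval-bP k q)) (sym (ι-* x (b k q)))))
                   (eval-newtonP (suc k) xs q) ⟩
    ι (x ℤ.* b k q) + ι (newton (suc k) xs q)
      ≡⟨ ι-+ (x ℤ.* b k q) (newton (suc k) xs q) ⟨
    ι (newton k (x ∷ xs) q) ∎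
    where open ≡-Reasoning

  evalV : Vec ℚ n → ℚ → ℚ
  evalV v = eval (toList v)

  evalV-zipWith-+ : (u v : Vec ℚ n) → ∀ t → evalV (zipWith _+_ u v) t ≡ evalV u t + evalV v t
  evalV-zipWith-+ []      []      t = refl
  evalV-zipWith-+ (x ∷ u) (y ∷ v) t = trans (cong (λ z → (x + y) + t * z) (evalV-zipWith-+ u v t)) (add-step x y t (evalV u t) (evalV v t))

  evalV-zipWith-minus : (u v : Vec ℚ n) → ∀ t → evalV (zipWith _-_ u v) t ≡ evalV u t - evalV v t
  evalV-zipWith-minus []      []      t = refl
  evalV-zipWith-minus (x ∷ u) (y ∷ v) t = trans (cong (λ z → (x - y) + t * z) (evalV-zipWith-minus u v t)) (lemma x y t (evalV u t) (evalV v t))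
    where
    lemma : ∀ c d t x y → (c - d) + t * (x - y) ≡ (c + t * x) - (d + t * y)
    lemma = solve-∀ ℚ-ring

  -- The deletion has corank one less; padding aligns its coefficient vector with that of the
  -- contraction and puts 0 in the leading place.
  pad : Vec ℚ n → Vec ℚ (suc n)
  pad v = v ∷ʳ 0ℚ

  evalV-pad : (v : Vec ℚ n) → ∀ t → evalV (pad v) t ≡ evalV v t
  evalV-pad []      t = lemma t
    where
    lemma : ∀ t → 0ℚ + t * 0ℚ ≡ 0ℚ
    lemma = solve-∀ ℚ-ring
  evalV-pad (x ∷ v) t = cong (λ z → x + t * z) (evalV-pad v t)

  lookup-pad : (v : Vec ℚ n) → lookup (pad v) (fromℕ n) ≡ 0ℚ
  lookup-pad []      = refl
  lookup-pad (x ∷ v) = lookup-pad v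

  evalV-zero : ∀ n t → evalV (Vec.replicate n 0ℚ) t ≡ 0ℚ
  evalV-zero zero    t = refl
  evalV-zero (suc n) t = trans (cong (λ z → 0ℚ + t * z) (evalV-zero n t)) (lemma t)
    where
    lemma : ∀ t → 0ℚ + t * 0ℚ ≡ 0ℚ
    lemma = solve-∀ ℚ-ring

  monomial : ∀ n → Vec ℚ (suc n)
  monomial zero    = 1ℚ ∷ []
  monomial (suc n) = 0ℚ ∷ monomial n

  lookup-monomial : ∀ n → lookup (monomial n) (fromℕ n) ≡ 1ℚ
  lookup-monomial zero    = refl
  lookup-monomial (suc n) = lookup-monomial n

  evalV-monomial : ∀ n z → evalV (monomial n) (ι z) ≡ ι (z ℤ.^ n)
  evalV-monomial zero    z = lemma (ι z)
    where
    lemma : ∀ t → 1ℚ + t * 0ℚ ≡ 1ℚ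
    lemma = solve-∀ ℚ-ring
  evalV-monomial (suc n) z = trans (+-identityˡ _) (trans (cong (ι z *_) (evalV-monomial n z)) (sym (ι-* z (z ℤ.^ n))))

  evalV-monomial-neg : ∀ n t → evalV (monomial n) (- t) ≡ signPow n * evalV (monomial n) t
  evalV-monomial-neg zero    t = lemma t
    where
    lemma : ∀ t → 1ℚ + - t * 0ℚ ≡ 1ℚ * (1ℚ + t * 0ℚ)
    lemma = solve-∀ ℚ-ring
  evalV-monomial-neg (suc n) t = trans (cong (λ z → 0ℚ + - t * z) (evalV-monomial-neg n t)) (lemma t (signPow n) (evalV (monomial n) t))
    where
    lemma : ∀ t s z → 0ℚ + - t * (s * z) ≡ - s * (0ℚ + t * z)
    lemma = solve-∀ ℚ-ring

-- Degree and reciprocity by deletion and contraction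

module Reciprocity where
  open BoxSums
  open CutPairing
  open ClosedSets
  open FreeFlows
  open DeletionContraction
  open RationalPolynomials
  open import Defs using (ℕtoℚ; signPow)
  open import Data.Nat as ℕ using (ℕ; zero; suc)
  import Data.Nat.Properties as ℕ
  open import Data.Integer as ℤ using (ℤ; +_)
  import Data.Integer.Properties as ℤ
  open import Data.Rational using (ℚ; 0ℚ; 1ℚ; _+_; _-_; _*_; -_)
  open import Data.Rational.Properties
  open import Data.Fin using (fromℕ)
  open import Data.Fin.Subset.Properties using (anySubset?)
  open import Data.Product using (_×_; _,_; proj₁; proj₂)
  open import Data.Sum using (_⊎_; inj₁; inj₂; [_,_]′)
  open import Data.Unit using (⊤)
  open import Data.Vec using (Vec; []; _∷_; lookup; zipWith; replicate)
  open import Data.Vec.Properties using (lookup-zipWith)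
  open import Relation.Binary using (Tri; tri<; tri≈; tri>)
  open import Relation.Nullary using (yes; no; contradiction)
  open import Relation.Nullary.Decidable using (_×-dec_; ¬?; decidable-stable)
  open import Relation.Binary.PropositionalEquality using (_≡_; refl; sym; trans; cong; cong₂; subst; module ≡-Reasoning)

  private variable
    ν n m : ℕ

  -- Only the branch of the recursion that contracts every edge determines the leading coefficient.
  -- Along it no edge is deleted, so each e is tested against all the other edges, and bridges
  -- created by deletions in other branches do no harm.
  NoBridges : Vec (Edge ν) n → Vec (Edge ν) m → Set
  NoBridges []      B = ⊤
  NoBridges (e ∷ A) B = NonBridge e A B × NoBridges A (e ∷ B)

  record Reciprocal (A : Vec (Edge ν) n) (B : Vec (Edge ν) m) (r : ℕ) : Set where
    field
      p p̄     : Vec ℚ (suc r)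
      counts   : ∀ q → evalV p (ℕtoℚ (suc q)) ≡ ι (Φ (suc q) A B)
      counts̄   : ∀ q → evalV p̄ (ℕtoℚ (suc q)) ≡ ι (Ψ (suc q) A B)
      reflects : ∀ t → evalV p (- t) ≡ signPow r * evalV p̄ t
      monic    : NoBridges A B → lookup p (fromℕ r) ≡ 1ℚ
  open Reciprocal

  private
    2^-pos : ∀ n → (+ 2) ℤ.^ n ≡ + (2 ℕ.^ n)
    2^-pos zero    = refl
    2^-pos (suc n) = trans (cong ((+ 2) ℤ.*_) (2^-pos n)) (sym (ℤ.pos-* 2 (2 ℕ.^ n)))

    2^-injective : ∀ r s → (+ 2) ℤ.^ r ≡ (+ 2) ℤ.^ s → r ≡ s
    2^-injective r s eq = compare (ℕ.<-cmp r s)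
      where
      eq′ : 2 ℕ.^ r ≡ 2 ℕ.^ s
      eq′ = ℤ.+-injective (trans (sym (2^-pos r)) (trans eq (2^-pos s)))
      compare : Tri (r ℕ.< s) (r ≡ s) (s ℕ.< r) → r ≡ s
      compare (tri≈ _ r≡s _) = r≡s
      compare (tri< r<s _ _) = contradiction eq′ (ℕ.<⇒≢ (ℕ.^-monoʳ-< 2 ℕ.≤-refl r<s))
      compare (tri> _ _ s<r) = contradiction (sym eq′) (ℕ.<⇒≢ (ℕ.^-monoʳ-< 2 ℕ.≤-refl s<r))

    -- Comparing the flow counts at q = 2, where powers determine their exponents.
    corank-nonbridge : ∀ (e : Edge ν) (A : Vec (Edge ν) n) (B : Vec (Edge ν) m) {r s} → NonBridge e A B →
      Corank (e ∷ A) B r → Corank A B s → r ≡ suc s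
    corank-nonbridge e A B {r} {s} nb cor cor′ = 2^-injective r (suc s)
      (trans (sym (cor 1)) (trans (Fl-nonbridge 2 e A B nb) (cong ((+ 2) ℤ.*_) (cor′ 1))))

    combine : ∀ (e : Edge ν) (A : Vec (Edge ν) n) (B : Vec (Edge ν) m) {r} → NonBridge e A B →
      Reciprocal A (e ∷ B) (suc r) → Reciprocal A B r → Reciprocal (e ∷ A) B (suc r)
    combine e A B {r} nb C D = record
      { p        = zipWith _-_ (C .p) (pad (D .p))
      ; p̄        = zipWith _+_ (C .p̄) (pad (D .p̄))
      ; counts   = λ q → begin
          evalV (zipWith _-_ (C .p) (pad (D .p))) (ℕtoℚ (suc q))
            ≡⟨ minus (ℕtoℚ (suc q)) ⟩
          evalV (C .p) (ℕtoℚ (suc q)) - evalV (D .p) (ℕtoℚ (suc q))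
            ≡⟨ cong₂ _-_ (C .counts q) (D .counts q) ⟩
          ι (Φ (suc q) A (e ∷ B)) - ι (Φ (suc q) A B)
            ≡⟨ cong (_+_ (ι (Φ (suc q) A (e ∷ B)))) (ι-neg (Φ (suc q) A B)) ⟨
          ι (Φ (suc q) A (e ∷ B)) + ι (ℤ.- Φ (suc q) A B)
            ≡⟨ ι-+ (Φ (suc q) A (e ∷ B)) (ℤ.- Φ (suc q) A B) ⟨
          ι (Φ (suc q) A (e ∷ B) ℤ.- Φ (suc q) A B)
            ≡⟨ cong ι (Φ-delete-contract q e A B) ⟨
          ι (Φ (suc q) (e ∷ A) B) ∎
      ; counts̄   = λ q → begin
          evalV (zipWith _+_ (C .p̄) (pad (D .p̄))) (ℕtoℚ (suc q))
            ≡⟨ plus (ℕtoℚ (suc q)) ⟩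
          evalV (C .p̄) (ℕtoℚ (suc q)) + evalV (D .p̄) (ℕtoℚ (suc q))
            ≡⟨ cong₂ _+_ (C .counts̄ q) (D .counts̄ q) ⟩
          ι (Ψ (suc q) A (e ∷ B)) + ι (Ψ (suc q) A B)
            ≡⟨ ι-+ (Ψ (suc q) A (e ∷ B)) (Ψ (suc q) A B) ⟨
          ι (Ψ (suc q) A (e ∷ B) ℤ.+ Ψ (suc q) A B)
            ≡⟨ cong ι (Ψ-delete-contract q e A B nb) ⟨
          ι (Ψ (suc q) (e ∷ A) B) ∎
      -- The deletion has corank one less and hence the opposite sign, which turns the difference
      -- for the open count into the sum for the closed one.
      ; reflects = λ t → begin
          evalV (zipWith _-_ (C .p) (pad (D .p))) (- t)
            ≡⟨ minus (- t) ⟩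
          evalV (C .p) (- t) - evalV (D .p) (- t)
            ≡⟨ cong₂ _-_ (C .reflects t) (D .reflects t) ⟩
          - signPow r * evalV (C .p̄) t - signPow r * evalV (D .p̄) t
            ≡⟨ lemma (signPow r) (evalV (C .p̄) t) (evalV (D .p̄) t) ⟩
          - signPow r * (evalV (C .p̄) t + evalV (D .p̄) t)
            ≡⟨ cong (- signPow r *_) (plus t) ⟨
          - signPow r * evalV (zipWith _+_ (C .p̄) (pad (D .p̄))) t ∎
      ; monic    = λ (_ , nbs) → begin
          lookup (zipWith _-_ (C .p) (pad (D .p))) (fromℕ (suc r))
            ≡⟨ lookup-zipWith _-_ (fromℕ (suc r)) (C .p) (pad (D .p)) ⟩
          lookup (C .p) (fromℕ (suc r)) - lookup (pad (D .p)) (fromℕ (suc r))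
            ≡⟨ cong₂ _-_ (C .monic nbs) (lookup-pad (D .p)) ⟩
          1ℚ ∎
      }
      where
      open ≡-Reasoning
      minus : ∀ t → evalV (zipWith _-_ (C .p) (pad (D .p))) t ≡ evalV (C .p) t - evalV (D .p) t
      minus t = trans (evalV-zipWith-minus (C .p) (pad (D .p)) t) (cong (λ z → evalV (C .p) t - z) (evalV-pad (D .p) t))
      plus : ∀ t → evalV (zipWith _+_ (C .p̄) (pad (D .p̄))) t ≡ evalV (C .p̄) t + evalV (D .p̄) t
      plus t = trans (evalV-zipWith-+ (C .p̄) (pad (D .p̄)) t) (cong (_+_ (evalV (C .p̄) t)) (evalV-pad (D .p̄) t))
      lemma : ∀ s x y → - s * x - s * y ≡ - s * (x + y)
      lemma s x y = trans (cong (_+_ (- s * x)) (neg-distribˡ-* s y)) (sym (*-distribˡ-+ (- s) x y))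

    bridge-or-not : (e : Edge ν) (A : Vec (Edge ν) n) (B : Vec (Edge ν) m) → Bridge e A B ⊎ NonBridge e A B
    bridge-or-not e A B with anySubset? (λ S → inv? A S ×-dec inv? B S ×-dec ¬? (uncut? e S))
    ... | yes br  = inj₁ br
    ... | no none = inj₂ λ S invA invB → decidable-stable (uncut? e S) λ cut → none (S , invA , invB , cut)

    edgeless : (B : Vec (Edge ν) m) → ∀ {r} → Corank [] B r → Reciprocal [] B r
    edgeless B {r} cor = record
      { p        = monomial r
      ; p̄        = monomial r
      ; counts   = λ q → trans (evalV-monomial r (+ suc q)) (cong ι (sym (cor q)))
      ; counts̄   = λ q → trans (evalV-monomial r (+ suc q)) (cong ι (sym (trans (Ψ-edgeless (suc q) B) (cor q))))
      ; reflects = evalV-monomial-neg r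
      ; monic    = λ _ → lookup-monomial r
      }

    -- Both counts vanish; the zero polynomial is written with r + 1 coefficients to fit the
    -- recursion.
    bridged : ∀ (e : Edge ν) (A : Vec (Edge ν) n) (B : Vec (Edge ν) m) r → Bridge e A B → Reciprocal (e ∷ A) B r
    bridged e A B r br@(S , invA , invB , cut) = record
      { p        = replicate (suc r) 0ℚ
      ; p̄        = replicate (suc r) 0ℚ
      ; counts   = λ q → trans (evalV-zero (suc r) (ℕtoℚ (suc q))) (cong ι (sym (Φ-bridge q e A B br)))
      ; counts̄   = λ q → trans (evalV-zero (suc r) (ℕtoℚ (suc q))) (cong ι (sym (Ψ-bridge q e A B br)))
      ; reflects = λ t → trans (evalV-zero (suc r) (- t))
          (sym (trans (cong (signPow r *_) (evalV-zero (suc r) t)) (*-zeroʳ (signPow r))))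
      ; monic    = λ (nb , _) → contradiction (nb S invA invB) cut
      }

  reciprocal : (A : Vec (Edge ν) n) (B : Vec (Edge ν) m) → ∀ {r} → Corank A B r → Reciprocal A B r
  reciprocal []      B {r} cor = edgeless B {r} cor
  reciprocal (e ∷ A) B {r} cor = [ bridged e A B r , unbridged ]′ (bridge-or-not e A B)
    where
    contracted : Reciprocal A (e ∷ B) r
    contracted = reciprocal A (e ∷ B) λ q → trans (sym (Fl-move (suc q) e A B)) (cor q)
    deleted : Reciprocal A B (proj₁ (corank-exists A B))
    deleted = reciprocal A B (proj₂ (corank-exists A B))
    unbridged : NonBridge e A B → Reciprocal (e ∷ A) B r
    unbridged nb = subst (Reciprocal (e ∷ A) B) (sym eq) (combine e A B nb (subst (Reciprocal A (e ∷ B)) eq contracted) deleted)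
      where
      eq : r ≡ suc (proj₁ (corank-exists A B))
      eq = corank-nonbridge e A B nb cor (proj₂ (corank-exists A B))

-- Lengths of filtered lists as sums over boxes

module Counting where
  open BoxSums
  open ClosedSets using (reversal; closed-box)
  open FreeFlows using (free)
  open DeletionContraction using (nz)
  open import Defs using (vecsOver)
  open import Data.Nat using (ℕ; zero; suc)
  open import Data.Nat.ListAction using (sum)
  open import Data.Integer using (ℤ; +_; 0ℤ; 1ℤ; _+_; _-_; -_)
  open import Data.Integer.Properties
  open import Data.Bool using (Bool; true; false)
  open import Data.Fin as Fin using (Fin; toℕ)
  open import Data.List as List using (List; []; _∷_; _++_; filter; length; concatMap; allFin)
  open import Data.List.Relation.Unary.All as All using (All; []; _∷_)
  open import Data.List.Relation.Unary.Any using (Any; here; there)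
  open import Data.List.Relation.Unary.AllPairs using (AllPairs; []; _∷_)
  open import Data.Product using (_,_)
  open import Data.Vec as Vec using (Vec; []; _∷_; map; zipWith)
  open import Data.Vec.Relation.Unary.All as AllV using ([]; _∷_)
  open import Function using (_∘_)
  open import Relation.Nullary using (¬_; Dec; yes; no)
  open import Relation.Binary.PropositionalEquality using (_≡_; _≢_; refl; sym; trans; cong; cong₂)

  private variable
    n : ℕ
    X Y : Set

  ΣL : List X → (X → ℤ) → ℤ
  ΣL []       w = 0ℤ
  ΣL (x ∷ xs) w = w x + ΣL xs w

  ΣL-cong : (xs : List X) {v w : X → ℤ} → (∀ x → v x ≡ w x) → ΣL xs v ≡ ΣL xs w
  ΣL-cong []       eq = refl
  ΣL-cong (x ∷ xs) eq = cong₂ _+_ (eq x) (ΣL-cong xs eq)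

  ΣL-++ : (xs ys : List X) (w : X → ℤ) → ΣL (xs ++ ys) w ≡ ΣL xs w + ΣL ys w
  ΣL-++ []       ys w = sym (+-identityˡ _)
  ΣL-++ (x ∷ xs) ys w = trans (cong (_+_ (w x)) (ΣL-++ xs ys w)) (sym (+-assoc (w x) _ _))

  ΣL-map : (f : X → Y) (xs : List X) (w : Y → ℤ) → ΣL (List.map f xs) w ≡ ΣL xs (w ∘ f)
  ΣL-map f []       w = refl
  ΣL-map f (x ∷ xs) w = cong (_+_ (w (f x))) (ΣL-map f xs w)

  ΣL-concatMap : (f : X → List Y) (xs : List X) (w : Y → ℤ) → ΣL (concatMap f xs) w ≡ ΣL xs (λ x → ΣL (f x) w)
  ΣL-concatMap f []       w = refl
  ΣL-concatMap f (x ∷ xs) w = trans (ΣL-++ (f x) (concatMap f xs) w) (cong (_+_ (ΣL (f x) w)) (ΣL-concatMap f xs w))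

  ΣL-vecsOver : (xs : List X) → ∀ n (w : Vec X (suc n) → ℤ) →
    ΣL (vecsOver xs (suc n)) w ≡ ΣL xs (λ x → ΣL (vecsOver xs n) λ v → w (x ∷ v))
  ΣL-vecsOver xs n w = trans (ΣL-concatMap (λ x → List.map (x ∷_) (vecsOver xs n)) xs w)
    (ΣL-cong xs λ x → ΣL-map (x ∷_) (vecsOver xs n) w)

  length-filter : {P : X → Set} (P? : ∀ x → Dec (P x)) (xs : List X) → + length (filter P? xs) ≡ ΣL xs (𝟙 ∘ P?)
  length-filter P? []       = refl
  length-filter P? (x ∷ xs) with P? x
  ... | yes _ = cong (_+_ 1ℤ) (length-filter P? xs)
  ... | no _  = trans (length-filter P? xs) (sym (+-identityˡ _))

  ΣL-tabulate : ∀ k l (f : Fin k → X) {v : X → ℤ} {w : ℤ → ℤ} → (∀ i → v (f i) ≡ w (l + + toℕ i)) →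
    ΣL (List.tabulate f) v ≡ Σr l k w
  ΣL-tabulate zero    l f eq = refl
  ΣL-tabulate (suc k) l f {w = w} eq = cong₂ _+_ (trans (eq Fin.zero) (cong w (+-identityʳ l)))
    (ΣL-tabulate k (l + 1ℤ) (f ∘ Fin.suc) λ i → trans (eq (Fin.suc i)) (cong w (sym (+-assoc l 1ℤ (+ toℕ i)))))

  values : ∀ {q} → Vec (Fin q) n → Vec ℤ n
  values = map (λ i → + toℕ i)

  ΣL-vecsOver-allFin : ∀ q n (v : Vec (Fin q) n → ℤ) (w : Vec ℤ n → ℤ) → (∀ f → v f ≡ w (values f)) →
    ΣL (vecsOver (allFin q) n) v ≡ ΣB (free q n) w
  ΣL-vecsOver-allFin q zero    v w eq = trans (+-identityʳ (v [])) (eq [])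
  ΣL-vecsOver-allFin q (suc n) v w eq = trans (ΣL-vecsOver (allFin q) n v)
    (ΣL-tabulate q 0ℤ (λ i → i) λ i → ΣL-vecsOver-allFin q n _ _ λ f → eq (i ∷ f))

  count-boxes : ∀ q n {P : Vec (Fin q) n → Set} (P? : ∀ f → Dec (P f)) (w : Vec ℤ n → ℤ) →
    (∀ f → 𝟙 (P? f) ≡ w (values f)) → + length (filter P? (vecsOver (allFin q) n)) ≡ ΣB (free q n) w
  count-boxes q n P? w eq = trans (length-filter P? (vecsOver (allFin q) n)) (ΣL-vecsOver-allFin q n _ w eq)

  count-orientations : ∀ n {P : Vec Bool n → Set} (P? : ∀ o → Dec (P o)) (w : Vec ℤ n → ℤ) →
    (∀ o → 𝟙 (P? o) ≡ w (map reversal o)) →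
    + length (filter P? (vecsOver (true ∷ false ∷ []) n)) ≡ ΣB (closed-box 1 n) w
  count-orientations n P? w eq = trans (length-filter P? (vecsOver (true ∷ false ∷ []) n)) (go n _ w eq)
    where
    go : ∀ n (v : Vec Bool n → ℤ) (w : Vec ℤ n → ℤ) → (∀ o → v o ≡ w (map reversal o)) →
      ΣL (vecsOver (true ∷ false ∷ []) n) v ≡ ΣB (closed-box 1 n) w
    go zero    v w eq = trans (+-identityʳ (v [])) (eq [])
    go (suc n) v w eq = trans (ΣL-vecsOver (true ∷ false ∷ []) n v)
      (cong₂ _+_ (go n _ _ λ o → eq (true ∷ o)) (cong (λ z → z + 0ℤ) (go n _ _ λ o → eq (false ∷ o))))

  ΣB-nowhere-zero : ∀ p n (w : Vec ℤ n → ℤ) → (∀ h → ¬ AllV.All (_≢ 0ℤ) h → w h ≡ 0ℤ) →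
    ΣB (free (suc p) n) w ≡ ΣB (nz (suc p) n) w
  ΣB-nowhere-zero p zero    w zeros = refl
  ΣB-nowhere-zero p (suc n) w zeros = trans (cong₂ _+_
    (trans (ΣB-cong (free (suc p) n) λ h → zeros (0ℤ ∷ h) λ { (0≢0 ∷ _) → 0≢0 refl }) (ΣB-0 (free (suc p) n)))
    (Σr-cong 1ℤ p λ a → ΣB-nowhere-zero p n (λ h → w (a ∷ h)) λ h ¬all → zeros (a ∷ h) λ { (_ ∷ all) → ¬all all }))
    (+-identityˡ _)

  reflect : ℕ → Bool → ℤ → ℤ
  reflect q true  x = x
  reflect q false x = + q - x

  reflectV : ℕ → Vec Bool n → Vec ℤ n → Vec ℤ n
  reflectV q = zipWith (reflect q)

  -- The equation makes the interval symmetric under a ↦ q - a. It holds for 0, ..., q, where l = 0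
  -- and k = q + 1, and for 1, ..., q - 1, where l = 1 and k = q - 1.
  ΣB-reflect : ∀ q l k → + q ≡ l + l + + k - 1ℤ → (o : Vec Bool n) (w : Vec ℤ n → ℤ) →
    ΣB (Vec.replicate n (l , k)) (λ h → w (reflectV q o h)) ≡ ΣB (Vec.replicate n (l , k)) w
  ΣB-reflect q l k eq []          w = refl
  ΣB-reflect q l k eq (true ∷ o)  w = Σr-cong l k λ a → ΣB-reflect q l k eq o (λ h → w (a ∷ h))
  ΣB-reflect {suc n} q l k eq (false ∷ o) w = trans
    (Σr-cong l k λ a → ΣB-reflect q l k eq o (λ h → w ((+ q - a) ∷ h)))
    (Σr-reflect l k (+ q) (λ a → ΣB (Vec.replicate n (l , k)) λ h → w (a ∷ h)) eq)

  ΣL-ΣB-swap : (xs : List X) (D : Box n) (w : X → Vec ℤ n → ℤ) →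
    ΣL xs (λ x → ΣB D (w x)) ≡ ΣB D (λ h → ΣL xs λ x → w x h)
  ΣL-ΣB-swap []       D w = sym (ΣB-0 D)
  ΣL-ΣB-swap (x ∷ xs) D w = trans (cong (_+_ (ΣB D (w x))) (ΣL-ΣB-swap xs D w)) (sym (ΣB-+ D _ _))

  ΣL-sum : (f : X → ℕ) (xs : List X) → + sum (List.map f xs) ≡ ΣL xs (λ x → + f x)
  ΣL-sum f []       = refl
  ΣL-sum f (x ∷ xs) = cong (_+_ (+ f x)) (ΣL-sum f xs)

  module _ {P : X → Set} (P? : ∀ x → Dec (P x)) where

    ΣL-none : (xs : List X) → All (¬_ ∘ P) xs → ΣL xs (𝟙 ∘ P?) ≡ 0ℤ
    ΣL-none []       []        = refl
    ΣL-none (x ∷ xs) (¬p ∷ ¬ps) = cong₂ _+_ (𝟙-no (P? x) ¬p) (ΣL-none xs ¬ps)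

    ΣL-unique : {_~_ : X → X → Set} → (∀ {x y} → P x → P y → x ~ y) →
      (xs : List X) → AllPairs (λ x y → ¬ (x ~ y)) xs → Any P xs → ΣL xs (𝟙 ∘ P?) ≡ 1ℤ
    ΣL-unique related (x ∷ xs) (x≁ ∷ _) (here p) =
      cong₂ _+_ (𝟙-yes (P? x) p) (ΣL-none xs (All.map (λ x≁y py → x≁y (related p py)) x≁))
    ΣL-unique related (x ∷ xs) (x≁ ∷ ≁s) (there any) = cong₂ _+_
      (𝟙-no (P? x) λ p → All.lookupWith (λ x≁y py → x≁y (related p py)) x≁ any)
      (ΣL-unique related xs ≁s any)

-- Flows and total cyclicity of a graph in terms of cuts

module GraphFlows where
  open BoxSums
  open CutPairing
  open ClosedSets
  open FreeFlows
  open Counting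
  open import Defs
  open import Data.Nat using (ℕ; zero; suc)
  open import Data.Integer using (ℤ; +_; 0ℤ; 1ℤ; _+_; _-_; _*_; -_)
  open import Data.Integer.Properties
  open import Data.Integer.Divisibility.Signed
  open import Data.Integer.Tactic.RingSolver using (solve-∀)
  open import Data.Bool using (Bool; true; false; not)
  open import Data.Bool.Properties using (not-injective; ¬-not)
  open import Data.Fin as F using (Fin)
  import Data.Fin.Properties as F
  open import Data.Fin.Subset using (Subset; ∁)
  open import Data.List as List using (List; []; _∷_)
  open import Data.Product using (∃; _,_)
  open import Data.Sum using (inj₁; inj₂)
  open import Data.Vec as Vec using (Vec; []; _∷_; lookup; map; tabulate; zipWith)
  open import Data.Vec.Properties using (lookup∘tabulate; lookup-map; lookup-zipWith)
  open import Data.Vec.Relation.Unary.All as All using (All; []; _∷_)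
  import Data.Vec.Relation.Unary.All.Properties as All
  open import Data.Vec.Relation.Binary.Pointwise.Inductive using (Pointwise; []; _∷_)
  open import Function using (_∘_)
  open import Relation.Nullary using (yes; no; does; contradiction)
  open import Relation.Nullary.Decidable using (decidable-stable)
  open import Relation.Binary.PropositionalEquality using (_≡_; _≢_; refl; sym; trans; cong; cong₂; subst; module ≡-Reasoning)

  private variable
    ν n m : ℕ

  sumℤ-cong : {x y : Fin n → ℤ} → (∀ i → x i ≡ y i) → sumℤ x ≡ sumℤ y
  sumℤ-cong {zero}  eq = refl
  sumℤ-cong {suc n} eq = cong₂ _+_ (eq F.zero) (sumℤ-cong (eq ∘ F.suc))

  sumℤ-0 : ∀ n → sumℤ {n} (λ _ → 0ℤ) ≡ 0ℤ
  sumℤ-0 zero    = refl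
  sumℤ-0 (suc n) = trans (+-identityˡ _) (sumℤ-0 n)

  sumℤ-+ : (x y : Fin n → ℤ) → sumℤ (λ i → x i + y i) ≡ sumℤ x + sumℤ y
  sumℤ-+ {zero}  x y = refl
  sumℤ-+ {suc n} x y = trans (cong (_+_ (x F.zero + y F.zero)) (sumℤ-+ (x ∘ F.suc) (y ∘ F.suc)))
    (lemma (x F.zero) (y F.zero) (sumℤ (x ∘ F.suc)) (sumℤ (y ∘ F.suc)))
    where
    lemma : ∀ a b c d → a + b + (c + d) ≡ (a + c) + (b + d)
    lemma = solve-∀

  sumℤ-*ʳ : (x : Fin n → ℤ) (k : ℤ) → sumℤ (λ i → x i * k) ≡ sumℤ x * k
  sumℤ-*ʳ {zero}  x k = sym (*-zeroˡ k)
  sumℤ-*ʳ {suc n} x k = trans (cong (_+_ (x F.zero * k)) (sumℤ-*ʳ (x ∘ F.suc) k)) (sym (*-distribʳ-+ k (x F.zero) _))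

  sumℤ-neg : (x : Fin n → ℤ) → sumℤ (λ i → - x i) ≡ - sumℤ x
  sumℤ-neg {zero}  x = refl
  sumℤ-neg {suc n} x = trans (cong (_+_ (- x F.zero)) (sumℤ-neg (x ∘ F.suc))) (sym (neg-distrib-+ (x F.zero) _))

  sumℤ-select : (x : Fin n → ℤ) (a : Fin n) → sumℤ (λ v → x v * bit (does (a F.≟ v))) ≡ x a
  sumℤ-select {suc n} x F.zero = trans (cong₂ _+_ (*-identityʳ (x F.zero))
    (trans (sumℤ-cong λ v → *-zeroʳ (x (F.suc v))) (sumℤ-0 n))) (+-identityʳ (x F.zero))
  sumℤ-select {suc n} x (F.suc a) = trans (cong₂ _+_ (*-zeroʳ (x F.zero)) (sumℤ-select (x ∘ F.suc) a)) (+-identityˡ _)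

  sumℤ-divisible : ∀ {k} (x : Fin n → ℤ) → (∀ i → k ∣ x i) → k ∣ sumℤ x
  sumℤ-divisible {zero}  x k∣ = divides 0ℤ refl
  sumℤ-divisible {suc n} x k∣ = ∣m∣n⇒∣m+n (k∣ F.zero) (sumℤ-divisible (x ∘ F.suc) (k∣ ∘ F.suc))

  ΣL-allFin : (w : Fin n → ℤ) → ΣL (List.allFin n) w ≡ sumℤ w
  ΣL-allFin {n} w = go n (λ i → i)
    where
    go : ∀ k (f : Fin k → Fin n) → ΣL (List.tabulate f) w ≡ sumℤ (w ∘ f)
    go zero    f = refl
    go (suc k) f = cong (_+_ (w (f F.zero))) (go k (f ∘ F.suc))

  point : Fin ν → Subset ν
  point = class λ v → v

  lookup-point : ∀ (v w : Fin ν) → lookup (point v) w ≡ does (w F.≟ v)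
  lookup-point v w = lookup∘tabulate _ w

  private
    c-point : ∀ (a b v : Fin ν) → c (a , b) (point v) ≡ bit (does (a F.≟ v)) - bit (does (b F.≟ v))
    c-point a b v = cong₂ (λ s t → bit s - bit t) (lookup-point v a) (lookup-point v b)

  c-expand : (e : Edge ν) → ∀ S → c e S ≡ sumℤ (λ v → bit (lookup S v) * c e (point v))
  c-expand (a , b) S = sym (begin
    sumℤ (λ v → bit (lookup S v) * c (a , b) (point v))
      ≡⟨ sumℤ-cong (λ v → trans (cong (bit (lookup S v) *_) (c-point a b v))
           (lemma (bit (lookup S v)) (bit (does (a F.≟ v))) (bit (does (b F.≟ v))))) ⟩
    sumℤ (λ v → bit (lookup S v) * bit (does (a F.≟ v)) + - (bit (lookup S v) * bit (does (b F.≟ v))))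
      ≡⟨ sumℤ-+ (λ v → bit (lookup S v) * bit (does (a F.≟ v))) _ ⟩
    sumℤ (λ v → bit (lookup S v) * bit (does (a F.≟ v))) + sumℤ (λ v → - (bit (lookup S v) * bit (does (b F.≟ v))))
      ≡⟨ cong₂ _+_ (sumℤ-select (bit ∘ lookup S) a)
           (trans (sumℤ-neg (λ v → bit (lookup S v) * bit (does (b F.≟ v)))) (cong -_ (sumℤ-select (bit ∘ lookup S) b))) ⟩
    c (a , b) S ∎)
    where
    open ≡-Reasoning
    lemma : ∀ s x y → s * (x - y) ≡ s * x + - (s * y)
    lemma = solve-∀

  -- The bridge between conservation at vertices and conservation on sets: arcs inside S cancel, so
  -- what leaves S is the sum of what leaves its points.
  ∂-expand : (es : Vec (Edge ν) n) (h : Vec ℤ n) → ∀ S → ∂ es h S ≡ sumℤ (λ v → bit (lookup S v) * ∂ es h (point v))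
  ∂-expand {ν} []       []      S = sym (trans (sumℤ-cong λ v → *-zeroʳ (bit (lookup S v))) (sumℤ-0 ν))
  ∂-expand (e ∷ es) (x ∷ h) S = sym (begin
    sumℤ (λ v → bit (lookup S v) * (c e (point v) * x + ∂ es h (point v)))
      ≡⟨ sumℤ-cong (λ v → lemma (bit (lookup S v)) (c e (point v)) x (∂ es h (point v))) ⟩
    sumℤ (λ v → bit (lookup S v) * c e (point v) * x + bit (lookup S v) * ∂ es h (point v))
      ≡⟨ sumℤ-+ (λ v → bit (lookup S v) * c e (point v) * x) _ ⟩
    sumℤ (λ v → bit (lookup S v) * c e (point v) * x) + sumℤ (λ v → bit (lookup S v) * ∂ es h (point v))
      ≡⟨ cong₂ _+_ (trans (sumℤ-*ʳ (λ v → bit (lookup S v) * c e (point v)) x) (cong (_* x) (sym (c-expand e S))))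
                   (sym (∂-expand es h S)) ⟩
    c e S * x + ∂ es h S ∎)
    where
    open ≡-Reasoning
    lemma : ∀ s c x t → s * (c * x + t) ≡ s * c * x + s * t
    lemma = solve-∀

  ∂-divisible : ∀ {k} (es : Vec (Edge ν) n) h → (∀ v → k ∣ ∂ es h (point v)) → ∀ S → k ∣ ∂ es h S
  ∂-divisible {k = k} es h k∣ S = subst (k ∣_) (sym (∂-expand es h S))
    (sumℤ-divisible (λ v → bit (lookup S v) * ∂ es h (point v)) λ v → ∣n⇒∣m*n (bit (lookup S v)) (k∣ v))

  ∂-vanishes : (es : Vec (Edge ν) n) → ∀ h → (∀ v → ∂ es h (point v) ≡ 0ℤ) → ∀ S → ∂ es h S ≡ 0ℤ
  -- To vanish is to be divisible by 0, so the divisibility statement applies.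
  ∂-vanishes es h eq S = 0∣⇒≡0 (∂-divisible es h (λ v → divides 0ℤ (eq v)) S)

  ∂-agrees : (es : Vec (Edge ν) n) → ∀ g h → (∀ v → ∂ es g (point v) ≡ ∂ es h (point v)) → ∀ S → ∂ es g S ≡ ∂ es h S
  ∂-agrees es g h eq S = trans (∂-expand es g S)
    (trans (sumℤ-cong λ v → cong (bit (lookup S v) *_) (eq v)) (sym (∂-expand es h S)))

  sumℤ-∂ : (E : Fin n → Edge ν) (h : Vec ℤ n) → ∀ S → sumℤ (λ i → c (E i) S * lookup h i) ≡ ∂ (tabulate E) h S
  sumℤ-∂ E []      S = refl
  sumℤ-∂ E (x ∷ h) S = cong (_+_ (c (E F.zero) S * x)) (sumℤ-∂ (E ∘ F.suc) h S)

  σ : Bool → ℤ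
  σ true  = 1ℤ
  σ false = - 1ℤ

  signed : Vec Bool n → Vec ℤ n → Vec ℤ n
  signed = zipWith λ o x → σ o * x

  -- On a reversed edge q - x splits into the signed flow value -x and a full amount q. The former
  -- make up the net flow under o, the latter q times the boundary of the reversed edges.
  ∂-reflectV : ∀ q (es : Vec (Edge ν) n) o h → ∀ S →
    ∂ es (reflectV q o h) S ≡ ∂ es (signed o h) S + ∂ es (map reversal o) S * + q
  ∂-reflectV q []       []          []      S = refl
  ∂-reflectV q (e ∷ es) (true ∷ o)  (x ∷ h) S = trans (cong (_+_ (c e S * x)) (∂-reflectV q es o h S))
    (lemma (c e S) x (∂ es (signed o h) S) (∂ es (map reversal o) S) (+ q))
    where
    lemma : ∀ c x s r q → c * x + (s + r * q) ≡ c * (1ℤ * x) + s + (c * 0ℤ + r) * q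
    lemma = solve-∀
  ∂-reflectV q (e ∷ es) (false ∷ o) (x ∷ h) S = trans (cong (_+_ (c e S * (+ q - x))) (∂-reflectV q es o h S))
    (lemma (c e S) x (∂ es (signed o h) S) (∂ es (map reversal o) S) (+ q))
    where
    lemma : ∀ c x s r q → c * (q - x) + (s + r * q) ≡ c * (- 1ℤ * x) + s + (c * 1ℤ + r) * q
    lemma = solve-∀

  signed-true : (h : Vec ℤ n) → signed (Vec.replicate n true) h ≡ h
  signed-true []      = refl
  signed-true (x ∷ h) = cong₂ _∷_ (*-identityˡ x) (signed-true h)

  module _ (G : Graph) where

    endpoints : Fin (ne G) → Edge (nv G)
    endpoints e = tl G e , hd G e

    edges : Vec (Edge (nv G)) (ne G)
    edges = tabulate endpoints

    private
      δ-yes : ∀ {a v : Fin (nv G)} → a ≡ v → bit (does (a F.≟ v)) ≡ 1ℤ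
      δ-yes {a} {v} eq with a F.≟ v
      ... | yes _  = refl
      ... | no a≢v = contradiction eq a≢v
      δ-no : ∀ {a v : Fin (nv G)} → a ≢ v → bit (does (a F.≟ v)) ≡ 0ℤ
      δ-no {a} {v} a≢v with a F.≟ v
      ... | yes eq = contradiction eq a≢v
      ... | no _   = refl

    inc-c : ∀ o v e → inc G o v e ≡ σ (lookup o e) * c (endpoints e) (point v)
    inc-c o v e = trans core (cong (σ (lookup o e) *_) (sym (c-point (tl G e) (hd G e) v)))
      where
      D : ℤ
      D = bit (does (tl G e F.≟ v)) - bit (does (hd G e F.≟ v))
      at-tail : tl G e ≢ hd G e → v ≡ tailO G o e → 1ℤ ≡ σ (lookup o e) * D
      at-tail t≢h with lookup o e
      ... | true  = λ v≡t → sym (cong₂ (λ x y → 1ℤ * (x - y)) (δ-yes (sym v≡t)) (δ-no λ h≡v → t≢h (sym (trans h≡v v≡t))))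
      ... | false = λ v≡h → sym (cong₂ (λ x y → - 1ℤ * (x - y)) (δ-no λ t≡v → t≢h (trans t≡v v≡h)) (δ-yes (sym v≡h)))
      at-head : v ≢ tailO G o e → v ≡ headO G o e → - 1ℤ ≡ σ (lookup o e) * D
      at-head with lookup o e
      ... | true  = λ v≢t v≡h → sym (cong₂ (λ x y → 1ℤ * (x - y)) (δ-no (v≢t ∘ sym)) (δ-yes (sym v≡h)))
      ... | false = λ v≢h v≡t → sym (cong₂ (λ x y → - 1ℤ * (x - y)) (δ-yes (sym v≡t)) (δ-no (v≢h ∘ sym)))
      elsewhere : v ≢ tailO G o e → v ≢ headO G o e → 0ℤ ≡ σ (lookup o e) * D
      elsewhere with lookup o e
      ... | true  = λ v≢t v≢h → sym (cong₂ (λ x y → 1ℤ * (x - y)) (δ-no (v≢t ∘ sym)) (δ-no (v≢h ∘ sym)))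
      ... | false = λ v≢h v≢t → sym (cong₂ (λ x y → - 1ℤ * (x - y)) (δ-no (v≢t ∘ sym)) (δ-no (v≢h ∘ sym)))
      core : inc G o v e ≡ σ (lookup o e) * D
      core with tl G e F.≟ hd G e
      ... | yes eq = sym (trans (cong (λ u → σ (lookup o e) * (bit (does (u F.≟ v)) - bit (does (hd G e F.≟ v)))) eq)
        (trans (cong (σ (lookup o e) *_) (+-inverseʳ (bit (does (hd G e F.≟ v))))) (*-zeroʳ (σ (lookup o e)))))
      ... | no t≢h with v F.≟ tailO G o e
      ...   | yes v≡t = at-tail t≢h v≡t
      ...   | no v≢t with v F.≟ headO G o e
      ...     | yes v≡h = at-head v≢t v≡h
      ...     | no v≢h  = elsewhere v≢t v≢h

    netFlow-∂ : ∀ o (h : Vec ℤ (ne G)) {x : Fin (ne G) → ℤ} → (∀ e → lookup h e ≡ x e) → ∀ v →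
      netFlow G o x v ≡ ∂ edges (signed o h) (point v)
    netFlow-∂ o h {x} eq v = trans (sumℤ-cong pointwise) (sumℤ-∂ endpoints (signed o h) (point v))
      where
      lemma : ∀ s c x → s * c * x ≡ c * (s * x)
      lemma = solve-∀
      pointwise : ∀ e → inc G o v e * x e ≡ c (endpoints e) (point v) * lookup (signed o h) e
      pointwise e = begin
        inc G o v e * x e
          ≡⟨ cong₂ _*_ (inc-c o v e) (sym (eq e)) ⟩
        σ (lookup o e) * c (endpoints e) (point v) * lookup h e
          ≡⟨ lemma (σ (lookup o e)) (c (endpoints e) (point v)) (lookup h e) ⟩
        c (endpoints e) (point v) * (σ (lookup o e) * lookup h e)
          ≡⟨ cong (c (endpoints e) (point v) *_) (lookup-zipWith (λ o x → σ o * x) e o h) ⟨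
        c (endpoints e) (point v) * lookup (signed o h) e ∎
        where open ≡-Reasoning

    private
      pointwise-edges : ∀ {R : Edge (nv G) → ℤ → Set} o →
        (∀ e → R (endpoints e) (reversal (lookup o e))) → Pointwise R edges (map reversal o)
      pointwise-edges o = go endpoints o
        where
        go : ∀ {k} {R : Edge (nv G) → ℤ → Set} (E : Fin k → Edge (nv G)) (o : Vec Bool k) →
          (∀ e → R (E e) (reversal (lookup o e))) → Pointwise R (tabulate E) (map reversal o)
        go E []      r = []
        go E (x ∷ o) r = r F.zero ∷ go (E ∘ F.suc) o (r ∘ F.suc)

      pointwise-edges⁻ : ∀ {R : Edge (nv G) → ℤ → Set} o →
        Pointwise R edges (map reversal o) → ∀ e → R (endpoints e) (reversal (lookup o e))
      pointwise-edges⁻ o = go endpoints o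
        where
        go : ∀ {k} {R : Edge (nv G) → ℤ → Set} (E : Fin k → Edge (nv G)) (o : Vec Bool k) →
          Pointwise R (tabulate E) (map reversal o) → ∀ e → R (E e) (reversal (lookup o e))
        go E (x ∷ o) (r ∷ rs) F.zero    = r
        go E (x ∷ o) (r ∷ rs) (F.suc e) = go (E ∘ F.suc) o rs e

    -- If an edge crosses a closed set, all crossing arcs point into the set and form a directed
    -- cut.
    TotallyCyclic⇒TC : ∀ {o} → TotallyCyclic G o → TC 1ℤ edges (map reversal o) ([] {A = Edge (nv G)})
    TotallyCyclic⇒TC {o} tc S _ clo = All.tabulate⁺ λ e → decidable-stable (uncut? (endpoints e) S) λ crosses →
      tc (S , inside e crosses , outside e crosses , (e , crosses) , inj₂ tails)
      where
      inside : ∀ e → Crosses G S e → ∃ λ v → lookup S v ≡ true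
      inside e crosses with lookup S (tl G e) in St | lookup S (hd G e) in Sh
      ... | true  | _     = tl G e , St
      ... | false | true  = hd G e , Sh
      ... | false | false = contradiction refl crosses
      outside : ∀ e → Crosses G S e → ∃ λ v → lookup S v ≡ false
      outside e crosses with lookup S (tl G e) in St | lookup S (hd G e) in Sh
      ... | false | _     = tl G e , St
      ... | true  | false = hd G e , Sh
      ... | true  | true  = contradiction refl crosses
      tails : ∀ e → Crosses G S e → lookup S (tailO G o e) ≡ false
      tails e crosses with lookup o e | pointwise-edges⁻ o clo e
      ... | true  | f , _ = ¬-not λ St → contradiction (f St (¬-not λ Sh → crosses (trans St (sym Sh)))) λ ()
      ... | false | _ , f = ¬-not λ Sh → contradiction (f (¬-not λ St → crosses (trans St (sym Sh))) Sh) λ ()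

    -- Closed sets only see cuts directed inwards. A cut directed out of S is read as one directed
    -- into ∁ S.
    TC⇒TotallyCyclic : ∀ {o} → TC 1ℤ edges (map reversal o) ([] {A = Edge (nv G)}) → TotallyCyclic G o
    TC⇒TotallyCyclic {o} tc (S , _ , _ , (e , crosses) , inj₂ tails) =
      contradiction (All.tabulate⁻ (tc S [] (pointwise-edges o closed)) e) crosses
      where
      closed : ∀ e → CloE 1ℤ (endpoints e) (reversal (lookup o e)) S
      closed e with lookup o e | tails e
      ... | true  | tail = (λ St Sh → contradiction (trans (sym St) (tail λ eq → contradiction (trans (sym St) (trans eq Sh)) λ ())) λ ()) , λ _ _ → refl
      ... | false | tail = (λ _ _ → refl) , λ St Sh → contradiction (trans (sym Sh) (tail λ eq → contradiction (trans (sym St) (trans eq Sh)) λ ())) λ ()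
    TC⇒TotallyCyclic {o} tc (S , _ , _ , (e , crosses) , inj₁ tails) =
      contradiction (All.tabulate⁻ (tc (∁ S) [] (pointwise-edges o closed)) e) λ eq → crosses (not-injective
        (trans (sym (lookup-map (tl G e) not S)) (trans eq (lookup-map (hd G e) not S))))
      where
      ∁-true : ∀ {v} → lookup (∁ S) v ≡ true → lookup S v ≡ false
      ∁-true {v} eq = not-injective (trans (sym (lookup-map v not S)) eq)
      ∁-false : ∀ {v} → lookup (∁ S) v ≡ false → lookup S v ≡ true
      ∁-false {v} eq = not-injective (trans (sym (lookup-map v not S)) eq)
      closed : ∀ e → CloE 1ℤ (endpoints e) (reversal (lookup o e)) (∁ S)
      closed e with lookup o e | tails e
      ... | true  | tail = (λ St Sh → contradiction (trans (sym (∁-true St)) (tail λ eq → contradiction (trans (sym (∁-true St)) (trans eq (∁-false Sh))) λ ())) λ ()) , λ _ _ → refl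
      ... | false | tail = (λ _ _ → refl) , λ St Sh → contradiction (trans (sym (∁-true Sh)) (tail λ eq → contradiction (trans (sym (∁-false St)) (trans eq (∁-true Sh))) λ ())) λ ()

-- Eulerian equivalence, bridges and the cyclomatic number

module GraphStructure where
  open BoxSums
  open CutPairing
  open ClosedSets
  open FreeFlows
  open Reciprocity using (NoBridges)
  open Counting
  open GraphFlows
  open import Defs
  open import Data.Nat as ℕ using (ℕ; suc)
  import Data.Nat.Properties as ℕ
  open import Data.Integer using (ℤ; +_; 0ℤ; 1ℤ; _+_; _-_; _*_; -_)
  open import Data.Integer.Properties
  open import Data.Integer.Divisibility.Signed
  open import Data.Integer.Tactic.RingSolver using (solve-∀)
  import Data.Bool as B
  open import Data.Bool using (Bool; true; false)
  open import Data.Fin as F using (Fin)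
  import Data.Fin.Properties as F
  open import Data.List as List using (List; []; _∷_)
  open import Data.Product using (∃; _,_; proj₁; proj₂)
  open import Data.Sum using (_⊎_; inj₁; inj₂)
  open import Data.Unit using (⊤; tt)
  open import Data.Vec as Vec using (Vec; []; _∷_; lookup; map)
  open import Data.Vec.Properties using (lookup-map; tabulate-∘)
  open import Data.Vec.Relation.Unary.All as All using (All; []; _∷_)
  import Data.Vec.Relation.Unary.All.Properties as All
  open import Data.Vec.Relation.Unary.Any using (here; there)
  open import Data.Vec.Membership.Propositional using (_∈_)
  open import Data.Vec.Membership.Propositional.Properties using (∈-allFin⁺)
  open import Data.Vec.Relation.Binary.Pointwise.Inductive using ([]; _∷_)
  open import Function using (Equivalence)
  open import Relation.Nullary using (Dec; yes; no; does; contradiction)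
  open import Relation.Nullary.Decidable using (_×-dec_; ¬?; decidable-stable)
  open import Relation.Binary.PropositionalEquality using (_≡_; _≢_; refl; sym; trans; cong; cong₂; subst; module ≡-Reasoning)

  private variable
    ν n m : ℕ

  module _ (G : Graph) where

    private
      -- Where the orientations agree both sides vanish. Where they differ, passing from o₁ to o₂
      -- changes the reversal indicator by 1 or -1, and this sign says whether the o₁-tail of e is
      -- its reference tail or its reference head.
      degree-term : ∀ o₁ o₂ v e →
        𝟙 (¬? (lookup o₁ e B.≟ lookup o₂ e) ×-dec (tailO G o₁ e F.≟ v)) - 𝟙 (¬? (lookup o₁ e B.≟ lookup o₂ e) ×-dec (headO G o₁ e F.≟ v))
        ≡ c (endpoints G e) (point v) * reversal (lookup o₂ e) - c (endpoints G e) (point v) * reversal (lookup o₁ e)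
      degree-term o₁ o₂ v e = trans core (cong (λ D → D * reversal (lookup o₂ e) - D * reversal (lookup o₁ e))
        (sym (cong₂ (λ s t → bit s - bit t) (lookup-point v (tl G e)) (lookup-point v (hd G e)))))
        where
        𝟙-bit : ∀ {P : Set} (d : Dec P) → 𝟙 d ≡ bit (does d)
        𝟙-bit (yes _) = refl
        𝟙-bit (no _)  = refl
        same : ∀ D r → D * r - D * r ≡ 0ℤ
        same = solve-∀
        forth : ∀ x y → x - y ≡ (x - y) * 1ℤ - (x - y) * 0ℤ
        forth = solve-∀
        back : ∀ x y → y - x ≡ (x - y) * 0ℤ - (x - y) * 1ℤ
        back = solve-∀
        t = bit (does (tl G e F.≟ v))
        h = bit (does (hd G e F.≟ v))
        core : 𝟙 (¬? (lookup o₁ e B.≟ lookup o₂ e) ×-dec (tailO G o₁ e F.≟ v)) - 𝟙 (¬? (lookup o₁ e B.≟ lookup o₂ e) ×-dec (headO G o₁ e F.≟ v))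
          ≡ (t - h) * reversal (lookup o₂ e) - (t - h) * reversal (lookup o₁ e)
        core with lookup o₁ e | lookup o₂ e
        ... | true  | true  = sym (same (t - h) 0ℤ)
        ... | false | false = sym (same (t - h) 1ℤ)
        ... | true  | false = trans (cong₂ _-_ (𝟙-bit (tl G e F.≟ v)) (𝟙-bit (hd G e F.≟ v))) (forth t h)
        ... | false | true  = trans (cong₂ _-_ (𝟙-bit (hd G e F.≟ v)) (𝟙-bit (tl G e F.≟ v))) (back t h)

      degree-difference : ∀ o₁ o₂ v → + outDegD G o₁ o₂ v - + inDegD G o₁ o₂ v ≡
        ∂ (edges G) (map reversal o₂) (point v) - ∂ (edges G) (map reversal o₁) (point v)
      degree-difference o₁ o₂ v = begin
        + outDegD G o₁ o₂ v - + inDegD G o₁ o₂ v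
          ≡⟨ cong₂ _-_ (trans (length-filter _ (List.allFin (ne G))) (ΣL-allFin outs))
                       (trans (length-filter _ (List.allFin (ne G))) (ΣL-allFin ins)) ⟩
        sumℤ outs - sumℤ ins
          ≡⟨ difference outs ins ⟩
        sumℤ (λ e → outs e - ins e)
          ≡⟨ sumℤ-cong (λ e → trans (degree-term o₁ o₂ v e)
               (cong₂ (λ x y → c (endpoints G e) (point v) * x - c (endpoints G e) (point v) * y)
                 (sym (lookup-map e reversal o₂)) (sym (lookup-map e reversal o₁)))) ⟩
        sumℤ (λ e → term o₂ e - term o₁ e)
          ≡⟨ difference (term o₂) (term o₁) ⟨
        sumℤ (term o₂) - sumℤ (term o₁)
          ≡⟨ cong₂ _-_ (sumℤ-∂ (endpoints G) (map reversal o₂) (point v)) (sumℤ-∂ (endpoints G) (map reversal o₁) (point v)) ⟩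
        ∂ (edges G) (map reversal o₂) (point v) - ∂ (edges G) (map reversal o₁) (point v) ∎
        where
        open ≡-Reasoning
        outs ins : Fin (ne G) → ℤ
        outs e = 𝟙 (¬? (lookup o₁ e B.≟ lookup o₂ e) ×-dec (tailO G o₁ e F.≟ v))
        ins  e = 𝟙 (¬? (lookup o₁ e B.≟ lookup o₂ e) ×-dec (headO G o₁ e F.≟ v))
        term : Vec Bool (ne G) → Fin (ne G) → ℤ
        term o e = c (endpoints G e) (point v) * lookup (map reversal o) e
        difference : ∀ (x y : Fin (ne G) → ℤ) → sumℤ x - sumℤ y ≡ sumℤ (λ e → x e - y e)
        difference x y = trans (cong (_+_ (sumℤ x)) (sym (sumℤ-neg y))) (sym (sumℤ-+ x (λ e → - y e)))

    Eulerian⇒∂ : ∀ {o₁ o₂} → EulerianEquiv G o₁ o₂ → ∀ S → ∂ (edges G) (map reversal o₁) S ≡ ∂ (edges G) (map reversal o₂) S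
    Eulerian⇒∂ {o₁} {o₂} eul = ∂-agrees (edges G) (map reversal o₁) (map reversal o₂) λ v →
      sym (i-j≡0⇒i≡j _ _ (trans (sym (degree-difference o₁ o₂ v)) (i≡j⇒i-j≡0 (cong +_ (eul v)))))

    ∂⇒Eulerian : ∀ {o₁ o₂} → (∀ S → ∂ (edges G) (map reversal o₁) S ≡ ∂ (edges G) (map reversal o₂) S) → EulerianEquiv G o₁ o₂
    ∂⇒Eulerian {o₁} {o₂} eq v = +-injective (i-j≡0⇒i≡j (+ outDegD G o₁ o₂ v) (+ inDegD G o₁ o₂ v)
      (trans (degree-difference o₁ o₂ v) (i≡j⇒i-j≡0 (sym (eq (point v))))))

    walk-uncut : ∀ {allowed u v} → Walk G allowed u v → ∀ S → (∀ e → allowed e → Uncut (endpoints G e) S) → lookup S u ≡ lookup S v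
    walk-uncut stay         S un = refl
    walk-uncut (fwd e ok w) S un = trans (un e ok) (walk-uncut w S un)
    walk-uncut (bwd e ok w) S un = trans (sym (un e ok)) (walk-uncut w S un)

    -- Edges are tracked by index, since parallel edges have equal endpoints. Throughout the
    -- recursion every index is either still in js or already in ks.
    bridgeless⇒NoBridges : Bridgeless G → NoBridges (edges G) ([] {A = Edge (nv G)})
    bridgeless⇒NoBridges bl = subst (λ A → NoBridges A []) (sym (tabulate-∘ (endpoints G) λ e → e))
      (go (Vec.allFin (ne G)) [] λ e → inj₁ (∈-allFin⁺ e))
      where
      member : ∀ {k} {js : Vec (Fin (ne G)) k} {j} S → Inv (map (endpoints G) js) S → j ∈ js → Uncut (endpoints G j) S
      member S (un ∷ _)  (here refl) = un
      member S (_ ∷ inv) (there j∈)  = member S inv j∈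
      go : ∀ {k l} (js : Vec (Fin (ne G)) k) (ks : Vec (Fin (ne G)) l) → (∀ e → e ∈ js ⊎ e ∈ ks) →
        NoBridges (map (endpoints G) js) (map (endpoints G) ks)
      go []       ks cover = tt
      go (j ∷ js) ks cover = nonbridge , go js (j ∷ ks) λ e → move (cover e)
        where
        move : ∀ {e} → e ∈ j ∷ js ⊎ e ∈ ks → e ∈ js ⊎ e ∈ j ∷ ks
        move (inj₁ (here eq))  = inj₂ (here eq)
        move (inj₁ (there e∈)) = inj₁ e∈
        move (inj₂ e∈)         = inj₂ (there e∈)
        nonbridge : NonBridge (endpoints G j) (map (endpoints G) js) (map (endpoints G) ks)
        -- `Bridgeless` supplies only the double negation of a walk avoiding j. This is enough
        -- because `Uncut` is decidable.
        nonbridge S invA invB = decidable-stable (uncut? (endpoints G j) S) λ cut →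
          bl j λ walk → cut (walk-uncut walk S λ e e≢j → others e e≢j (cover e))
          where
          others : ∀ e → e ≢ j → e ∈ j ∷ js ⊎ e ∈ ks → Uncut (endpoints G e) S
          others e e≢j (inj₁ (here eq))  = contradiction eq e≢j
          others e e≢j (inj₁ (there e∈)) = member S invA e∈
          others e e≢j (inj₂ e∈)         = member S invB e∈

    module _ {k : ℕ} (cc : IsComponentCount G k) where
      private
        comp′ = proj₁ cc
        surjective′ = proj₁ (proj₂ cc)
        connects = proj₂ (proj₂ cc)
        open Components (components (edges G))

        respects′ : All (λ (a , b) → comp′ a ≡ comp′ b) (edges G)
        respects′ = All.tabulate⁺ λ e → Equivalence.from (connects (tl G e) (hd G e)) (fwd e tt stay)

        -- Each given component is an invariant set, so `joined` cannot lead out of it.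
        coarser : ∀ u v → comp u ≡ comp v → comp′ u ≡ comp′ v
        coarser u v eq = sym (class-∋ comp′ (trans
          (sym (joined u v eq (class comp′ (comp′ u)) (class-Inv respects′ (comp′ u)))) (class-∈ comp′ refl)))

        finer : ∀ u v → comp′ u ≡ comp′ v → comp u ≡ comp v
        finer u v eq = walk (Equivalence.to (connects u v) eq)
          where
          walk : ∀ {u v} → Walk G (λ _ → ⊤) u v → comp u ≡ comp v
          walk stay        = refl
          walk (fwd e _ w) = trans (All.tabulate⁻ respects e) (walk w)
          walk (bwd e _ w) = trans (sym (All.tabulate⁻ respects e)) (walk w)

        representative : ∀ j → ∃ λ v → comp′ v ≡ j
        representative j = let v , eq = surjective′ j in v , eq refl

        count≡k : count ≡ k
        count≡k = ℕ.≤-antisym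
          (F.injective⇒≤ {f = λ j → comp′ (proj₁ (surjective j))} λ {i} {j} eq →
            trans (sym (proj₂ (surjective i))) (trans (finer _ _ eq) (proj₂ (surjective j))))
          (F.injective⇒≤ {f = λ j → comp (proj₁ (representative j))} λ {i} {j} eq →
            trans (sym (proj₂ (representative i))) (trans (coarser _ _ eq) (proj₂ (representative j))))

      corank-cyclomatic : Corank (edges G) ([] {A = Edge (nv G)}) (cyclomatic G k)
      corank-cyclomatic q = trans
        (ΣB-cong (free (suc q) (ne G)) λ h → 𝟙-cong (div? (suc q) (edges G) h [] []) (div? (suc q) [] [] (edges G) h)
          (λ div S → subst (+ suc q ∣_) (+-comm (∂ (edges G) h S) 0ℤ) (div S))
          (λ div S → subst (+ suc q ∣_) (+-comm 0ℤ (∂ (edges G) h S)) (div S)))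
        (subst (Corank [] (edges G)) eq isCorank q)
        where
        -- Truncated subtraction is exact here: `euler` exhibits `nv G` as a summand of the minuend.
        eq : corank ≡ cyclomatic G k
        eq = begin
          corank                            ≡⟨ ℕ.m+n∸m≡n (nv G) corank ⟨
          nv G ℕ.+ corank ℕ.∸ nv G          ≡⟨ cong (ℕ._∸ nv G) euler ⟨
          ne G ℕ.+ count ℕ.∸ nv G           ≡⟨ cong (λ j → ne G ℕ.+ j ℕ.∸ nv G) count≡k ⟩
          cyclomatic G k                    ∎
          where open ≡-Reasoning

-- Flow counts as box sums and their decomposition over classes

module FlowCounts where
  open BoxSums
  open CutPairing
  open ClosedSets
  open LatticePoints
  open FreeFlows
  open DeletionContraction
  open Counting
  open GraphFlows
  open GraphStructure
  open import Defs
  open import Data.Nat as ℕ using (ℕ; suc)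
  import Data.Nat.Properties as ℕ
  open import Data.Integer using (ℤ; +_; 0ℤ; 1ℤ; _+_; _-_; _*_; -_; _≤_; +≤+)
  open import Data.Integer.Properties
  open import Data.Integer.Divisibility.Signed
  open import Data.Integer.Tactic.RingSolver using (solve-∀)
  open import Data.Bool using (true; false)
  open import Data.Fin using (Fin; toℕ)
  open import Data.Fin.Properties using (all?)
  open import Data.Fin.Subset using (Subset)
  open import Data.List using (List; []; _∷_; length; filter; allFin)
  import Data.List.Relation.Unary.All as AllL
  import Data.List.Relation.Unary.Any as AnyL
  open import Data.Product using (_×_; _,_; proj₁; proj₂)
  open import Data.Vec using (Vec; []; _∷_; lookup; map)
  open import Data.Vec.Properties using (lookup-map)
  open import Data.Vec.Relation.Unary.All as All using (All; []; _∷_)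
  import Data.Vec.Relation.Unary.All.Properties as All
  open import Data.Vec.Relation.Binary.Pointwise.Inductive using ([]; _∷_)
  open import Function using (_∘_)
  open import Relation.Nullary using (Dec; yes; no; contradiction)
  open import Relation.Nullary.Decidable using (_×-dec_; ¬?)
  open import Relation.Binary.PropositionalEquality using (_≡_; _≢_; refl; sym; trans; cong; subst)

  private variable
    ν n : ℕ

  private
    all-nonzero? : (h : Vec ℤ n) → Dec (All (_≢ 0ℤ) h)
    all-nonzero? = All.all? λ x → ¬? (x ≟ 0ℤ)

    nz-nonzero : ∀ p {h : Vec ℤ n} → h ∈B nz (suc p) n → All (_≢ 0ℤ) h
    nz-nonzero p []              = []
    nz-nonzero p ((1≤x , _) ∷ h∈) = (λ { refl → contradiction 1≤x λ { (+≤+ ()) } }) ∷ nz-nonzero p h∈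

    nz-InRange : ∀ p {h : Vec ℤ n} → h ∈B nz (suc p) n → InRange (+ suc p) h
    nz-InRange p []                        = []
    nz-InRange p {x ∷ _} ((1≤x , x<) ∷ h∈) =
      (≤-trans (≤-reflexive (*-zeroˡ (+ suc p))) (≤-trans (+≤+ ℕ.z≤n) 1≤x) ,
       ≤-trans (<⇒≤ x<) (≤-reflexive (sym (*-identityˡ (+ suc p))))) ∷ nz-InRange p h∈

    -- In the open box every edge carries both arcs, so total cyclicity is automatic. This is why
    -- the open counts of the representatives add up to all nowhere-zero flows modulo q.
    nz-TC : ∀ p (es : Vec (Edge ν) n) {h} → h ∈B nz (suc p) n → ∀ S → Clo (+ suc p) es h S → Inv es S
    nz-TC p []             []               S []         = []
    nz-TC p ((a , b) ∷ es) ((1≤x , x<) ∷ h∈) S (ce ∷ clo) = edge (lookup S a) (lookup S b) ce ∷ nz-TC p es h∈ S clo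
      where
      edge : ∀ s t → (s ≡ true → t ≡ false → _ ≡ + suc p) × (s ≡ false → t ≡ true → _ ≡ 0ℤ) → s ≡ t
      edge true  true  _       = refl
      edge false false _       = refl
      edge true  false (f , _) = contradiction x< (<-irrefl (f refl refl))
      edge false true  (_ , f) = contradiction (subst (1ℤ ≤_) (f refl refl) 1≤x) λ { (+≤+ ()) }

  count-nowhere-zero : ∀ p n {P : Vec (Fin (suc p)) n → Set} (P? : ∀ f → Dec (P f)) {D : Vec ℤ n → Set} (D? : ∀ h → Dec (D h)) →
    (∀ f → P f → (∀ e → toℕ (lookup f e) ≢ 0) × D (values f)) →
    (∀ f → (∀ e → toℕ (lookup f e) ≢ 0) → D (values f) → P f) →
    + length (filter P? (vecsOver (allFin (suc p)) n)) ≡ ΣB (nz (suc p) n) (𝟙 ∘ D?)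
  count-nowhere-zero p n P? {D} D? to from = trans
    (count-boxes (suc p) n P? w λ f → 𝟙-cong (P? f) (all-nonzero? (values f) ×-dec D? (values f))
      (λ pf → let nonzero , d = to f pf in All.map⁺ (All.lookup⁻ λ e eq → nonzero e (+-injective eq)) , d)
      (λ (nonzero , d) → from f (λ e eq → All.lookup⁺ (All.map⁻ nonzero) e (cong +_ eq)) d))
    (trans (ΣB-nowhere-zero p n w λ h ¬all → 𝟙-no (all-nonzero? h ×-dec D? h) (¬all ∘ proj₁))
      (ΣB-cong′ (nz (suc p) n) λ h h∈ → 𝟙-cong (all-nonzero? h ×-dec D? h) (D? h) proj₂ (λ d → nz-nonzero p h∈ , d)))
    where
    w : Vec ℤ n → ℤ
    w h = 𝟙 (all-nonzero? h ×-dec D? h)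

  module _ (G : Graph) where
    private
      es = edges G

    target : Orientation G → Subset (nv G) → ℤ
    target ρ = ∂ es (map reversal ρ)

    private
      module _ {q r : ℕ} (ρ : Orientation G) (f : Vec (Fin r) (ne G)) where
        flow : Fin (ne G) → ℤ
        flow e = + toℕ (lookup f e)

        values-lookup : ∀ e → lookup (values f) e ≡ flow e
        values-lookup e = lookup-map e (λ i → + toℕ i) f

        IntFlow⇒Meets : IsIntFlow G ρ flow → Meets es (target ρ) q (reflectV q ρ (values f))
        IntFlow⇒Meets isFlow S = trans (∂-reflectV q es ρ (values f) S)
          (trans (cong (λ z → z + target ρ S * + q)
            (∂-vanishes es (signed ρ (values f)) (λ v → trans (sym (netFlow-∂ G ρ (values f) values-lookup v)) (isFlow v)) S))
          (+-identityˡ _))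

        Meets⇒IntFlow : Meets es (target ρ) q (reflectV q ρ (values f)) → IsIntFlow G ρ flow
        Meets⇒IntFlow meets v = trans (netFlow-∂ G ρ (values f) values-lookup v)
          (≡-by-difference (trans (sym (∂-reflectV q es ρ (values f) (point v))) (meets (point v)))
            (lemma (∂ es (signed ρ (values f)) (point v)) (target ρ (point v) * + q)))
          where
          lemma : ∀ x y → x - 0ℤ ≡ x + y - y
          lemma = solve-∀

    φ̄ρ-box : ∀ ρ q → + φ̄ρ G ρ q ≡ ΣB (closed-box q (ne G)) (weight es (target ρ) q)
    φ̄ρ-box ρ q = trans
      (count-boxes (suc q) (ne G) _ (λ h → weight es (target ρ) q (reflectV q ρ h)) λ f →
        𝟙-cong (isIntFlow? G ρ _) (meets? es (target ρ) q _) (IntFlow⇒Meets ρ f) (Meets⇒IntFlow ρ f))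
      (ΣB-reflect q 0ℤ (suc q) refl ρ (weight es (target ρ) q))

    φρ-box : ∀ ρ p → + φρ G ρ (suc p) ≡ ΣB (nz (suc p) (ne G)) (weight es (target ρ) (suc p))
    φρ-box ρ p = trans
      (count-nowhere-zero p (ne G) _ (λ h → meets? es (target ρ) (suc p) (reflectV (suc p) ρ h))
        (λ f (nonzero , isFlow) → nonzero , IntFlow⇒Meets ρ f isFlow)
        (λ f nonzero meets → nonzero , Meets⇒IntFlow ρ f meets))
      (ΣB-reflect (suc p) 1ℤ p refl ρ (weight es (target ρ) (suc p)))

    φ-box : ∀ p → + φ G (suc p) ≡ Φ (suc p) es ([] {A = Edge (nv G)})
    φ-box p = count-nowhere-zero p (ne G) _ (λ h → div? (suc p) es h [] [])
      (λ f (nonzero , isFlow) → nonzero , λ S → subst (+ suc p ∣_) (sym (+-identityʳ (∂ es (values f) S)))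
        (∂-divisible es (values f) (λ v → subst (+ suc p ∣_) (net f v) (isFlow v)) S))
      (λ f nonzero div → nonzero , λ v → subst (+ suc p ∣_) (trans (+-identityʳ (∂ es (values f) (point v))) (sym (net f v))) (div (point v)))
      where
      net : ∀ f v → netFlow G (refOrientation G) (λ e → + toℕ (lookup f e)) v ≡ ∂ es (values f) (point v)
      net f v = trans (netFlow-∂ G (refOrientation G) (values f) (λ e → lookup-map e (λ i → + toℕ i) f) v)
        (cong (λ h → ∂ es h (point v)) (signed-true (values f)))

    -- At q = 1 divisibility is void, and the points of {0, 1}^E are exactly the orientations.
    numTC-box : + numTC G ≡ Ψ 1 es ([] {A = Edge (nv G)})
    numTC-box = count-orientations (ne G) (totallyCyclic? G) (λ h → 𝟙 (div? 1 es h [] [] ×-dec tc? 1ℤ es h [])) λ o →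
      𝟙-cong (totallyCyclic? G o) (div? 1 es (map reversal o) [] [] ×-dec tc? 1ℤ es (map reversal o) [])
        (λ tc → (λ S → divides (∂ es (map reversal o) S + 0ℤ) (sym (*-identityʳ _))) , TotallyCyclic⇒TC G tc)
        (λ (_ , tc) → TC⇒TotallyCyclic G tc)

    module _ {R : List (Orientation G)} (reps : IsTCRepresentatives G R) where
      private
        all-TC = proj₁ reps
        covers = proj₁ (proj₂ reps)
        distinct = proj₂ (proj₂ reps)

      -- Rounding h / q yields an orientation with boundary ∂ h / q, and the orientations with that boundary
      -- form one Eulerian class.
      representative-sum : ∀ p h → InRange (+ suc p) h →
        ΣL R (λ ρ → weight es (target ρ) (suc p) h) ≡ 𝟙 (div? (suc p) es h [] [] ×-dec tc? (+ suc p) es h ([] {A = Edge (nv G)}))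
      representative-sum p h h∈ = decide (div? (suc p) es h [] [] ×-dec tc? (+ suc p) es h [])
        where
        related : ∀ {ρ ρ′} → Meets es (target ρ) (suc p) h → Meets es (target ρ′) (suc p) h → EulerianEquiv G ρ ρ′
        related {ρ} {ρ′} meets meets′ = ∂⇒Eulerian G λ S → *-cancelʳ-≡ (target ρ S) (target ρ′ S) (+ suc p) (trans (sym (meets S)) (meets′ S))
        exists : Div (suc p) es h ([] {A = Edge (nv G)}) [] → TC (+ suc p) es h ([] {A = Edge (nv G)}) →
          AnyL.Any (λ ρ → Meets es (target ρ) (suc p) h) R
        exists div tc with integral-rounding (suc p) es h∈ {λ S → quotient (div S)} (λ S → trans (sym (+-identityʳ (∂ es h S))) (_∣_.equality (div S)))
        ... | y , y∈ , eq with ∈unit⇒reversal y y∈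
        ...   | o , refl = AnyL.map (λ {ρ} eul S → trans (scaled S) (cong (_* + suc p) (sym (Eulerian⇒∂ G eul S))))
          (covers o (TC⇒TotallyCyclic G (TC-unscale (suc p) es [] h∈ (reversal-InRange o) scaled tc)))
          where
          scaled : ∀ S → ∂ es h S ≡ target o S * + suc p
          scaled S = trans (trans (sym (+-identityʳ (∂ es h S))) (_∣_.equality (div S))) (cong (_* + suc p) (sym (eq S)))
        decide : (d : Dec (Div (suc p) es h [] [] × TC (+ suc p) es h ([] {A = Edge (nv G)}))) →
          ΣL R (λ ρ → weight es (target ρ) (suc p) h) ≡ 𝟙 d
        decide (yes (div , tc)) = ΣL-unique (λ ρ → meets? es (target ρ) (suc p) h) {EulerianEquiv G} related R distinct (exists div tc)
        decide (no ¬both) = ΣL-none (λ ρ → meets? es (target ρ) (suc p) h) R (AllL.map (λ {ρ} tc meets → ¬both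
          ((λ S → divides (target ρ S) (trans (+-identityʳ (∂ es h S)) (meets S))) ,
           TC-scale (suc p) es [] h∈ (reversal-InRange ρ) meets (TotallyCyclic⇒TC G tc))) all-TC)

      Ψ-decomposition : ∀ p → ΣL R (λ ρ → + φ̄ρ G ρ (suc p)) ≡ Ψ (suc p) es ([] {A = Edge (nv G)})
      Ψ-decomposition p = trans (ΣL-cong R λ ρ → φ̄ρ-box ρ (suc p))
        (trans (ΣL-ΣB-swap R (closed-box (suc p) (ne G)) λ ρ → weight es (target ρ) (suc p))
          (ΣB-cong′ (closed-box (suc p) (ne G)) λ h h∈ → representative-sum p h (∈closed-box (suc p) h∈)))

      Φ-decomposition : ∀ p → ΣL R (λ ρ → + φρ G ρ (suc p)) ≡ Φ (suc p) es ([] {A = Edge (nv G)})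
      Φ-decomposition p = trans (ΣL-cong R λ ρ → φρ-box ρ p)
        (trans (ΣL-ΣB-swap R (nz (suc p) (ne G)) λ ρ → weight es (target ρ) (suc p))
          (ΣB-cong′ (nz (suc p) (ne G)) λ h h∈ → trans (representative-sum p h (nz-InRange p h∈))
            (𝟙-cong (div? (suc p) es h [] [] ×-dec tc? (+ suc p) es h []) (div? (suc p) es h [] [])
              proj₁ (λ div → div , λ S _ clo → nz-TC p es h∈ S clo))))

-- Polynomials of the single orientations

module FlowPolynomials where
  open BoxSums
  open CutPairing
  open ClosedSets
  open FacePolynomials
  open LatticePoints
  open DeletionContraction
  open RationalPolynomials
  open Counting
  open GraphFlows
  open FlowCounts
  open import Defs
  open import Data.Nat as ℕ using (ℕ; zero; suc)
  import Data.Nat.Properties as ℕ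
  open import Data.Integer as ℤ using (ℤ; +_)
  import Data.Integer.Properties as ℤ
  open import Data.Rational using (ℚ; 1ℚ; _+_; _*_; ∣_∣)
  open import Data.Rational.Properties
  open import Data.Fin using (Fin; zero; suc)
  open import Data.List using (List; []; _∷_; length; lookup)
  open import Data.Product using (Σ; _,_)
  open import Data.Unit using (tt)
  open import Data.Vec using (Vec; []; _∷_; replicate)
  open import Data.Vec.Properties using (map-replicate)
  open import Data.Vec.Relation.Binary.Pointwise.Inductive using (Pointwise; []; _∷_)
  open import Function using (_∘_)
  open import Relation.Binary.PropositionalEquality using (_≡_; refl; sym; trans; cong; cong₂; module ≡-Reasoning)

  ι-ΣL : ∀ {X : Set} (xs : List X) (w : X → ℤ) → ι (ΣL xs w) ≡ sumℚ (λ i → ι (w (lookup xs i)))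
  ι-ΣL []       w = refl
  ι-ΣL (x ∷ xs) w = trans (ι-+ (w x) (ΣL xs w)) (cong (_+_ (ι (w x))) (ι-ΣL xs w))

  sumℚ-cong : ∀ {n} {x y : Fin n → ℚ} → (∀ i → x i ≡ y i) → sumℚ x ≡ sumℚ y
  sumℚ-cong {zero}  eq = refl
  sumℚ-cong {suc n} eq = cong₂ _+_ (eq zero) (sumℚ-cong (eq ∘ suc))

  ∣signPow∣ : ∀ n → ∣ signPow n ∣ ≡ 1ℚ
  ∣signPow∣ zero    = refl
  ∣signPow∣ (suc n) = trans (∣-p∣≡∣p∣ (signPow n)) (∣signPow∣ n)

  ∣signPow*ℕ∣ : ∀ n m → ∣ signPow n * ℕtoℚ m ∣ ≡ ℕtoℚ m
  ∣signPow*ℕ∣ n m = begin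
    ∣ signPow n * ℕtoℚ m ∣        ≡⟨ ∣p*q∣≡∣p∣*∣q∣ (signPow n) (ℕtoℚ m) ⟩
    ∣ signPow n ∣ * ∣ ℕtoℚ m ∣    ≡⟨ cong₂ _*_ (∣signPow∣ n) (0≤p⇒∣p∣≡p (nonNegative⁻¹ (ℕtoℚ m) {{normalize-nonNeg m 1}})) ⟩
    1ℚ * ℕtoℚ m                   ≡⟨ *-identityˡ (ℕtoℚ m) ⟩
    ℕtoℚ m                        ∎
    where open ≡-Reasoning

  module _ (G : Graph) (ρ : Orientation G) where
    private
      w = weight (edges G) (target G ρ)
      cube : Vec Face (ne G)
      cube = replicate (ne G) full

      -- The indicator of the edges reversed by ρ has the target boundary by definition. The flow
      -- polytope of ρ therefore has a vertex, which makes the closed count polynomial from q = 0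
      -- on.
      cube-vertex : Vertex (edges G) (target G ρ) cube ρ
      cube-vertex = compatible ρ , λ S → refl
        where
        compatible : ∀ {n} (o : Vec _ n) → Pointwise Compatible (replicate n full) o
        compatible []      = []
        compatible (x ∷ o) = tt ∷ compatible o

      interior : Poly₁ (ΣM (replicate (ne G) ⦅0,q⦆) w)
      interior = ΣM-polynomial (replicate (ne G) ⦅0,q⦆) w λ m _ → face-polynomial (edges G) (target G ρ) m

      solid : Poly₀ (ΣF cube w)
      solid = vertex-polynomial (edges G) (target G ρ) cube-vertex

      φ̄ρ-cube : ∀ q → ΣF cube w q ≡ + φ̄ρ G ρ q
      φ̄ρ-cube q = trans (cong (λ D → ΣB D (w q)) (map-replicate (domF q) full (ne G))) (sym (φ̄ρ-box G ρ q))

    φρ-polynomial : Σ Poly λ P → ∀ q → eval P (ℕtoℚ (suc q)) ≡ ℕtoℚ (φρ G ρ (suc q))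
    φρ-polynomial = newtonP 0 (Poly₁.coefficients interior) , λ q →
      trans (eval-newtonP 0 (Poly₁.coefficients interior) (suc q)) (cong ι (trans (Poly₁.agrees interior q)
        (trans (cong (λ D → ΣB D (w (suc q))) (map-replicate (dom (suc q)) ⦅0,q⦆ (ne G))) (sym (φρ-box G ρ q)))))

    φ̄ρ-polynomial : Σ Poly λ P → ∀ q → eval P (ℕtoℚ q) ≡ ℕtoℚ (φ̄ρ G ρ q)
    φ̄ρ-polynomial = newtonP 0 (Poly₀.coefficients solid) , λ q →
      trans (eval-newtonP 0 (Poly₀.coefficients solid) q) (cong ι (trans (Poly₀.agrees solid q) (φ̄ρ-cube q)))

    φ̄ρ-at-0 : φ̄ρ G ρ 0 ≡ 1
    φ̄ρ-at-0 = ℤ.+-injective (trans (sym (φ̄ρ-cube 0)) (at-0 (edges G) (target G ρ) cube))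

  φ̄-at-0 : ∀ G R → φ̄ G R 0 ≡ length R
  φ̄-at-0 G []      = refl
  φ̄-at-0 G (ρ ∷ R) = cong₂ ℕ._+_ (φ̄ρ-at-0 G ρ) (φ̄-at-0 G R)

-- Reciprocity, decomposition and the values at -1 and 0

open import Defs
open import Data.Nat using (ℕ; suc; _≤_)
open import Data.Integer using (+_)
open import Data.Rational using (ℚ; 0ℚ; 1ℚ; -_; _*_; ∣_∣)
open import Data.Fin using (Fin)
open import Data.List using (List; length; lookup)
open import Data.Product using (Σ; _×_; _,_; proj₁; proj₂)
open import Data.Vec using (toList; [])
open import Relation.Binary.PropositionalEquality using (_≡_; _≢_; refl; sym; trans; cong; module ≡-Reasoning)

open DeletionContraction using (Φ; Ψ)
open RationalPolynomials using (ι; sumP; eval-sumP; eval-unique)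
open Reciprocity using (Reciprocal; reciprocal)
open Counting using (ΣL; ΣL-sum)
open GraphFlows using (edges)
open GraphStructure using (bridgeless⇒NoBridges; corank-cyclomatic)
open FlowCounts using (φ-box; numTC-box; Φ-decomposition; Ψ-decomposition)
open FlowPolynomials

theorem1p2 : (G : Graph) → Bridgeless G →
    (k : ℕ) → IsComponentCount G k →
    (R : List (Orientation G)) → IsTCRepresentatives G R →
    Σ Poly λ P → Σ Poly λ P̄ →
    HasDegree P (cyclomatic G k) ×
    (∀ q → 1 ≤ q → eval P (ℕtoℚ q) ≡ ℕtoℚ (φ G q)) ×
    (∀ q → eval P̄ (ℕtoℚ q) ≡ ℕtoℚ (φ̄ G R q)) ×
    (∀ t → eval P (- t) ≡ signPow (cyclomatic G k) * eval P̄ t) ×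
    (Σ (Fin (length R) → Poly) λ Ps → Σ (Fin (length R) → Poly) λ P̄s →
    (∀ i q → 1 ≤ q → eval (Ps i) (ℕtoℚ q) ≡ ℕtoℚ (φρ G (lookup R i) q)) ×
    (∀ i q → eval (P̄s i) (ℕtoℚ q) ≡ ℕtoℚ (φ̄ρ G (lookup R i) q)) ×
    (∀ t → eval P t ≡ sumℚ (λ i → eval (Ps i) t)) ×
    (∀ t → eval P̄ t ≡ sumℚ (λ i → eval (P̄s i) t))) ×
    ∣ eval P (- 1ℚ) ∣ ≡ ℕtoℚ (numTC G) ×
    ∣ eval P 0ℚ ∣ ≡ ℕtoℚ (length R)
theorem1p2 G bridgeless k cc R reps =
  P , P̄ ,
  (p , refl , λ p≡0 → 1≢0 (trans (sym (monic (bridgeless⇒NoBridges G bridgeless))) p≡0)) ,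
  (λ { (suc q) _ → trans (counts q) (cong ι (sym (φ-box G q))) }) ,
  P̄-values , reflects ,
  (Ps , P̄s , (λ { i (suc q) _ → proj₂ (φρ-polynomial G (lookup R i)) q }) ,
    (λ i → proj₂ (φ̄ρ-polynomial G (lookup R i))) , P-sum , P̄-sum) ,
  -- Reciprocity at t = 1; the index 0 of `counts̄` means q = 1.
  trans (cong ∣_∣ (trans (reflects 1ℚ) (cong (signPow n *_) (trans (counts̄ 0) (cong ι (sym (numTC-box G)))))))
    (∣signPow*ℕ∣ n (numTC G)) ,
  -- Reciprocity at t = 0, as `- 0ℚ` computes to `0ℚ`. Each representative contributes 1 to P̄(0),
  -- namely its zero flow.
  trans (cong ∣_∣ (trans (reflects 0ℚ) (cong (signPow n *_) (trans (P̄-values 0) (cong ℕtoℚ (φ̄-at-0 G R))))))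
    (∣signPow*ℕ∣ n (length R))
  where
  open ≡-Reasoning
  n = cyclomatic G k
  open Reciprocal (reciprocal (edges G) [] {n} (corank-cyclomatic G cc))
  P P̄ : Poly
  P = toList p
  P̄ = toList p̄
  Ps P̄s : Fin (length R) → Poly
  Ps i  = proj₁ (φρ-polynomial G (lookup R i))
  P̄s i = proj₁ (φ̄ρ-polynomial G (lookup R i))
  1≢0 : 1ℚ ≢ 0ℚ
  1≢0 ()
  P-sum : ∀ t → eval P t ≡ sumℚ (λ i → eval (Ps i) t)
  P-sum t = trans (eval-unique P (sumP Ps) agree t) (eval-sumP Ps t)
    where
    agree : ∀ q → eval P (ℕtoℚ (suc q)) ≡ eval (sumP Ps) (ℕtoℚ (suc q))
    agree q = begin
      eval P (ℕtoℚ (suc q))                                ≡⟨ counts q ⟩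
      ι (Φ (suc q) (edges G) [])                           ≡⟨ cong ι (Φ-decomposition G reps q) ⟨
      ι (ΣL R (λ ρ → + φρ G ρ (suc q)))                    ≡⟨ ι-ΣL R (λ ρ → + φρ G ρ (suc q)) ⟩
      sumℚ (λ i → ℕtoℚ (φρ G (lookup R i) (suc q)))        ≡⟨ sumℚ-cong (λ i → proj₂ (φρ-polynomial G (lookup R i)) q) ⟨
      sumℚ (λ i → eval (Ps i) (ℕtoℚ (suc q)))              ≡⟨ eval-sumP Ps (ℕtoℚ (suc q)) ⟨
      eval (sumP Ps) (ℕtoℚ (suc q))                        ∎
  P̄s-sum : ∀ q → sumℚ (λ i → eval (P̄s i) (ℕtoℚ q)) ≡ ι (ΣL R (λ ρ → + φ̄ρ G ρ q))
  P̄s-sum q = trans (sumℚ-cong λ i → proj₂ (φ̄ρ-polynomial G (lookup R i)) q) (sym (ι-ΣL R (λ ρ → + φ̄ρ G ρ q)))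
  P̄-sum : ∀ t → eval P̄ t ≡ sumℚ (λ i → eval (P̄s i) t)
  P̄-sum t = trans (eval-unique P̄ (sumP P̄s) agree t) (eval-sumP P̄s t)
    where
    agree : ∀ q → eval P̄ (ℕtoℚ (suc q)) ≡ eval (sumP P̄s) (ℕtoℚ (suc q))
    agree q = begin
      eval P̄ (ℕtoℚ (suc q))                                ≡⟨ counts̄ q ⟩
      ι (Ψ (suc q) (edges G) [])                           ≡⟨ cong ι (Ψ-decomposition G reps q) ⟨
      ι (ΣL R (λ ρ → + φ̄ρ G ρ (suc q)))                    ≡⟨ P̄s-sum (suc q) ⟨
      sumℚ (λ i → eval (P̄s i) (ℕtoℚ (suc q)))              ≡⟨ eval-sumP P̄s (ℕtoℚ (suc q)) ⟨
      eval (sumP P̄s) (ℕtoℚ (suc q))                        ∎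
  -- `counts̄` starts at q = 1. The value at 0 is reached through `P̄-sum`, which holds for all
  -- arguments.
  P̄-values : ∀ q → eval P̄ (ℕtoℚ q) ≡ ℕtoℚ (φ̄ G R q)
  P̄-values q = trans (P̄-sum (ℕtoℚ q)) (trans (P̄s-sum q) (cong ι (sym (ΣL-sum (λ ρ → φ̄ρ G ρ q) R))))
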